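{- There exists a randomized distributed algorithm for the maximum coverage problem that, for any integer $r\ge1$ and any parameter $\varepsilon\in(0,1)$, with high probability computes an $\left(\frac{e}{e-1}+\varepsilon\right)$-approximation in $r$ rounds and with $\widetilde O\left(\frac{k}{\varepsilon^4}\cdot m^{O(1/(\varepsilon r))}+n\right)$ total communication.
   Context: Maximum coverage: given sets $S_1,\dots,S_m\subseteq[n]$ and an integer $k$, find $k$ of the sets whose union has maximum size; an $\alpha$-approximation is a choice of at most $k$ sets covering at least a $1/\alpha$ fraction of the optimum. Distributed (coordinator) model: the collection of sets is partitioned arbitrarily (adversarially) across $p$ machines. Computation proceeds in synchronous rounds: in each round all machines simultaneously send a message to a central coordinator, which then communicates back to all machines a summary for the next round; at the end of the last round the coordinator outputs the answer. Communication is measured in bits; $\widetilde O(\cdot)$ hides polylogarithmic factors. -}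

module Defs where

open import Data.Bool.Base using (Bool; if_then_else_)
open import Data.Fin.Base using (Fin)
import Data.Fin.Properties as Fin
open import Data.Fin.Subset using (Subset; inside; outside; ⋃; ∣_∣; _∉_)
open import Data.Fin.Subset.Properties using (_∈?_)
import Data.Integer.Base as ℤ
open import Data.List.Base as List using (List; []; _∷_; _++_; length)
open import Data.List.Extrema.Nat using (max)
open import Data.Maybe.Base using (Maybe; just; nothing)
open import Data.Nat.Base as ℕ using (ℕ; zero; suc; NonZero; _!; pred)
open import Data.Nat.Logarithm using (⌈log₂_⌉)
open import Data.Nat.Properties using (_≤?_; _!≢0)
open import Data.Product.Base using (Σ-syntax; ∃-syntax; _×_)
open import Data.Rational.Base as ℚ using (ℚ; 0ℚ; 1ℚ; _/_; ↥_; ↧ₙ_)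
open import Data.Sum.Base using (_⊎_)
open import Data.Vec.Base as Vec using (Vec; []; _∷_)
open import Algebra.Definitions.RawSemiring ℚ.+-*-rawSemiring using (_^_)
open import Relation.Binary.PropositionalEquality.Core using (_≡_)
open import Relation.Nullary.Decidable.Core using (does)
open import Relation.Nullary.Negation.Core using (¬_)

------------------------------------------------------------------------
-- Real numbers

-- Two-sided (located) Dedekind cuts: lower q means q < x, upper q means x < q.
record ℝ : Set₁ where
  field
    lower upper   : ℚ → Set
    lower-inhab   : ∃[ q ] lower q
    upper-inhab   : ∃[ q ] upper q
    lower-closed  : ∀ {p q} → p ℚ.< q → lower q → lower p
    upper-closed  : ∀ {p q} → p ℚ.< q → upper p → upper q
    lower-rounded : ∀ {p} → lower p → ∃[ q ] (p ℚ.< q × lower q)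
    upper-rounded : ∀ {q} → upper q → ∃[ p ] (p ℚ.< q × upper p)
    disjoint      : ∀ {q} → ¬ (lower q × upper q)
    located       : ∀ {p q} → p ℚ.< q → lower p ⊎ upper q

_<ʳ_ : ℚ → ℝ → Set
q <ʳ x = ℝ.lower x q

_ʳ<_ : ℝ → ℚ → Set
x ʳ< q = ℝ.upper x q

-- The right-hand sides of the approximation and communication bounds are
-- non-negative reals, needed only as upper bounds. Such a real is given by an
-- inhabited set of non-negative rationals whose infimum it is. Sums, products
-- and powers are then taken elementwise, since on [0,∞) each of these
-- operations is monotone and continuous in the arguments it is applied to.
Inf : Set₁
Inf = ℚ → Set

infix  4 _≤ⁱ_
infixl 6 _+ⁱ_
infixl 7 _*ⁱ_

_≤ⁱ_ : ℚ → Inf → Set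
x ≤ⁱ U = ∀ u → U u → x ℚ.≤ u

fromℕ : ℕ → ℚ
fromℕ n = (ℤ.+ n) / 1

⌜_⌝ : ℚ → Inf
⌜ x ⌝ q = q ≡ x

fromℝ : ℝ → Inf
fromℝ x q = x ʳ< q

_+ⁱ_ : Inf → Inf → Inf
(U +ⁱ V) q = ∃[ u ] ∃[ v ] (U u × V v × q ≡ u ℚ.+ v)

_*ⁱ_ : Inf → Inf → Inf
(U *ⁱ V) q = ∃[ u ] ∃[ v ] (U u × V v × q ≡ u ℚ.* v)

_^ⁱ_ : Inf → ℕ → Inf
(U ^ⁱ j) q = ∃[ u ] (U u × q ≡ u ^ j)

-- 1/x for x > 0: the infimum of 1/a over rationals 0 < a < x.
recip : ℝ → Inf
recip x q = ∃[ a ] (0ℚ ℚ.< a × a <ʳ x × q ℚ.* a ≡ 1ℚ)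

-- m raised to a real exponent E ≥ 0: t ≥ m^(a/b) is m^a ≤ t^b, and the
-- infimum is over such t ≥ 0 with a/b ranging over the rationals that define E.
power : ℕ → Inf → Inf
power m E t =
  ∃[ s ] (E s × 0ℚ ℚ.≤ t × fromℕ m ^ ℤ.∣ ↥ s ∣ ℚ.≤ t ^ ↧ₙ s)

-- 1/0! + 1/1! + … + 1/N!
expSum : ℕ → ℚ
expSum zero    = 1ℚ
expSum (suc N) = expSum N ℚ.+ _/_ (ℤ.+ 1) (suc N !) {{suc N !≢0}}

-- e/(e-1): as x ↦ x/(x-1) decreases on x > 1, it is the infimum of
-- s/(s-1) over the partial sums s of the series for e. The sum 1/0! is skipped
-- because there s - 1 = 0.
e/[e-1] : Inf
e/[e-1] q = ∃[ N ] (q ℚ.* (expSum (suc N) ℚ.- 1ℚ) ≡ expSum (suc N))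

------------------------------------------------------------------------
-- Maximum coverage

Sets : ℕ → ℕ → Set
Sets n m = Fin m → Subset n

covered : ∀ {n m} → Sets n m → Subset m → Subset n
covered S T = ⋃ (List.map S (List.filter (_∈? T) (List.allFin _)))

coverage : ∀ {n m} → Sets n m → Subset m → ℕ
coverage S T = ∣ covered S T ∣

allSubsets : ∀ m → List (Subset m)
allSubsets zero    = [] ∷ []
allSubsets (suc m) =
  List.map (outside ∷_) (allSubsets m) ++ List.map (inside ∷_) (allSubsets m)

-- Choosing at most k sets rather than exactly k does not change the maximum
-- when k ≤ m, and keeps it meaningful when k > m.
opt : ∀ {n m} → Sets n m → ℕ → ℕ
opt {m = m} S k =
  max 0 (List.map (coverage S) (List.filter (λ T → ∣ T ∣ ≤? k) (allSubsets m)))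

record IsApproximation {n m} (α : Inf) (S : Sets n m) (k : ℕ) (T : Subset m) : Set where
  field
    size  : ∣ T ∣ ℕ.≤ k
    ratio : fromℕ (opt S k) ≤ⁱ α *ⁱ ⌜ fromℕ (coverage S T) ⌝

------------------------------------------------------------------------
-- The coordinator model

Message : Set
Message = List Bool

-- What one machine holds: the sets assigned to it, with their indices.
View : ℕ → ℕ → Set
View n m = Fin m → Maybe (Subset n)

view : ∀ {n m p} → Sets n m → (Fin m → Fin p) → Fin p → View n m
view S owner i j = if does (owner j Fin.≟ i) then just (S j) else nothing

-- The seed is uniform on Fin seeds and visible to all parties. Private
-- randomness is the special case where each party looks only at its own part.
-- Histories list the most recent round first; their length is the number of
-- rounds completed. Local computation is not restricted.
record Protocol (n m p : ℕ) : Set where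
  field
    seeds       : ℕ
    {{seeds≢0}} : NonZero seeds
    machine     : Fin seeds → ∀ {t} → Fin p → View n m → Vec Message t → Message
    summary     : Fin seeds → ∀ {t} → Vec (Vec Message p) t → Message
    output      : Fin seeds → ∀ {t} → Vec (Vec Message p) t → Subset m

module Execution {n m p} (Π : Protocol n m p)
                 (S : Sets n m) (owner : Fin m → Fin p)
                 (s : Fin (Protocol.seeds Π)) where
  open Protocol Π

  mutual
    sent : ∀ t → Vec (Vec Message p) t
    sent zero    = []
    sent (suc t) =
      Vec.tabulate (λ i → machine s i (view S owner i) (heard t)) ∷ sent t

    heard : ∀ t → Vec Message t
    heard zero    = []
    heard (suc t) = summary s (sent (suc t)) ∷ heard t

  result : ℕ → Subset m
  result r = output s (sent r)

  -- Bits communicated in r rounds: every message to the coordinator, and the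
  -- summary (broadcast, hence counted once) after each round but the last.
  communication : ℕ → ℕ
  communication r =
    Vec.sum (Vec.map (λ ms → Vec.sum (Vec.map length ms)) (sent r))
    ℕ.+ Vec.sum (Vec.map length (heard (pred r)))

-- Everything the algorithm may depend on besides the input itself.
record Parameters : Set₁ where
  field
    n m k p r : ℕ
    ε         : ℝ
    {{r≢0}}   : NonZero r
    0<ε       : 0ℚ <ʳ ε
    ε<1       : ε ʳ< 1ℚ

Algorithm : Set₁
Algorithm = (P : Parameters) → Protocol (Parameters.n P) (Parameters.m P) (Parameters.p P)

-- The event has probability at least 1 - 1/N^d over the seed. It need not be
-- decidable, so its complement is enclosed in an explicit finite set.
WithHighProbability : ∀ {seeds} (N d : ℕ) → (Fin seeds → Set) → Set
WithHighProbability {seeds} N d Event =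
  Σ[ bad ∈ Subset seeds ]
    (∣ bad ∣ ℕ.* N ℕ.^ d ℕ.≤ seeds × (∀ s → s ∉ bad → Event s))

module _ (P : Parameters) where
  open Parameters P

  approximationFactor : Inf
  approximationFactor = e/[e-1] +ⁱ fromℝ ε

  -- C · (k/ε⁴ · m^(C/(εr)) + n) · (1 + ⌈log₂ (n + m)⌉)^C
  communicationBound : ℕ → Inf
  communicationBound C =
    ⌜ fromℕ C ⌝
    *ⁱ (⌜ fromℕ k ⌝ *ⁱ (recip ε ^ⁱ 4) *ⁱ power m (⌜ (ℤ.+ C) / r ⌝ *ⁱ recip ε)
        +ⁱ ⌜ fromℕ n ⌝)
    *ⁱ ⌜ fromℕ (suc ⌈log₂ (n ℕ.+ m) ⌉ ℕ.^ C) ⌝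

  record Succeeds (Π : Protocol n m p) (S : Sets n m) (owner : Fin m → Fin p)
                  (C : ℕ) (s : Fin (Protocol.seeds Π)) : Set where
    open Execution Π S owner s
    field
      approximates : IsApproximation approximationFactor S k (result r)
      bits         : fromℕ (communication r) ≤ⁱ communicationBound C

{-# OPTIONS --safe #-}
module Submission where

-- Hashing samples the universe at every rate 2^-j. At the rate where the optimum retains about
-- k log(n + m)/ε² elements, Chernoff bounds make the sampled coverage accurate to within ε for every choice
-- of k sets. The coordinator runs threshold greedy on every sample: the threshold descends in
-- O(1/ε) equal steps, and for each one a maximal collection of sets that still gain that much is
-- found by sample and prune. A set whose residual is much larger than the threshold takes part in
-- consecutive pieces of bounded size, so that a round costs only k/ε² times a power of the pruning factor.
-- For any fixed pair of coverings before and after a round, a random sample of the pieces hits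
-- every large family of pieces that remain useful; a covering is a union of at most k sets cut by
-- intervals, so there are few pairs and a union bound covers all adaptive executions at once. Hence the
-- total residual of the useful sets drops by the pruning factor in each round. With r rounds there
-- are about εr per threshold, which makes m^(O(1/(εr))) a sufficient factor; when this is less
-- than one, that power of m is at least m and all samples can be sent at once. The level is chosen by
-- the estimated coverage less the sampling error, which cannot be spuriously large.

open import Defs
open import Data.Bool.Base using (Bool; true; false; if_then_else_; _∧_; _∨_; T)
import Data.Bool.Properties as Bool
open import Data.Fin.Base as Fin using (Fin; zero; suc; toℕ; combine; quotient; remainder; _↑ˡ_; _↑ʳ_)
import Data.Fin.Properties as Fin
import Data.Fin.Subset as Subset
open import Data.Fin.Subset using (Subset; ∣_∣; _∩_; _∪_; _─_; ⋃; ⊥; ⊤; ⁅_⁆)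
import Data.Fin.Subset.Properties as Subset
import Data.Integer.Base as ℤ
import Data.Integer.Properties as ℤ
open import Data.List.Base as List using (List; []; _∷_; length)
open import Data.List.Extrema.Nat using (argmax; argmax-sel; f[xs]≤f[argmax]; xs≤max)
open import Data.List.Membership.Propositional using (_∈_)
import Data.List.Membership.Propositional.Properties as List
import Data.List.Properties as List
import Data.List.Relation.Unary.All as All
open import Data.List.Relation.Unary.Any using (here; there)
open import Data.Maybe.Base using (fromMaybe)
open import Data.Nat.Base
open import Data.Nat.DivMod using (_/_; _%_; m≡m%n+[m/n]*n; m%n<n; m/n*n≤m)
open import Data.Nat.Induction using (<-rec)
open import Data.Nat.Logarithm using (⌈log₂_⌉; ⌈log₂⌉-mono-≤; ⌈log₂⌈n/2⌉⌉≡⌈log₂n⌉∸1)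
open import Data.Nat.Properties
open import Data.Nat.Tactic.RingSolver using (solve-∀)
open import Data.Product.Base using (Σ-syntax; ∃-syntax; _×_; _,_; proj₁; proj₂)
open import Data.Rational.Base as ℚ using (ℚ; 0ℚ; 1ℚ; ½)
import Data.Rational.Properties as ℚ
open import Data.Rational.Solver using (module +-*-Solver)
open import Data.Rational.Unnormalised.Base as ℚᵘ using (mkℚᵘ; *≡*; *≤*)
import Data.Rational.Unnormalised.Properties as ℚᵘ
open import Data.Sum.Base using (_⊎_; inj₁; inj₂)
open import Data.Vec.Base as Vec using (Vec; []; _∷_; lookup; tabulate)
import Data.Vec.Properties as Vec
open import Function.Base using (_∘_; id; case_of_)
open import Relation.Binary.PropositionalEquality hiding ([_]; J)
open import Relation.Nullary using (¬_; Dec; yes; no; does)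
open import Relation.Nullary.Negation using (contradiction)
open import Algebra.Properties.Semiring.Sum +-*-semiring using (sum; sum-cong-≗; ∑-distrib-+; ∑-comm; *-distribˡ-sum; *-distribʳ-sum)
open import Algebra.Definitions.RawSemiring ℚ.+-*-rawSemiring using () renaming (_^_ to _^ᵠ_)

-- Elementary inequalities

-- Two obstacles shape the details. First, the bound forgives powers of log(n + m) but not of
-- log(1/ε), and the latter enters both the width of an element index and the union bound. About 1/ε
-- thresholds with k/ε² elements per round cost only k/ε³, so the fourth factor 1/ε can pay for
-- these two logarithms. Second, the union bound must range over coverings described without
-- reference to the history, although a piece is cut out of a residual. Replacing the residual by
-- the whole set changes nothing, since what is missing is already covered: k sets, each cut by an
-- interval, describe a covering, and the logarithm of the number of such descriptions, k times a
-- logarithm, is the additive error of the hash on pieces. Elements are copied before sampling, so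
-- that even a tiny optimum has a rate at which it retains enough of them. Probabilities are numbers
-- of seeds; accordingly the Chernoff bounds are integer inequalities, with the rational bases (a +
-- 1)/a and (a - 1)/a for the exponential moments and Bernoulli's inequality in place of calculus.

^-distribʳ-* : ∀ m n o → (m * n) ^ o ≡ m ^ o * n ^ o
^-distribʳ-* m n zero    = refl
^-distribʳ-* m n (suc o) = trans (cong (m * n *_) (^-distribʳ-* m n o)) (shuffle m n (m ^ o) (n ^ o))
  where
  shuffle : ∀ a b c d → a * b * (c * d) ≡ a * c * (b * d)
  shuffle = solve-∀

^-cancelˡ-≤ : ∀ e .{{_ : NonZero e}} {x y} → x ^ e ≤ y ^ e → x ≤ y
^-cancelˡ-≤ e {x} {y} xᵉ≤yᵉ with x ≤? y
... | yes x≤y = x≤y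
... | no  x≰y = contradiction xᵉ≤yᵉ (<⇒≱ (^-monoˡ-< e (≰⇒> x≰y)))

n≤2^n : ∀ n → n ≤ 2 ^ n
n≤2^n zero    = z≤n
n≤2^n (suc n) = begin
  suc n           ≤⟨ +-mono-≤ (m^n>0 2 n) (n≤2^n n) ⟩
  2 ^ n + 2 ^ n   ≡⟨ cong (2 ^ n +_) (sym (+-identityʳ (2 ^ n))) ⟩
  2 ^ suc n       ∎
  where open ≤-Reasoning

-- Bernoulli's (1 - 1/x)^M ≥ 1 - M/x with x = u + 1, arranged so that no subtraction occurs.
bernoulli-below : ∀ u M → suc u ^ M * suc u ≤ u ^ M * suc u + M * suc u ^ M
bernoulli-below u zero    = m≤m+n _ _
bernoulli-below u (suc M) = begin
  x * q * x                       ≡⟨ *-assoc x q x ⟩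
  x * (q * x)                     ≤⟨ *-monoʳ-≤ x (bernoulli-below u M) ⟩
  x * (p * x + M * q)             ≡⟨ expand u p q M ⟩
  u * p * x + M * (x * q) + p * x ≤⟨ +-monoʳ-≤ (u * p * x + M * (x * q)) (*-monoˡ-≤ x (^-monoˡ-≤ M (n≤1+n u))) ⟩
  u * p * x + M * (x * q) + q * x ≡⟨ collect u p q M ⟩
  u * p * x + (x * q + M * (x * q)) ∎
  where
  open ≤-Reasoning
  x = suc u ; p = u ^ M ; q = suc u ^ M
  expand : ∀ u p q M → suc u * (p * suc u + M * q) ≡ u * p * suc u + M * (suc u * q) + p * suc u
  expand = solve-∀
  collect : ∀ u p q M → u * p * suc u + M * (suc u * q) + q * suc u ≡ u * p * suc u + (suc u * q + M * (suc u * q))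
  collect = solve-∀

-- Bernoulli's (1 + 1/x)^M ≥ 1 + M/x with the denominators cleared.
bernoulli-above : ∀ x M → x ^ M * (x + M) ≤ suc x ^ M * x
bernoulli-above x zero    = ≤-reflexive (cong (1 *_) (+-identityʳ x))
bernoulli-above x (suc M) = begin
  x * p * (x + suc M)             ≡⟨ expand x p M ⟩
  x * (p * (x + M)) + p * x       ≤⟨ +-mono-≤ (*-monoʳ-≤ x (bernoulli-above x M)) (*-monoˡ-≤ x (^-monoˡ-≤ M (n≤1+n x))) ⟩
  x * (q * x) + q * x             ≡⟨ collect x q ⟩
  suc x * q * x                   ∎
  where
  open ≤-Reasoning
  p = x ^ M ; q = suc x ^ M
  expand : ∀ x p M → x * p * (x + suc M) ≡ x * (p * (x + M)) + p * x
  expand = solve-∀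
  collect : ∀ x q → x * (q * x) + q * x ≡ suc x * q * x
  collect = solve-∀

-- (1 - 1/b)^c ≥ 1 - 1/a whenever b = c a.
root-below : ∀ a .{{_ : NonZero a}} c .{{_ : NonZero c}} {u} → suc u ≡ c * a →
             (c * a) ^ c * a ≤ u ^ c * a + (c * a) ^ c
root-below a c {u} eq = *-cancelˡ-≤ c (begin
  c * ((c * a) ^ c * a)             ≡⟨ shuffle₁ c a ((c * a) ^ c) ⟩
  (c * a) ^ c * (c * a)             ≤⟨ subst (λ x → x ^ c * x ≤ u ^ c * x + c * x ^ c) eq (bernoulli-below u c) ⟩
  u ^ c * (c * a) + c * (c * a) ^ c ≡⟨ shuffle₂ c a (u ^ c) ((c * a) ^ c) ⟩
  c * (u ^ c * a + (c * a) ^ c)     ∎)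
  where
  open ≤-Reasoning
  shuffle₁ : ∀ c a p → c * (p * a) ≡ p * (c * a)
  shuffle₁ = solve-∀
  shuffle₂ : ∀ c a p q → p * (c * a) + c * q ≡ c * (p * a + q)
  shuffle₂ = solve-∀

-- (1 + 1/b)^c ≥ 1 + 1/a whenever b = c a.
root-above : ∀ a c .{{_ : NonZero c}} → (c * a) ^ c * suc a ≤ suc (c * a) ^ c * a
root-above a c = *-cancelˡ-≤ c (begin
  c * ((c * a) ^ c * suc a)         ≡⟨ shuffle₁ c a ((c * a) ^ c) ⟩
  (c * a) ^ c * (c * a + c)         ≤⟨ bernoulli-above (c * a) c ⟩
  suc (c * a) ^ c * (c * a)         ≡⟨ shuffle₂ c a (suc (c * a) ^ c) ⟩
  c * (suc (c * a) ^ c * a)         ∎)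
  where
  open ≤-Reasoning
  shuffle₁ : ∀ c a p → c * (p * suc a) ≡ p * (c * a + c)
  shuffle₁ = solve-∀
  shuffle₂ : ∀ c a p → p * (c * a) ≡ c * (p * a)
  shuffle₂ = solve-∀

2aᵃ≤[1+a]ᵃ : ∀ a .{{_ : NonZero a}} → 2 * a ^ a ≤ suc a ^ a
2aᵃ≤[1+a]ᵃ a = *-cancelʳ-≤ _ _ a (begin
  2 * a ^ a * a     ≡⟨ shuffle a (a ^ a) ⟩
  a ^ a * (a + a)   ≤⟨ bernoulli-above a a ⟩
  suc a ^ a * a     ∎)
  where
  open ≤-Reasoning
  shuffle : ∀ a p → 2 * p * a ≡ p * (a + a)
  shuffle = solve-∀

-- As (1 + 1/a)^a ≥ 2, every a units of surplus in the exponent gain a factor of two. This turns an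
-- additive deviation z of a sample count into a failure probability 2^-t.
2^z*a^≤[1+a]^ : ∀ a .{{_ : NonZero a}} {z t} → a * t ≤ z → 2 ^ t * a ^ z ≤ suc a ^ z
2^z*a^≤[1+a]^ a {z} {t} at≤z = begin
  2 ^ t * a ^ z                         ≡⟨ cong (λ y → 2 ^ t * a ^ y) (sym (m+[n∸m]≡n at≤z)) ⟩
  2 ^ t * a ^ (a * t + e)               ≡⟨ cong (2 ^ t *_) (^-distribˡ-+-* a (a * t) e) ⟩
  2 ^ t * (a ^ (a * t) * a ^ e)         ≡⟨ sym (*-assoc (2 ^ t) _ _) ⟩
  2 ^ t * a ^ (a * t) * a ^ e           ≡⟨ cong (λ y → 2 ^ t * y * a ^ e) (sym (^-*-assoc a a t)) ⟩
  2 ^ t * (a ^ a) ^ t * a ^ e           ≡⟨ cong (_* a ^ e) (sym (^-distribʳ-* 2 (a ^ a) t)) ⟩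
  (2 * a ^ a) ^ t * a ^ e               ≤⟨ *-mono-≤ (^-monoˡ-≤ t (2aᵃ≤[1+a]ᵃ a)) (^-monoˡ-≤ e (n≤1+n a)) ⟩
  (suc a ^ a) ^ t * suc a ^ e           ≡⟨ cong (_* suc a ^ e) (^-*-assoc (suc a) a t) ⟩
  suc a ^ (a * t) * suc a ^ e           ≡⟨ sym (^-distribˡ-+-* (suc a) (a * t) e) ⟩
  suc a ^ (a * t + e)                   ≡⟨ cong (suc a ^_) (m+[n∸m]≡n at≤z) ⟩
  suc a ^ z                             ∎
  where
  open ≤-Reasoning
  e = z ∸ a * t

[1+v]-square : ∀ v → suc (v * suc (suc v)) ≡ suc v * suc v
[1+v]-square = solve-∀

-- (1 - 1/a²)^a ≥ 1 - 1/a with a = 1 + v, after factoring 1 - 1/a².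
square-below : ∀ v → suc v ^ suc v * suc v ^ suc v * v ≤ suc (suc v) ^ suc v * v ^ suc v * suc v
square-below v = +-cancelʳ-≤ ((a * a) ^ a) _ _ (begin
  a ^ a * a ^ a * v + (a * a) ^ a        ≡⟨ cong (λ y → y * v + (a * a) ^ a) (sym (^-distribʳ-* a a a)) ⟩
  (a * a) ^ a * v + (a * a) ^ a          ≡⟨ shuffle ((a * a) ^ a) v ⟩
  (a * a) ^ a * a                        ≤⟨ root-below a a ([1+v]-square v) ⟩
  (v * suc a) ^ a * a + (a * a) ^ a      ≡⟨ cong (λ y → y * a + (a * a) ^ a) (trans (^-distribʳ-* v (suc a) a) (*-comm (v ^ a) _)) ⟩
  suc a ^ a * v ^ a * a + (a * a) ^ a    ∎)
  where
  open ≤-Reasoning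
  a = suc v
  shuffle : ∀ p v → p * v + p ≡ p * suc v
  shuffle = solve-∀

-- Exponential weights compared with powers of their mean

module _ (v M : ℕ) .{{_ : NonZero v}} .{{_ : NonZero M}} {u : ℕ} (u-eq : suc u ≡ M * suc v) where
  private
    a = suc v
    b = M * a

  private instance
    b≢0 : NonZero b
    b≢0 = m*n≢0 M a

  [1+b]u≤b² : suc b * u ≤ b * b
  [1+b]u≤b² = subst (λ x → suc x * u ≤ x * x) u-eq
    (≤-trans (n≤1+n _) (≤-reflexive (trans (cong suc (*-comm (suc (suc u)) u)) ([1+v]-square u))))

  -- (1 + 1/b)^M ≤ 1/(1 - 1/a), because (1 + 1/b)(1 - 1/b) ≤ 1.
  [1+b]^M-bound : suc b ^ M * v ≤ b ^ M * a
  [1+b]^M-bound = *-cancelʳ-≤ _ _ (b ^ M) {{m^n≢0 b M}} (begin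
    suc b ^ M * v * b ^ M           ≡⟨ shuffle₁ (suc b ^ M) v (b ^ M) ⟩
    suc b ^ M * (b ^ M * v)         ≤⟨ *-monoʳ-≤ (suc b ^ M) below ⟩
    suc b ^ M * (u ^ M * a)         ≡⟨ sym (*-assoc (suc b ^ M) _ _) ⟩
    suc b ^ M * u ^ M * a           ≡⟨ cong (_* a) (sym (^-distribʳ-* (suc b) u M)) ⟩
    (suc b * u) ^ M * a             ≤⟨ *-monoˡ-≤ a (^-monoˡ-≤ M [1+b]u≤b²) ⟩
    (b * b) ^ M * a                 ≡⟨ cong (_* a) (^-distribʳ-* b b M) ⟩
    b ^ M * b ^ M * a               ≡⟨ shuffle₂ (b ^ M) a ⟩
    b ^ M * a * b ^ M               ∎)
    where
    open ≤-Reasoning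
    shuffle₁ : ∀ p v q → p * v * q ≡ p * (q * v)
    shuffle₁ = solve-∀
    shuffle₂ : ∀ p q → p * p * q ≡ p * q * p
    shuffle₂ = solve-∀
    below : b ^ M * v ≤ u ^ M * a
    below = +-cancelʳ-≤ (b ^ M) _ _ (≤-trans (≤-reflexive (trans (+-comm _ (b ^ M)) (sym (*-suc (b ^ M) v)))) (root-below a M u-eq))

  -- (1 + 1/b)^(aM) ≤ (1 + 1/a)^(a+2)
  upper-exponent : suc b ^ (M * a) * a ^ (a + 2) ≤ suc a ^ (a + 2) * b ^ (M * a)
  upper-exponent = *-cancelʳ-≤ _ _ (v ^ a * a) {{m*n≢0 (v ^ a) a {{m^n≢0 v a}}}} (begin
    suc b ^ (M * a) * a ^ (a + 2) * (v ^ a * a)       ≡⟨ cong₂ (λ p q → p * q * (v ^ a * a)) (sym (^-*-assoc (suc b) M a)) (^-distribˡ-+-* a a 2) ⟩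
    (suc b ^ M) ^ a * (a ^ a * a ^ 2) * (v ^ a * a)   ≡⟨ shuffle₁ ((suc b ^ M) ^ a) (a ^ a * a ^ 2) (v ^ a) a ⟩
    (suc b ^ M) ^ a * v ^ a * (a ^ a * a ^ 2 * a)     ≡⟨ cong (_* (a ^ a * a ^ 2 * a)) (sym (^-distribʳ-* (suc b ^ M) v a)) ⟩
    (suc b ^ M * v) ^ a * (a ^ a * a ^ 2 * a)         ≤⟨ *-monoˡ-≤ (a ^ a * a ^ 2 * a) (^-monoˡ-≤ a [1+b]^M-bound) ⟩
    (b ^ M * a) ^ a * (a ^ a * a ^ 2 * a)             ≡⟨ cong (_* (a ^ a * a ^ 2 * a)) (^-distribʳ-* (b ^ M) a a) ⟩
    (b ^ M) ^ a * a ^ a * (a ^ a * a ^ 2 * a)         ≡⟨ shuffle₂ ((b ^ M) ^ a) (a ^ a) a ⟩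
    (b ^ M) ^ a * (a ^ a * a ^ a * (a * a * a))       ≤⟨ *-monoʳ-≤ ((b ^ M) ^ a) (*-monoʳ-≤ (a ^ a * a ^ a) cubic) ⟩
    (b ^ M) ^ a * (a ^ a * a ^ a * (v * (suc a * suc a))) ≡⟨ cong ((b ^ M) ^ a *_) (sym (*-assoc (a ^ a * a ^ a) v _)) ⟩
    (b ^ M) ^ a * (a ^ a * a ^ a * v * (suc a * suc a)) ≤⟨ *-monoʳ-≤ ((b ^ M) ^ a) (*-monoˡ-≤ (suc a * suc a) (square-below v)) ⟩
    (b ^ M) ^ a * (suc a ^ a * v ^ a * a * (suc a * suc a)) ≡⟨ shuffle₃ ((b ^ M) ^ a) (suc a ^ a) (v ^ a) a ⟩
    suc a ^ a * suc a ^ 2 * (b ^ M) ^ a * (v ^ a * a) ≡⟨ cong₂ (λ p q → p * q * (v ^ a * a)) (sym (^-distribˡ-+-* (suc a) a 2)) (^-*-assoc b M a) ⟩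
    suc a ^ (a + 2) * b ^ (M * a) * (v ^ a * a)       ∎)
    where
    open ≤-Reasoning
    shuffle₁ : ∀ p q r s → p * q * (r * s) ≡ p * r * (q * s)
    shuffle₁ = solve-∀
    shuffle₂ : ∀ p q a → p * q * (q * (a * (a * 1)) * a) ≡ p * (q * q * (a * a * a))
    shuffle₂ = solve-∀
    shuffle₃ : ∀ p q r a → p * (q * r * a * (suc a * suc a)) ≡ q * (suc a * (suc a * 1)) * p * (r * a)
    shuffle₃ = solve-∀
    -- (a - 1)(a + 1)² = a³ + a² - a - 1, and a² ≥ a + 1 because a ≥ 2. With the exponent a + 1 in
    -- place of a + 2 this step would ask for a² ≤ a² - 1.
    cubic : a * a * a ≤ v * (suc a * suc a)
    cubic = begin
      a * a * a                                     ≡⟨ expand v ⟩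
      v * v * v + 3 * (v * v) + 3 * v + 1           ≤⟨ +-monoʳ-≤ (v * v * v + 3 * (v * v) + 3 * v) (≤-trans (>-nonZero⁻¹ v) (m≤n+m v (v * v))) ⟩
      v * v * v + 3 * (v * v) + 3 * v + (v * v + v) ≡⟨ collect v ⟩
      v * (suc a * suc a)                           ∎
      where
      expand : ∀ v → suc v * suc v * suc v ≡ v * v * v + 3 * (v * v) + 3 * v + 1
      expand = solve-∀
      collect : ∀ v → v * v * v + 3 * (v * v) + 3 * v + (v * v + v) ≡ v * (suc (suc v) * suc (suc v))
      collect = solve-∀

  -- (1 - 1/b)^(-aM) ≥ (1 - 1/a)^(-(a-1))
  lower-exponent : a ^ v * u ^ (M * a) ≤ v ^ v * b ^ (M * a)
  lower-exponent = *-cancelʳ-≤ _ _ (suc a ^ a) {{m^n≢0 (suc a) a}} (begin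
    a ^ v * u ^ (M * a) * suc a ^ a            ≡⟨ cong (λ p → a ^ v * p * suc a ^ a) (sym (^-*-assoc u M a)) ⟩
    a ^ v * (u ^ M) ^ a * suc a ^ a            ≡⟨ shuffle₁ (a ^ v) ((u ^ M) ^ a) (suc a ^ a) ⟩
    a ^ v * ((u ^ M) ^ a * suc a ^ a)          ≡⟨ cong (a ^ v *_) (sym (^-distribʳ-* (u ^ M) (suc a) a)) ⟩
    a ^ v * (u ^ M * suc a) ^ a                ≤⟨ *-monoʳ-≤ (a ^ v) (^-monoˡ-≤ a reciprocal) ⟩
    a ^ v * (b ^ M * a) ^ a                    ≡⟨ cong (a ^ v *_) (^-distribʳ-* (b ^ M) a a) ⟩
    a ^ v * ((b ^ M) ^ a * a ^ a)              ≡⟨ shuffle₂ (a ^ v) ((b ^ M) ^ a) (a ^ a) ⟩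
    (b ^ M) ^ a * (a ^ v * a ^ a)              ≤⟨ *-monoʳ-≤ ((b ^ M) ^ a) powers ⟩
    (b ^ M) ^ a * (suc a ^ a * v ^ v)          ≡⟨ shuffle₃ ((b ^ M) ^ a) (suc a ^ a) (v ^ v) ⟩
    v ^ v * (b ^ M) ^ a * suc a ^ a            ≡⟨ cong (λ p → v ^ v * p * suc a ^ a) (^-*-assoc b M a) ⟩
    v ^ v * b ^ (M * a) * suc a ^ a            ∎)
    where
    open ≤-Reasoning
    shuffle₁ : ∀ p q r → p * q * r ≡ p * (q * r)
    shuffle₁ = solve-∀
    shuffle₂ : ∀ p q r → p * (q * r) ≡ q * (p * r)
    shuffle₂ = solve-∀
    shuffle₃ : ∀ p q r → p * (q * r) ≡ r * p * q
    shuffle₃ = solve-∀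
    powers : a ^ v * a ^ a ≤ suc a ^ a * v ^ v
    powers = *-cancelʳ-≤ _ _ (a * v) {{m*n≢0 a v}} (begin
      a ^ v * a ^ a * (a * v)        ≡⟨ p₁ (a ^ v) (a ^ a) a v ⟩
      a * a ^ v * a ^ a * v          ≤⟨ square-below v ⟩
      suc a ^ a * (v * v ^ v) * a    ≡⟨ p₂ (suc a ^ a) (v ^ v) a v ⟩
      suc a ^ a * v ^ v * (a * v)    ∎)
      where
      p₁ : ∀ p q a v → p * q * (a * v) ≡ a * p * q * v
      p₁ = solve-∀
      p₂ : ∀ p q a v → p * (v * q) * a ≡ p * q * (a * v)
      p₂ = solve-∀
    reciprocal : u ^ M * suc a ≤ b ^ M * a
    reciprocal = *-cancelʳ-≤ _ _ (b ^ M) {{m^n≢0 b M}} (begin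
      u ^ M * suc a * b ^ M           ≡⟨ p₁ (u ^ M) (suc a) (b ^ M) ⟩
      u ^ M * (b ^ M * suc a)         ≤⟨ *-monoʳ-≤ (u ^ M) (root-above a M) ⟩
      u ^ M * (suc b ^ M * a)         ≡⟨ p₂ (u ^ M) (suc b ^ M) a ⟩
      suc b ^ M * u ^ M * a           ≡⟨ cong (_* a) (sym (^-distribʳ-* (suc b) u M)) ⟩
      (suc b * u) ^ M * a             ≤⟨ *-monoˡ-≤ a (^-monoˡ-≤ M [1+b]u≤b²) ⟩
      (b * b) ^ M * a                 ≡⟨ cong (_* a) (^-distribʳ-* b b M) ⟩
      b ^ M * b ^ M * a               ≡⟨ p₃ (b ^ M) a ⟩
      b ^ M * a * b ^ M               ∎)
      where
      p₁ : ∀ p v q → p * v * q ≡ p * (q * v)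
      p₁ = solve-∀
      p₂ : ∀ p q r → p * (q * r) ≡ q * p * r
      p₂ = solve-∀
      p₃ : ∀ p q → p * p * q ≡ p * q * p
      p₃ = solve-∀

  -- ((a+1)/a)^X ≥ 2^t (1 + 1/b)^n once X exceeds (1 + 2/a) n/M by at least a t.
  upper-weight : ∀ {n X z t} → a * t ≤ z → (a + 2) * n + M * a * z ≤ M * a * X →
                 2 ^ t * suc b ^ n * a ^ X ≤ suc a ^ X * b ^ n
  upper-weight {n} {X} {z} {t} at≤z large = begin
    2 ^ t * suc b ^ n * a ^ X             ≡⟨ cong (λ y → 2 ^ t * suc b ^ n * a ^ y) (sym X≡) ⟩
    2 ^ t * suc b ^ n * a ^ (Y + z)       ≡⟨ cong (2 ^ t * suc b ^ n *_) (^-distribˡ-+-* a Y z) ⟩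
    2 ^ t * suc b ^ n * (a ^ Y * a ^ z)   ≡⟨ p₁ (2 ^ t) (suc b ^ n) (a ^ Y) (a ^ z) ⟩
    suc b ^ n * a ^ Y * (2 ^ t * a ^ z)   ≤⟨ *-mono-≤ root (2^z*a^≤[1+a]^ a at≤z) ⟩
    suc a ^ Y * b ^ n * suc a ^ z         ≡⟨ p₂ (suc a ^ Y) (b ^ n) (suc a ^ z) ⟩
    suc a ^ Y * suc a ^ z * b ^ n         ≡⟨ cong (_* b ^ n) (sym (^-distribˡ-+-* (suc a) Y z)) ⟩
    suc a ^ (Y + z) * b ^ n               ≡⟨ cong (λ y → suc a ^ y * b ^ n) X≡ ⟩
    suc a ^ X * b ^ n                     ∎
    where
    open ≤-Reasoning
    p₁ : ∀ p q r s → p * q * (r * s) ≡ q * r * (p * s)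
    p₁ = solve-∀
    p₂ : ∀ p q r → p * q * r ≡ p * r * q
    p₂ = solve-∀
    z≤X : z ≤ X
    z≤X = *-cancelˡ-≤ b (≤-trans (m≤n+m _ _) large)
    Y = X ∸ z
    X≡ : Y + z ≡ X
    X≡ = m∸n+n≡m z≤X
    base : (a + 2) * n ≤ b * Y
    base = +-cancelʳ-≤ (b * z) _ _ (≤-trans large (≤-reflexive (trans (cong (b *_) (sym X≡)) (*-distribˡ-+ b Y z))))
    f = b * Y ∸ (a + 2) * n
    f≡ : (a + 2) * n + f ≡ b * Y
    f≡ = m+[n∸m]≡n base
    -- (a + 2) n / b need not be an integer. After taking b-th powers both sides are n-th powers of
    -- `upper-exponent`, up to the surplus f, which favours the larger base.
    root : suc b ^ n * a ^ Y ≤ suc a ^ Y * b ^ n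
    root = ^-cancelˡ-≤ b (begin
      (suc b ^ n * a ^ Y) ^ b                             ≡⟨ ^-distribʳ-* (suc b ^ n) (a ^ Y) b ⟩
      (suc b ^ n) ^ b * (a ^ Y) ^ b                       ≡⟨ cong₂ _*_ (swap (suc b) n) (trans (^-*-assoc a Y b) (cong (a ^_) (trans (*-comm Y b) (sym f≡)))) ⟩
      (suc b ^ b) ^ n * a ^ ((a + 2) * n + f)             ≡⟨ cong ((suc b ^ b) ^ n *_) (trans (^-distribˡ-+-* a ((a + 2) * n) f) (cong (_* a ^ f) (sym (^-*-assoc a (a + 2) n)))) ⟩
      (suc b ^ b) ^ n * ((a ^ (a + 2)) ^ n * a ^ f)       ≡⟨ trans (sym (*-assoc ((suc b ^ b) ^ n) _ _)) (cong (_* a ^ f) (sym (^-distribʳ-* (suc b ^ b) (a ^ (a + 2)) n))) ⟩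
      (suc b ^ b * a ^ (a + 2)) ^ n * a ^ f               ≤⟨ *-mono-≤ (^-monoˡ-≤ n upper-exponent) (^-monoˡ-≤ f (n≤1+n a)) ⟩
      (suc a ^ (a + 2) * b ^ b) ^ n * suc a ^ f           ≡⟨ cong (_* suc a ^ f) (^-distribʳ-* (suc a ^ (a + 2)) (b ^ b) n) ⟩
      (suc a ^ (a + 2)) ^ n * (b ^ b) ^ n * suc a ^ f     ≡⟨ p₂ ((suc a ^ (a + 2)) ^ n) ((b ^ b) ^ n) (suc a ^ f) ⟩
      (suc a ^ (a + 2)) ^ n * suc a ^ f * (b ^ b) ^ n     ≡⟨ cong₂ (λ p q → p * suc a ^ f * q) (^-*-assoc (suc a) (a + 2) n) (sym (swap b n)) ⟩
      suc a ^ ((a + 2) * n) * suc a ^ f * (b ^ n) ^ b     ≡⟨ cong (_* (b ^ n) ^ b) (trans (sym (^-distribˡ-+-* (suc a) ((a + 2) * n) f)) (trans (cong (suc a ^_) (trans f≡ (*-comm b Y))) (sym (^-*-assoc (suc a) Y b)))) ⟩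
      (suc a ^ Y) ^ b * (b ^ n) ^ b                       ≡⟨ sym (^-distribʳ-* (suc a ^ Y) (b ^ n) b) ⟩
      (suc a ^ Y * b ^ n) ^ b                             ∎)
      where
      swap : ∀ x e → (x ^ e) ^ b ≡ (x ^ b) ^ e
      swap x e = trans (^-*-assoc x e b) (trans (cong (x ^_) (*-comm e b)) (sym (^-*-assoc x b e)))

  -- The mirror image of `upper-weight`, for X at least z below (1 - 1/a) n/M: the base (a - 1)/a is
  -- less than one, so a small X makes the weight large.
  lower-weight : ∀ {n X z t} → a * t ≤ z → M * a * X + M * a * z ≤ v * n →
                 2 ^ t * u ^ n * a ^ X ≤ v ^ X * b ^ n
  lower-weight {n} {X} {z} {t} at≤z small = *-cancelʳ-≤ _ _ (v ^ z) {{m^n≢0 v z}} (begin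
    2 ^ t * u ^ n * a ^ X * v ^ z         ≡⟨ p₁ (2 ^ t) (u ^ n) (a ^ X) (v ^ z) ⟩
    2 ^ t * v ^ z * (a ^ X * u ^ n)       ≤⟨ *-monoˡ-≤ (a ^ X * u ^ n) half ⟩
    a ^ z * (a ^ X * u ^ n)               ≡⟨ p₂ (a ^ z) (a ^ X) (u ^ n) ⟩
    a ^ X * a ^ z * u ^ n                 ≡⟨ cong (_* u ^ n) (sym (^-distribˡ-+-* a X z)) ⟩
    a ^ (X + z) * u ^ n                   ≤⟨ root ⟩
    v ^ (X + z) * b ^ n                   ≡⟨ cong (_* b ^ n) (^-distribˡ-+-* v X z) ⟩
    v ^ X * v ^ z * b ^ n                 ≡⟨ p₃ (v ^ X) (v ^ z) (b ^ n) ⟩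
    v ^ X * b ^ n * v ^ z                 ∎)
    where
    open ≤-Reasoning
    p₁ : ∀ p q r s → p * q * r * s ≡ p * s * (r * q)
    p₁ = solve-∀
    p₂ : ∀ p q r → p * (q * r) ≡ q * p * r
    p₂ = solve-∀
    p₃ : ∀ p q r → p * q * r ≡ p * r * q
    p₃ = solve-∀
    half : 2 ^ t * v ^ z ≤ a ^ z
    half = 2^z*a^≤[1+a]^ v (≤-trans (*-monoˡ-≤ t (n≤1+n v)) at≤z)
    Y = X + z
    base : b * Y ≤ v * n
    base = ≤-trans (≤-reflexive (*-distribˡ-+ b X z)) small
    f = v * n ∸ b * Y
    f≡ : b * Y + f ≡ v * n
    f≡ = m+[n∸m]≡n base
    root : a ^ Y * u ^ n ≤ v ^ Y * b ^ n
    root = ^-cancelˡ-≤ b (*-cancelʳ-≤ _ _ (v ^ f) {{m^n≢0 v f}} (begin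
      (a ^ Y * u ^ n) ^ b * v ^ f                   ≤⟨ *-monoʳ-≤ ((a ^ Y * u ^ n) ^ b) (^-monoˡ-≤ f (n≤1+n v)) ⟩
      (a ^ Y * u ^ n) ^ b * a ^ f                   ≡⟨ cong (_* a ^ f) (^-distribʳ-* (a ^ Y) (u ^ n) b) ⟩
      (a ^ Y) ^ b * (u ^ n) ^ b * a ^ f             ≡⟨ p₃ ((a ^ Y) ^ b) ((u ^ n) ^ b) (a ^ f) ⟩
      (a ^ Y) ^ b * a ^ f * (u ^ n) ^ b             ≡⟨ cong₂ _*_ (exponents a) (swap u n) ⟩
      (a ^ v) ^ n * (u ^ b) ^ n                     ≡⟨ sym (^-distribʳ-* (a ^ v) (u ^ b) n) ⟩
      (a ^ v * u ^ b) ^ n                           ≤⟨ ^-monoˡ-≤ n lower-exponent ⟩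
      (v ^ v * b ^ b) ^ n                           ≡⟨ ^-distribʳ-* (v ^ v) (b ^ b) n ⟩
      (v ^ v) ^ n * (b ^ b) ^ n                     ≡⟨ cong₂ _*_ (sym (exponents v)) (sym (swap b n)) ⟩
      (v ^ Y) ^ b * v ^ f * (b ^ n) ^ b             ≡⟨ p₃ ((v ^ Y) ^ b) (v ^ f) ((b ^ n) ^ b) ⟩
      (v ^ Y) ^ b * (b ^ n) ^ b * v ^ f             ≡⟨ cong (_* v ^ f) (sym (^-distribʳ-* (v ^ Y) (b ^ n) b)) ⟩
      (v ^ Y * b ^ n) ^ b * v ^ f                   ∎))
      where
      swap : ∀ x e → (x ^ e) ^ b ≡ (x ^ b) ^ e
      swap x e = trans (^-*-assoc x e b) (trans (cong (x ^_) (*-comm e b)) (sym (^-*-assoc x b e)))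
      exponents : ∀ x → (x ^ Y) ^ b * x ^ f ≡ (x ^ v) ^ n
      exponents x = trans (cong (_* x ^ f) (trans (^-*-assoc x Y b) (cong (x ^_) (*-comm Y b))))
        (trans (sym (^-distribˡ-+-* x (b * Y) f)) (trans (cong (x ^_) f≡) (sym (^-*-assoc x v n))))

-- Finite sums and counting

sum-mono : ∀ {n} {f g : Fin n → ℕ} → (∀ i → f i ≤ g i) → sum f ≤ sum g
sum-mono {zero}  f≤g = z≤n
sum-mono {suc n} f≤g = +-mono-≤ (f≤g zero) (sum-mono (f≤g ∘ suc))

sum-const : ∀ n c → sum {n} (λ _ → c) ≡ n * c
sum-const zero    c = refl
sum-const (suc n) c = cong (c +_) (sum-const n c)

term≤sum : ∀ {n} (f : Fin n → ℕ) i → f i ≤ sum f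
term≤sum f zero    = m≤m+n _ _
term≤sum f (suc i) = ≤-trans (term≤sum (f ∘ suc) i) (m≤n+m _ (f zero))

sum-++ : ∀ a b (f : Fin (a + b) → ℕ) → sum f ≡ sum (f ∘ (_↑ˡ b)) + sum (f ∘ (a ↑ʳ_))
sum-++ zero    b f = refl
sum-++ (suc a) b f = trans (cong (f zero +_) (sum-++ a b (f ∘ suc))) (sym (+-assoc (f zero) _ _))

sum-combine : ∀ m n (f : Fin (m * n) → ℕ) → sum f ≡ sum {m} (λ i → sum {n} (λ j → f (combine i j)))
sum-combine zero    n f = refl
sum-combine (suc m) n f = trans (sum-++ n (m * n) f) (cong (sum (f ∘ (_↑ˡ (m * n))) +_) (sum-combine m n (f ∘ (n ↑ʳ_))))

quotient-combine : ∀ {m n} (i : Fin m) (j : Fin n) → quotient n (combine i j) ≡ i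
quotient-combine i j = cong proj₁ (Fin.remQuot-combine i j)

remainder-combine : ∀ {m n} (i : Fin m) (j : Fin n) → remainder {m} n (combine i j) ≡ j
remainder-combine i j = cong proj₂ (Fin.remQuot-combine i j)

sum-remQuot : ∀ m n (f : Fin m → Fin n → ℕ) →
              sum {m * n} (λ e → f (quotient n e) (remainder {m} n e)) ≡ sum (λ i → sum (f i))
sum-remQuot m n f = trans (sum-combine m n _) (sum-cong-≗ (λ i → sum-cong-≗ (λ j →
  cong₂ f (quotient-combine i j) (remainder-combine i j))))

indicator : Bool → ℕ
indicator true  = 1
indicator false = 0

tally : ∀ {n} → (Fin n → Bool) → ℕ
tally P = sum (indicator ∘ P)

indicator≤1 : ∀ b → indicator b ≤ 1
indicator≤1 true  = ≤-refl
indicator≤1 false = z≤n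

indicator-∨ : ∀ b c → indicator (b ∨ c) ≤ indicator b + indicator c
indicator-∨ true  c = s≤s z≤n
indicator-∨ false c = ≤-refl

∣tabulate∣ : ∀ {n} (P : Fin n → Bool) → ∣ tabulate P ∣ ≡ tally P
∣tabulate∣ {zero}  P = refl
∣tabulate∣ {suc n} P with P zero
... | true  = cong suc (∣tabulate∣ (P ∘ suc))
... | false = ∣tabulate∣ (P ∘ suc)

∣∣≡sum : ∀ {n} (A : Subset n) → ∣ A ∣ ≡ sum (indicator ∘ lookup A)
∣∣≡sum []          = refl
∣∣≡sum (true ∷ A)  = cong suc (∣∣≡sum A)
∣∣≡sum (false ∷ A) = ∣∣≡sum A

sum-below : ∀ W h b c → h ≤ W → sum {W} (λ y → if toℕ y <ᵇ h then b else c) ≡ h * b + (W ∸ h) * c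
sum-below W       zero    b c h≤W       = sum-const W c
sum-below (suc W) (suc h) b c (s≤s h≤W) = trans (cong (b +_) (sum-below W h b c h≤W)) (sym (+-assoc b _ _))

≤ᵇ-true : ∀ {m n} → m ≤ n → (m ≤ᵇ n) ≡ true
≤ᵇ-true {m} {n} p with m ≤ᵇ n | ≤⇒≤ᵇ p
... | true | _ = refl

≤ᵇ-true⁻¹ : ∀ {m n} → (m ≤ᵇ n) ≡ true → m ≤ n
≤ᵇ-true⁻¹ {m} {n} eq = ≤ᵇ⇒≤ m n (subst T (sym eq) _)

≤ᵇ-false⁻¹ : ∀ {m n} → (m ≤ᵇ n) ≡ false → n < m
≤ᵇ-false⁻¹ eq = ≰⇒> (λ p → case trans (sym eq) (≤ᵇ-true p) of λ ())

-- Hashing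

-- A seed is N independent uniform values below W, read as the digits of one number, so that sums
-- over seeds factor digit by digit. Each position is hit with probability h/W.
hits : ∀ W h N → Fin (W ^ N) → Subset N
hits W h zero    e = []
hits W h (suc N) e = (toℕ (quotient {W} (W ^ N) e) <ᵇ h) ∷ hits W h N (remainder {W} (W ^ N) e)

weight : ∀ {N} → ℕ → ℕ → Subset N → Subset N → ℕ
weight b c []          []      = 1
weight b c (true  ∷ A) (x ∷ H) = (if x then b else c) * weight b c A H
weight b c (false ∷ A) (x ∷ H) = weight b c A H

-- With x hits the weight is b^x c^(|A| - x); multiplying by c^x avoids the subtraction.
weight-power : ∀ {N} b c (A H : Subset N) → weight b c A H * c ^ ∣ A ∩ H ∣ ≡ b ^ ∣ A ∩ H ∣ * c ^ ∣ A ∣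
weight-power b c []          []          = refl
weight-power b c (false ∷ A) (x ∷ H)     = weight-power b c A H
weight-power b c (true  ∷ A) (false ∷ H) = trans (*-assoc c _ _) (trans (cong (c *_) (weight-power b c A H)) (shuffle c (b ^ ∣ A ∩ H ∣) (c ^ ∣ A ∣)))
  where
  shuffle : ∀ c p q → c * (p * q) ≡ p * (c * q)
  shuffle = solve-∀
weight-power b c (true  ∷ A) (true ∷ H)  = trans (shuffle₁ b c (weight b c A H) (c ^ ∣ A ∩ H ∣))
  (trans (cong (λ y → b * c * y) (weight-power b c A H)) (shuffle₂ b c (b ^ ∣ A ∩ H ∣) (c ^ ∣ A ∣)))
  where
  shuffle₁ : ∀ b c p q → b * p * (c * q) ≡ b * c * (p * q)
  shuffle₁ = solve-∀
  shuffle₂ : ∀ b c p q → b * c * (p * q) ≡ b * p * (c * q)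
  shuffle₂ = solve-∀

-- By independence the mean of the weight is a product in which every member of A contributes (b + M
-- c)/(M + 1), the rate being 1/(M + 1).
moment : ∀ h M b c {N} (A : Subset N) → let W = h * suc M in
         sum (λ e → weight b c A (hits W h N e)) * suc M ^ ∣ A ∣ ≡ W ^ N * (b + M * c) ^ ∣ A ∣
moment h M b c []                    = refl
moment h M b c {suc N} (false ∷ A) = trans (cong (_* suc M ^ ∣ A ∣) split)
  (trans (*-assoc W _ _) (trans (cong (W *_) (moment h M b c A)) (sym (*-assoc W (W ^ N) _))))
  where
  W = h * suc M
  split : sum (λ e → weight b c A (hits W h N (remainder {W} (W ^ N) e))) ≡ W * sum (λ e → weight b c A (hits W h N e))
  split = trans (sum-remQuot W (W ^ N) (λ _ e → weight b c A (hits W h N e))) (sum-const W _)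
moment h M b c {suc N} (true ∷ A) = trans (cong (_* (suc M * suc M ^ ∣ A ∣)) split)
  (trans (shuffle₁ h M b c (sum w) (suc M ^ ∣ A ∣)) (trans (cong (λ y → (h * suc M) * (b + M * c) * y) (moment h M b c A))
  (shuffle₂ h M b c (W ^ N) ((b + M * c) ^ ∣ A ∣))))
  where
  W = h * suc M
  w = λ e → weight b c A (hits W h N e)
  shuffle₁ : ∀ h M b c s p → h * (b + M * c) * s * (suc M * p) ≡ h * suc M * (b + M * c) * (s * p)
  shuffle₁ = solve-∀
  shuffle₂ : ∀ h M b c s p → h * suc M * (b + M * c) * (s * p) ≡ h * suc M * s * ((b + M * c) * p)
  shuffle₂ = solve-∀
  first = λ (y : Fin W) → if toℕ y <ᵇ h then b else c
  shuffle₃ : ∀ h M b c → h * b + h * M * c ≡ h * (b + M * c)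
  shuffle₃ = solve-∀
  total : sum first ≡ h * (b + M * c)
  total = trans (sum-below W h b c (m≤m*n h (suc M)))
    (trans (cong (λ y → h * b + y * c) (trans (cong (_∸ h) (*-suc h M)) (m+n∸m≡n h (h * M)))) (shuffle₃ h M b c))
  split : sum (λ e → first (quotient {W} (W ^ N) e) * w (remainder {W} (W ^ N) e)) ≡ h * (b + M * c) * sum w
  split = trans (sum-remQuot W (W ^ N) (λ y e → first y * w e))
    (trans (sum-cong-≗ (λ y → sym (*-distribˡ-sum (first y) w)))
    (trans (sym (*-distribʳ-sum (sum w) first)) (cong (_* sum w) total)))

markov : ∀ {s} (P : Fin s → Bool) (f : Fin s → ℕ) {θ} → (∀ e → P e ≡ true → θ ≤ f e) → tally P * θ ≤ sum f
markov P f {θ} big = ≤-trans (≤-reflexive (*-distribʳ-sum θ (indicator ∘ P))) (sum-mono bound)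
  where
  bound : ∀ e → indicator (P e) * θ ≤ f e
  bound e with P e in eq
  ... | true  = ≤-trans (≤-reflexive (*-identityˡ θ)) (big e eq)
  ... | false = z≤n

-- Probability at most c/2^t. With c kept apart from t, a union bound merely adds up the c.
record Rare {s} (t c : ℕ) (P : Fin s → Bool) : Set where
  constructor rare
  field bound : tally P * 2 ^ t ≤ c * s

module _ (v h M : ℕ) .{{_ : NonZero v}} {N : ℕ} (A : Subset N) where
  private
    a = suc v
    b = suc M * a
    u = v + M * a
    W = h * suc M
    X = λ e → ∣ A ∩ hits W h N e ∣
    instance
      b≢0 : NonZero b
      b≢0 = m*n≢0 (suc M) a

  -- Markov's inequality for the exponential moment with base w/a, where w = a + 1 serves the upper
  -- tail and w = a - 1 the lower one. The mean factor of one member of A is then ρ/b.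
  chernoff : ∀ t (P : Fin (W ^ N) → Bool) (w ρ : ℕ) .{{_ : NonZero ρ}} → w + M * a ≡ ρ →
             (∀ e → P e ≡ true → 2 ^ t * ρ ^ ∣ A ∣ * a ^ X e ≤ w ^ X e * b ^ ∣ A ∣) → Rare t 1 P
  chernoff t P w ρ ρ-eq large = rare (*-cancelʳ-≤ _ _ (ρ ^ ∣ A ∣) {{m^n≢0 ρ ∣ A ∣}} (begin
    tally P * 2 ^ t * ρ ^ ∣ A ∣                     ≡⟨ *-assoc (tally P) _ _ ⟩
    tally P * (2 ^ t * ρ ^ ∣ A ∣)                   ≤⟨ markov P f heavy ⟩
    sum f                                           ≡⟨ sym (*-distribʳ-sum (suc M ^ ∣ A ∣) (λ e → weight w a A (hits W h N e))) ⟩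
    sum (λ e → weight w a A (hits W h N e)) * suc M ^ ∣ A ∣ ≡⟨ moment h M w a A ⟩
    W ^ N * (w + M * a) ^ ∣ A ∣                     ≡⟨ cong₂ (λ x y → x * y ^ ∣ A ∣) (sym (*-identityˡ (W ^ N))) ρ-eq ⟩
    1 * W ^ N * ρ ^ ∣ A ∣                           ∎))
    where
    open ≤-Reasoning
    f = λ e → weight w a A (hits W h N e) * suc M ^ ∣ A ∣
    heavy : ∀ e → P e ≡ true → 2 ^ t * ρ ^ ∣ A ∣ ≤ f e
    heavy e eq = *-cancelʳ-≤ _ _ (a ^ X e) {{m^n≢0 a (X e)}} (begin
      2 ^ t * ρ ^ ∣ A ∣ * a ^ X e                   ≤⟨ large e eq ⟩
      w ^ X e * b ^ ∣ A ∣                           ≡⟨ cong (w ^ X e *_) (^-distribʳ-* (suc M) a ∣ A ∣) ⟩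
      w ^ X e * (suc M ^ ∣ A ∣ * a ^ ∣ A ∣)         ≡⟨ shuffle (w ^ X e) (suc M ^ ∣ A ∣) (a ^ ∣ A ∣) ⟩
      w ^ X e * a ^ ∣ A ∣ * suc M ^ ∣ A ∣           ≡⟨ cong (_* suc M ^ ∣ A ∣) (sym (weight-power w a A (hits W h N e))) ⟩
      weight w a A (hits W h N e) * a ^ X e * suc M ^ ∣ A ∣ ≡⟨ swap (weight w a A (hits W h N e)) (a ^ X e) (suc M ^ ∣ A ∣) ⟩
      f e * a ^ X e                                 ∎)
      where
      shuffle : ∀ p q r → p * (q * r) ≡ p * r * q
      shuffle = solve-∀
      swap : ∀ p q r → p * q * r ≡ p * r * q
      swap = solve-∀

  upper-tail : ∀ {z t} → a * t ≤ z → Rare t 1 (λ e → (a + 2) * ∣ A ∣ + b * z ≤ᵇ b * X e)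
  upper-tail {z} {t} at≤z = chernoff t _ (suc a) (suc b) refl
    (λ e eq → upper-weight v (suc M) {u} refl {∣ A ∣} {X e} {z} at≤z
      (≤ᵇ-true⁻¹ {(a + 2) * ∣ A ∣ + b * z} {b * X e} eq))

  lower-tail : ∀ {z t} → a * t ≤ z → Rare t 1 (λ e → b * X e + b * z ≤ᵇ v * ∣ A ∣)
  lower-tail {z} {t} at≤z = chernoff t _ v u {{>-nonZero (≤-trans (>-nonZero⁻¹ v) (m≤m+n v _))}} refl
    (λ e eq → lower-weight v (suc M) {u} refl {∣ A ∣} {X e} {z} at≤z
      (≤ᵇ-true⁻¹ {b * X e + b * z} {v * ∣ A ∣} eq))

-- Union bounds

anyᵇ : ∀ {q} → (Fin q → Bool) → Bool
anyᵇ {zero}  P = false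
anyᵇ {suc q} P = P zero ∨ anyᵇ (P ∘ suc)

∨-false : ∀ {b c} → b ∨ c ≡ false → b ≡ false × c ≡ false
∨-false {false} {false} refl = refl , refl

anyᵇ-false : ∀ {q} (P : Fin q → Bool) → anyᵇ P ≡ false → ∀ i → P i ≡ false
anyᵇ-false P eq zero    = proj₁ (∨-false eq)
anyᵇ-false P eq (suc i) = anyᵇ-false (P ∘ suc) (proj₂ (∨-false {P zero} eq)) i

Rare-∨ : ∀ {s t c d} {P Q : Fin s → Bool} → Rare t c P → Rare t d Q → Rare t (c + d) (λ e → P e ∨ Q e)
Rare-∨ {s} {t} {c} {d} {P} {Q} (rare rP) (rare rQ) = rare (begin
  tally (λ e → P e ∨ Q e) * 2 ^ t                          ≤⟨ *-monoˡ-≤ (2 ^ t) (sum-mono (λ e → indicator-∨ (P e) (Q e))) ⟩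
  sum (λ e → indicator (P e) + indicator (Q e)) * 2 ^ t    ≡⟨ cong (_* 2 ^ t) (∑-distrib-+ (indicator ∘ P) (indicator ∘ Q)) ⟩
  (tally P + tally Q) * 2 ^ t                              ≡⟨ *-distribʳ-+ (2 ^ t) (tally P) (tally Q) ⟩
  tally P * 2 ^ t + tally Q * 2 ^ t                        ≤⟨ +-mono-≤ rP rQ ⟩
  c * s + d * s                                            ≡⟨ sym (*-distribʳ-+ s c d) ⟩
  (c + d) * s                                              ∎)
  where open ≤-Reasoning

Rare-any : ∀ {s t c} q {P : Fin q → Fin s → Bool} → (∀ i → Rare t c (P i)) → Rare t (q * c) (λ e → anyᵇ (λ i → P i e))
Rare-any {s} zero    r = rare (≤-trans (*-monoˡ-≤ _ (≤-reflexive (trans (sum-const s 0) (*-zeroʳ s)))) z≤n)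
Rare-any (suc q) r = Rare-∨ (r zero) (Rare-any q (r ∘ suc))

Rare-shrink : ∀ {s t c x} {P : Fin s → Bool} → c * 2 ^ x ≤ 2 ^ t → Rare t c P → tally P * 2 ^ x ≤ s
Rare-shrink {s} {t} {c} {x} {P} small (rare r) = *-cancelʳ-≤ _ _ (2 ^ t) {{m^n≢0 2 t}} (begin
  tally P * 2 ^ x * 2 ^ t     ≡⟨ shuffle₁ (tally P) (2 ^ x) (2 ^ t) ⟩
  tally P * 2 ^ t * 2 ^ x     ≤⟨ *-monoˡ-≤ (2 ^ x) r ⟩
  c * s * 2 ^ x               ≡⟨ shuffle₂ c s (2 ^ x) ⟩
  s * (c * 2 ^ x)             ≤⟨ *-monoʳ-≤ s small ⟩
  s * 2 ^ t                   ∎)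
  where
  open ≤-Reasoning
  shuffle₁ : ∀ a b c → a * b * c ≡ a * c * b
  shuffle₁ = solve-∀
  shuffle₂ : ∀ a b c → a * b * c ≡ b * (a * c)
  shuffle₂ = solve-∀

-- The second event may depend on the first seed as long as it is rare for each value of that seed.
-- This is needed because the pieces hashed by the second seed are made of elements sampled by the
-- first.
union-seed : ∀ a b x (P : Fin a → Bool) (Q : Fin a → Fin b → Bool) →
             tally P * 2 ^ suc x ≤ a → (∀ i → tally (Q i) * 2 ^ suc x ≤ b) →
             tally {a * b} (λ e → P (quotient b e) ∨ Q (quotient b e) (remainder {a} b e)) * 2 ^ x ≤ a * b
union-seed a b x P Q rareP rareQ = *-cancelˡ-≤ 2 (begin
  2 * (tally bad * 2 ^ x)                                          ≡⟨ shuffle (tally bad) (2 ^ x) ⟩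
  tally bad * 2 ^ suc x                                            ≤⟨ *-monoˡ-≤ (2 ^ suc x) total ⟩
  (tally P * b + sum (tally ∘ Q)) * 2 ^ suc x                      ≡⟨ expand (tally P) b (sum (tally ∘ Q)) (2 ^ suc x) ⟩
  tally P * 2 ^ suc x * b + sum (tally ∘ Q) * 2 ^ suc x            ≤⟨ +-mono-≤ (*-monoˡ-≤ b rareP)
       (≤-trans (≤-reflexive (*-distribʳ-sum (2 ^ suc x) (tally ∘ Q))) (≤-trans (sum-mono rareQ) (≤-reflexive (sum-const a b)))) ⟩
  a * b + a * b                                                    ≡⟨ cong (a * b +_) (sym (+-identityʳ (a * b))) ⟩
  2 * (a * b)                                                      ∎)
  where
  open ≤-Reasoning
  bad : Fin (a * b) → Bool
  bad e = P (quotient b e) ∨ Q (quotient b e) (remainder {a} b e)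
  shuffle : ∀ c y → 2 * (c * y) ≡ c * (2 * y)
  shuffle = solve-∀
  expand : ∀ p b q y → (p * b + q) * y ≡ p * y * b + q * y
  expand = solve-∀
  total : tally bad ≤ tally P * b + sum (tally ∘ Q)
  total = begin
    tally bad                                                ≡⟨ sum-remQuot a b (λ i j → indicator (P i ∨ Q i j)) ⟩
    sum (λ i → sum (λ j → indicator (P i ∨ Q i j)))          ≤⟨ sum-mono (λ i → sum-mono (λ j → indicator-∨ (P i) (Q i j))) ⟩
    sum (λ i → sum {b} (λ j → indicator (P i) + indicator (Q i j))) ≡⟨ sum-cong-≗ (λ i → trans (∑-distrib-+ {b} (λ _ → indicator (P i)) (indicator ∘ Q i)) (cong (_+ tally (Q i)) (trans (sum-const b _) (*-comm b _)))) ⟩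
    sum (λ i → indicator (P i) * b + tally (Q i))            ≡⟨ ∑-distrib-+ (λ i → indicator (P i) * b) (tally ∘ Q) ⟩
    sum (λ i → indicator (P i) * b) + sum (tally ∘ Q)        ≡⟨ cong (_+ sum (tally ∘ Q)) (sym (*-distribʳ-sum b (indicator ∘ P))) ⟩
    tally P * b + sum (tally ∘ Q)                            ∎

-- Sampling at rate 2^-l

-- All rates are thresholds on the same uniform values, so one seed serves every l ≤ w.
sample : ∀ w l N → Fin ((2 ^ w) ^ N) → Subset N
sample w l N = hits (2 ^ w) (2 ^ (w ∸ l)) N

private
  2^-split : ∀ {w l} → l ≤ w → 2 ^ w ≡ 2 ^ (w ∸ l) * 2 ^ l
  2^-split {w} {l} l≤w = trans (cong (2 ^_) (sym (m∸n+n≡m l≤w))) (^-distribˡ-+-* 2 (w ∸ l) l)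

  suc-pred-2^ : ∀ l → 2 ^ l ≡ suc (pred (2 ^ l))
  suc-pred-2^ l = sym (suc-pred (2 ^ l) {{m^n≢0 2 l}})

sample-upper-tail : ∀ v .{{_ : NonZero v}} w l {N} (A : Subset N) → l ≤ w → ∀ z {t} → suc v * t ≤ z →
  Rare t 1 (λ e → (suc v + 2) * ∣ A ∣ + 2 ^ l * suc v * z ≤ᵇ 2 ^ l * suc v * ∣ A ∩ sample w l N e ∣)
sample-upper-tail v w l {N} A l≤w z {t} vt≤z = general (2^-split l≤w) (suc-pred-2^ l)
  where
  general : ∀ {W h L M} → W ≡ h * L → L ≡ suc M →
            Rare t 1 (λ e → (suc v + 2) * ∣ A ∣ + L * suc v * z ≤ᵇ L * suc v * ∣ A ∩ hits W h N e ∣)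
  general {h = h} {M = M} refl refl = upper-tail v h M A vt≤z

sample-lower-tail : ∀ v .{{_ : NonZero v}} w l {N} (A : Subset N) → l ≤ w → ∀ z {t} → suc v * t ≤ z →
  Rare t 1 (λ e → 2 ^ l * suc v * ∣ A ∩ sample w l N e ∣ + 2 ^ l * suc v * z ≤ᵇ v * ∣ A ∣)
sample-lower-tail v w l {N} A l≤w z {t} vt≤z = general (2^-split l≤w) (suc-pred-2^ l)
  where
  general : ∀ {W h L M} → W ≡ h * L → L ≡ suc M →
            Rare t 1 (λ e → L * suc v * ∣ A ∩ hits W h N e ∣ + L * suc v * z ≤ᵇ v * ∣ A ∣)
  general {h = h} {M = M} refl refl = lower-tail v h M A vt≤z

sample-zero : ∀ w N e → sample w 0 N e ≡ ⊤
sample-zero w N = all N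
  where
  <ᵇ-true : ∀ {W} (y : Fin W) → (toℕ y <ᵇ W) ≡ true
  <ᵇ-true y = ≤ᵇ-true (Fin.toℕ<n y)
  all : ∀ N e → hits (2 ^ w) (2 ^ w) N e ≡ ⊤
  all zero    e = refl
  all (suc N) e = cong₂ _∷_ (<ᵇ-true (quotient {2 ^ w} ((2 ^ w) ^ N) e)) (all N _)

-- Cardinalities

∣A∣≤∣B∣+∣A─B∣ : ∀ {N} (A B : Subset N) → ∣ A ∣ ≤ ∣ B ∣ + ∣ A ─ B ∣
∣A∣≤∣B∣+∣A─B∣ []          []          = z≤n
∣A∣≤∣B∣+∣A─B∣ (true ∷ A)  (true ∷ B)  = s≤s (∣A∣≤∣B∣+∣A─B∣ A B)
∣A∣≤∣B∣+∣A─B∣ (true ∷ A)  (false ∷ B) = ≤-trans (s≤s (∣A∣≤∣B∣+∣A─B∣ A B)) (≤-reflexive (sym (+-suc ∣ B ∣ _)))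
∣A∣≤∣B∣+∣A─B∣ (false ∷ A) (true ∷ B)  = m≤n⇒m≤1+n (∣A∣≤∣B∣+∣A─B∣ A B)
∣A∣≤∣B∣+∣A─B∣ (false ∷ A) (false ∷ B) = ∣A∣≤∣B∣+∣A─B∣ A B

∣A∪B∣≡∣A∣+∣B─A∣ : ∀ {N} (A B : Subset N) → ∣ A ∪ B ∣ ≡ ∣ A ∣ + ∣ B ─ A ∣
∣A∪B∣≡∣A∣+∣B─A∣ []          []          = refl
∣A∪B∣≡∣A∣+∣B─A∣ (true ∷ A)  (true ∷ B)  = cong suc (∣A∪B∣≡∣A∣+∣B─A∣ A B)
∣A∪B∣≡∣A∣+∣B─A∣ (true ∷ A)  (false ∷ B) = cong suc (∣A∪B∣≡∣A∣+∣B─A∣ A B)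
∣A∪B∣≡∣A∣+∣B─A∣ (false ∷ A) (true ∷ B)  = trans (cong suc (∣A∪B∣≡∣A∣+∣B─A∣ A B)) (sym (+-suc ∣ A ∣ _))
∣A∪B∣≡∣A∣+∣B─A∣ (false ∷ A) (false ∷ B) = ∣A∪B∣≡∣A∣+∣B─A∣ A B

∣A∪B─C∣≤ : ∀ {N} (A B C : Subset N) → ∣ (A ∪ B) ─ C ∣ ≤ ∣ A ─ C ∣ + ∣ B ─ C ∣
∣A∪B─C∣≤ []          []          []          = z≤n
∣A∪B─C∣≤ (true ∷ A)  (true ∷ B)  (false ∷ C) = s≤s (≤-trans (∣A∪B─C∣≤ A B C) (+-monoʳ-≤ ∣ A ─ C ∣ (n≤1+n _)))
∣A∪B─C∣≤ (true ∷ A)  (false ∷ B) (false ∷ C) = s≤s (∣A∪B─C∣≤ A B C)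
∣A∪B─C∣≤ (false ∷ A) (true ∷ B)  (false ∷ C) = ≤-trans (s≤s (∣A∪B─C∣≤ A B C)) (≤-reflexive (sym (+-suc ∣ A ─ C ∣ _)))
∣A∪B─C∣≤ (false ∷ A) (false ∷ B) (false ∷ C) = ∣A∪B─C∣≤ A B C
∣A∪B─C∣≤ (true ∷ A)  (true ∷ B)  (true ∷ C)  = ∣A∪B─C∣≤ A B C
∣A∪B─C∣≤ (true ∷ A)  (false ∷ B) (true ∷ C)  = ∣A∪B─C∣≤ A B C
∣A∪B─C∣≤ (false ∷ A) (true ∷ B)  (true ∷ C)  = ∣A∪B─C∣≤ A B C
∣A∪B─C∣≤ (false ∷ A) (false ∷ B) (true ∷ C)  = ∣A∪B─C∣≤ A B C

∣A∪B∣≤∣A∣+∣B∣ : ∀ {N} (A B : Subset N) → ∣ A ∪ B ∣ ≤ ∣ A ∣ + ∣ B ∣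
∣A∪B∣≤∣A∣+∣B∣ A B = ≤-trans (≤-reflexive (∣A∪B∣≡∣A∣+∣B─A∣ A B)) (+-monoʳ-≤ ∣ A ∣ (Subset.∣p─q∣≤∣p∣ B A))

─-anti-card : ∀ {N} (A : Subset N) {B C} → B Subset.⊆ C → ∣ A ─ C ∣ ≤ ∣ A ─ B ∣
─-anti-card A {B} {C} B⊆C = Subset.p⊆q⇒∣p∣≤∣q∣ (λ x∈ →
  Subset.x∈p∧x∉q⇒x∈p─q (Subset.p─q⊆p A C x∈) (λ x∈B → x∉q (B⊆C x∈B) x∈))
  where
  x∉q : ∀ {N} {A C : Subset N} {x} → x Subset.∈ C → ¬ (x Subset.∈ (A ─ C))
  x∉q {A = true ∷ A}  {true ∷ C} Vec.here ()
  x∉q {A = false ∷ A} {true ∷ C} Vec.here ()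
  x∉q {A = a ∷ A} {c ∷ C} (Vec.there p) q = x∉q p (drop a c q)
    where
    drop : ∀ {N} a c {A C : Subset N} {x} → suc x Subset.∈ ((a ∷ A) ─ (c ∷ C)) → x Subset.∈ (A ─ C)
    drop true  true  (Vec.there p) = p
    drop true  false (Vec.there p) = p
    drop false true  (Vec.there p) = p
    drop false false (Vec.there p) = p

⊆⇒─≡⊥ : ∀ {N} {A B : Subset N} → A Subset.⊆ B → ∣ A ─ B ∣ ≡ 0
⊆⇒─≡⊥ {N} {A} {B} A⊆B = n≤0⇒n≡0 (≤-trans (─-anti-card A A⊆B) (≤-reflexive (self A)))
  where
  self : ∀ {N} (A : Subset N) → ∣ A ─ A ∣ ≡ 0
  self []          = refl
  self (true ∷ A)  = self A
  self (false ∷ A) = self A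

-- Cutting a set into consecutive pieces

-- The members of R with ranks lo, ..., lo + s - 1. Cutting by rank rather than by position bounds
-- both the size of a piece and the number of nonempty pieces.
slice : ∀ {N} → Subset N → ℕ → ℕ → Subset N
slice []          lo       s       = []
slice (false ∷ R) lo       s       = false ∷ slice R lo s
slice (true ∷ R)  (suc lo) s       = false ∷ slice R lo s
slice (true ∷ R)  zero     (suc s) = true ∷ slice R zero s
slice (true ∷ R)  zero     zero    = false ∷ slice R zero zero

slice⊆ : ∀ {N} (R : Subset N) lo s → slice R lo s Subset.⊆ R
slice⊆ (false ∷ R) lo       s       = Subset.s⊆s (slice⊆ R lo s)
slice⊆ (true ∷ R)  (suc lo) s       = Subset.out⊆ (slice⊆ R lo s)
slice⊆ (true ∷ R)  zero     (suc s) = Subset.s⊆s (slice⊆ R zero s)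
slice⊆ (true ∷ R)  zero     zero    = Subset.out⊆ (slice⊆ R zero zero)

∣slice∣≤ : ∀ {N} (R : Subset N) lo s → ∣ slice R lo s ∣ ≤ s
∣slice∣≤ []          lo       s       = z≤n
∣slice∣≤ (false ∷ R) lo       s       = ∣slice∣≤ R lo s
∣slice∣≤ (true ∷ R)  (suc lo) s       = ∣slice∣≤ R lo s
∣slice∣≤ (true ∷ R)  zero     (suc s) = s≤s (∣slice∣≤ R zero s)
∣slice∣≤ (true ∷ R)  zero     zero    = ∣slice∣≤ R zero zero

slice-beyond : ∀ {N} (R : Subset N) lo s → ∣ R ∣ ≤ lo → slice R lo s ≡ ⊥
slice-beyond []          lo       s p       = refl
slice-beyond (false ∷ R) lo       s p       = cong (false ∷_) (slice-beyond R lo s p)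
slice-beyond (true ∷ R)  (suc lo) s (s≤s p) = cong (false ∷_) (slice-beyond R lo s p)

slice-none : ∀ {N} (R : Subset N) lo → slice R lo 0 ≡ ⊥
slice-none []          lo       = refl
slice-none (false ∷ R) lo       = cong (false ∷_) (slice-none R lo)
slice-none (true ∷ R)  (suc lo) = cong (false ∷_) (slice-none R lo)
slice-none (true ∷ R)  zero     = cong (false ∷_) (slice-none R zero)

slice-whole : ∀ {N} (R : Subset N) s → ∣ R ∣ ≤ s → slice R 0 s ≡ R
slice-whole []          s       p       = refl
slice-whole (false ∷ R) s       p       = cong (false ∷_) (slice-whole R s p)
slice-whole (true ∷ R)  (suc s) (s≤s p) = cong (true ∷_) (slice-whole R s p)

slice-+ : ∀ {N} (R : Subset N) lo a b → slice R lo (a + b) ≡ slice R lo a ∪ slice R (lo + a) b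
slice-+ []          lo       a       b = refl
slice-+ (false ∷ R) lo       a       b = cong (false ∷_) (slice-+ R lo a b)
slice-+ (true ∷ R)  (suc lo) a       b = cong (false ∷_) (slice-+ R lo a b)
slice-+ (true ∷ R)  zero     (suc a) b = cong (true ∷_) (slice-+ R zero a b)
slice-+ (true ∷ R)  zero     zero    zero    = cong (false ∷_) (slice-+ R zero zero zero)
slice-+ (true ∷ R)  zero     zero    (suc b) = cong (true ∷_) (slice-+ R zero zero b)

slices-cover : ∀ {N} (R Q : Subset N) s C lo →
               ∣ slice R lo (C * s) ─ Q ∣ ≤ sum {C} (λ c → ∣ slice R (lo + toℕ c * s) s ─ Q ∣)
slices-cover R Q s zero    lo = ≤-trans (Subset.∣p─q∣≤∣p∣ (slice R lo 0) Q) (∣slice∣≤ R lo 0)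
slices-cover R Q s (suc C) lo = begin
  ∣ slice R lo (s + C * s) ─ Q ∣                                    ≡⟨ cong (λ A → ∣ A ─ Q ∣) (slice-+ R lo s (C * s)) ⟩
  ∣ (slice R lo s ∪ slice R (lo + s) (C * s)) ─ Q ∣                 ≤⟨ ∣A∪B─C∣≤ (slice R lo s) _ Q ⟩
  ∣ slice R lo s ─ Q ∣ + ∣ slice R (lo + s) (C * s) ─ Q ∣           ≤⟨ +-monoʳ-≤ ∣ slice R lo s ─ Q ∣ (slices-cover R Q s C (lo + s)) ⟩
  ∣ slice R lo s ─ Q ∣ + sum {C} (λ c → ∣ slice R (lo + s + toℕ c * s) s ─ Q ∣)
    ≡⟨ cong₂ _+_ (cong (λ l → ∣ slice R l s ─ Q ∣) (sym (+-identityʳ lo)))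
                 (sum-cong-≗ {C} (λ c → cong (λ l → ∣ slice R l s ─ Q ∣) (+-assoc lo s (toℕ c * s)))) ⟩
  ∣ slice R (lo + 0) s ─ Q ∣ + sum {C} (λ c → ∣ slice R (lo + (s + toℕ c * s)) s ─ Q ∣) ∎
  where open ≤-Reasoning

interval : ∀ {N} → ℕ → ℕ → Subset N
interval {zero}  lo       hi       = []
interval {suc N} lo       zero     = false ∷ interval 0 0
interval {suc N} zero     (suc hi) = true ∷ interval zero hi
interval {suc N} (suc lo) (suc hi) = false ∷ interval lo hi

interval-empty : ∀ N → interval {N} 0 0 ≡ ⊥
interval-empty zero    = refl
interval-empty (suc N) = cong (false ∷_) (interval-empty N)

slice-prefix : ∀ {N} (R : Subset N) s → Σ[ hi ∈ Fin (suc N) ] slice R 0 s ≡ R ∩ interval 0 (toℕ hi)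
slice-prefix []          s       = zero , refl
slice-prefix (false ∷ R) s       = let hi , eq = slice-prefix R s in suc hi , cong (false ∷_) eq
slice-prefix (true ∷ R)  (suc s) = let hi , eq = slice-prefix R s in suc hi , cong (true ∷_) eq
slice-prefix {suc N} (true ∷ R) zero = zero , cong (false ∷_) (trans (slice-none R 0)
  (sym (trans (cong (R ∩_) (interval-empty N)) (Subset.∩-zeroʳ R))))

-- A piece defined by rank is also cut out by positions, and there are only (N + 1)² pairs of end
-- points whatever R is. The ranks depend on the history, but this count does not.
slice-interval : ∀ {N} (R : Subset N) lo s →
                 Σ[ l ∈ Fin (suc N) ] Σ[ h ∈ Fin (suc N) ] slice R lo s ≡ R ∩ interval (toℕ l) (toℕ h)
slice-interval []          lo       s = zero , zero , refl
slice-interval (true ∷ R)  zero     s = zero , slice-prefix (true ∷ R) s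
slice-interval (true ∷ R)  (suc lo) s = let l , h , eq = slice-interval R lo s in suc l , suc h , cong (false ∷_) eq
slice-interval (false ∷ R) lo       s = let l , h , eq = slice-interval R lo s in suc l , suc h , cong (false ∷_) eq

-- The index type exhibits the number q^c of candidate unions, which is what the union bounds pay
-- for.
unionOf : ∀ {q N} → (Fin q → Subset N) → ∀ c → Fin (q ^ c) → Subset N
unionOf item zero    e = ⊥
unionOf {q} item (suc c) e = item (quotient (q ^ c) e) ∪ unionOf item c (remainder {q} (q ^ c) e)

unionOf-cons : ∀ {q N} (item : Fin q → Subset N) {c} i (e : Fin (q ^ c)) →
               Σ[ e′ ∈ Fin (q ^ suc c) ] unionOf item (suc c) e′ ≡ item i ∪ unionOf item c e
unionOf-cons item {c} i e = combine i e ,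
  cong₂ (λ x y → item x ∪ unionOf item c y) (quotient-combine i e) (remainder-combine i e)

unionOf-pad : ∀ {q N} (item : Fin q → Subset N) o → item o ≡ ⊥ → ∀ {c k} → c ≤ k → (e : Fin (q ^ c)) →
              Σ[ e′ ∈ Fin (q ^ k) ] unionOf item k e′ ≡ unionOf item c e
unionOf-pad item o eq {zero} {zero} c≤k e = e , refl
unionOf-pad item o eq {zero} {suc k} c≤k e =
  let e₁ , eq₁ = unionOf-pad item o eq {zero} {k} z≤n e
      e₂ , eq₂ = unionOf-cons item {k} o e₁
  in e₂ , trans eq₂ (trans (cong₂ _∪_ eq eq₁) (Subset.∪-identityˡ ⊥))
unionOf-pad {q} item o eq {suc c} {suc k} (s≤s c≤k) e =
  let e₁ , eq₁ = unionOf-pad item o eq c≤k (remainder {q} (q ^ c) e)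
      e₂ , eq₂ = unionOf-cons item {k} (quotient (q ^ c) e) e₁
  in e₂ , trans eq₂ (cong (item (quotient (q ^ c) e) ∪_) eq₁)

lift : ∀ D {n} → Subset n → Subset (n * D)
lift D A = Vec.concat (Vec.map (Vec.replicate D) A)

∣++∣ : ∀ {a b} (A : Subset a) (B : Subset b) → ∣ A Vec.++ B ∣ ≡ ∣ A ∣ + ∣ B ∣
∣++∣ []          B = refl
∣++∣ (true ∷ A)  B = cong suc (∣++∣ A B)
∣++∣ (false ∷ A) B = ∣++∣ A B

∣lift∣ : ∀ D {n} (A : Subset n) → ∣ lift D A ∣ ≡ ∣ A ∣ * D
∣lift∣ D []          = refl
∣lift∣ D (true ∷ A)  = trans (∣++∣ (Vec.replicate D true) (lift D A)) (cong₂ _+_ (Subset.∣⊤∣≡n D) (∣lift∣ D A))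
∣lift∣ D (false ∷ A) = trans (∣++∣ (Vec.replicate D false) (lift D A)) (cong₂ _+_ (Subset.∣⊥∣≡0 D) (∣lift∣ D A))

lift-⊥ : ∀ D n → lift D {n} ⊥ ≡ ⊥
lift-⊥ D zero    = refl
lift-⊥ D (suc n) = trans (cong (Vec.replicate D false Vec.++_) (lift-⊥ D n)) (replicate-++ D (n * D))
  where
  replicate-++ : ∀ a b → Vec.replicate a false Vec.++ Vec.replicate b false ≡ Vec.replicate (a + b) false
  replicate-++ zero    b = refl
  replicate-++ (suc a) b = cong (false ∷_) (replicate-++ a b)

lift-∪ : ∀ D {n} (A B : Subset n) → lift D (A ∪ B) ≡ lift D A ∪ lift D B
lift-∪ D []      []      = refl
lift-∪ D (a ∷ A) (b ∷ B) = trans (cong₂ Vec._++_ (replicate-∨ D) (lift-∪ D A B)) (sym (++-∪ (Vec.replicate D a) (Vec.replicate D b) _ _))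
  where
  replicate-∨ : ∀ D → Vec.replicate D (a ∨ b) ≡ Vec.replicate D a ∪ Vec.replicate D b
  replicate-∨ zero    = refl
  replicate-∨ (suc D) = cong ((a ∨ b) ∷_) (replicate-∨ D)
  ++-∪ : ∀ {x y} (P Q : Subset x) (R S : Subset y) → (P Vec.++ R) ∪ (Q Vec.++ S) ≡ (P ∪ Q) Vec.++ (R ∪ S)
  ++-∪ []      []      R S = refl
  ++-∪ (p ∷ P) (q ∷ Q) R S = cong ((p ∨ q) ∷_) (++-∪ P Q R S)

-- Sample and prune, at one sampling level

-- A set may be picked several times, once for each of several pieces. `cov` holds only the pieces
-- taken, so it can be smaller than the union of the picked sets.
record State (m N : ℕ) : Set where
  constructor state
  field
    picks : List (Fin m)
    cov   : Subset N
open State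

Live : ∀ {m N} → ℕ → State m N → Set
Live k st = length (picks st) < k

liveᵇ : ∀ {m N} → ℕ → State m N → Bool
liveᵇ k st = suc (length (picks st)) ≤ᵇ k

start : ∀ {m N} → State m N
start = state [] ⊥

-- (i , rem): the current threshold is i β, and rem further rounds follow at it.
Position : Set
Position = ℕ × ℕ

next : ℕ → Position → Position
next Y (zero  , rem)     = zero , rem
next Y (suc i , zero)    = i , pred Y
next Y (suc i , suc rem) = suc i , rem

-- β is the step between thresholds and `top` their number; each threshold gets Y rounds, every one
-- of which is to shrink the total residual by 2^γ. The hash on pieces has additive error 2^ζ.
record Config : Set where
  field
    k β γ ζ Y top : ℕ

  span : ℕ → ℕ
  span τ = 2 ^ (γ + 2) * τ

  -- A family missed at rate 2^-l has fewer than 2^(l + 1 + ζ) members, and this times (2^(γ + 2))²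
  -- must not exceed 2^(γ (rem + 1)). When the difference is truncated to zero, every piece is
  -- sampled.
  rate : ℕ → ℕ
  rate rem = γ * suc rem ∸ (2 * γ + 5 + ζ)

  -- At most 2^(2 γ + 7 + ζ) sampled pieces of at most 2^(γ + 2) `top * β` elements each, doubled to
  -- absorb the additive error in their number.
  volume : ℕ
  volume = 2 ^ (3 * γ + 10 + ζ) * (top * β)

  position : ℕ → Position
  position zero    = top , pred Y
  position (suc t) = next Y (position t)

module Process (K : Config) {m N : ℕ} where
  open Config K

  -- A label is a set together with a piece number below N; for a positive span this reaches the end
  -- of any residual. The arguments `live` and `C` are all that a machine learns about the state.
  pieceAt : (Fin m → Subset N) → (ℕ → Subset (m * N)) → Bool → Subset N → Position → Fin (m * N) → Subset N
  pieceAt F hit live C (zero  , rem) p = ⊥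
  pieceAt F hit live C (suc i , rem) p =
    let R = F (quotient N p) ─ C ; τ = suc i * β in
    if live ∧ (lookup (hit (rate rem)) p ∧ (τ ≤ᵇ ∣ R ∣))
    then slice R (toℕ (remainder {m} N p) * span τ) (span τ)
    else ⊥

  absorb : ℕ → (Fin (m * N) → Subset N) → State m N → Fin (m * N) → State m N
  absorb τ piece st p =
    if liveᵇ k st ∧ (τ ≤ᵇ ∣ piece p ─ cov st ∣)
    then state (quotient N p ∷ picks st) (cov st ∪ piece p)
    else st

  absorbAll : ℕ → (Fin (m * N) → Subset N) → State m N → State m N
  absorbAll τ piece st = List.foldl (absorb τ piece) st (List.allFin (m * N))

  advance : Position → (Fin (m * N) → Subset N) → State m N → State m N
  advance (zero  , rem) piece st = st
  advance (suc i , rem) piece st = absorbAll (suc i * β) piece st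

  -- Pieces are cut relative to the covering at the start of the round, whereas `absorb` measures
  -- gains against the growing one.
  round : (Fin m → Subset N) → (ℕ → Subset (m * N)) → Position → State m N → State m N
  round F hit pos st = advance pos (pieceAt F hit (liveᵇ k st) (cov st) pos) st

  run : (Fin m → Subset N) → (ℕ → Subset (m * N)) → ℕ → State m N
  run F hit zero    = start
  run F hit (suc t) = round F hit (position t) (run F hit t)

  absorb-cong : ∀ τ {piece piece′} → (∀ p → piece p ≡ piece′ p) → ∀ st p → absorb τ piece st p ≡ absorb τ piece′ st p
  absorb-cong τ eq st p rewrite eq p = refl

  advance-cong : ∀ pos {piece piece′} → (∀ p → piece p ≡ piece′ p) → ∀ st → advance pos piece st ≡ advance pos piece′ st
  advance-cong (zero  , rem) eq st = refl
  advance-cong (suc i , rem) {piece} {piece′} eq st = go st (List.allFin (m * N))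
    where
    go : ∀ st ps → List.foldl (absorb (suc i * β) piece) st ps ≡ List.foldl (absorb (suc i * β) piece′) st ps
    go st []       = refl
    go st (p ∷ ps) = trans (cong (λ st → List.foldl (absorb (suc i * β) piece) st ps) (absorb-cong (suc i * β) eq st p)) (go _ ps)

  pieceAt-cong : ∀ {F F′} hit → (∀ i → F i ≡ F′ i) → ∀ live C pos p → pieceAt F hit live C pos p ≡ pieceAt F′ hit live C pos p
  pieceAt-cong hit eq live C (zero  , rem) p = refl
  pieceAt-cong hit eq live C (suc i , rem) p rewrite eq (quotient N p) = refl

  run-cong : ∀ {F F′} hit → (∀ i → F i ≡ F′ i) → ∀ t → run F hit t ≡ run F′ hit t
  run-cong hit eq zero    = refl
  run-cong {F} {F′} hit eq (suc t) = trans (cong (round F hit (position t)) (run-cong hit eq t))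
    (advance-cong (position t) (pieceAt-cong hit eq _ _ (position t)) _)

  absorb-cases : ∀ τ piece st p →
    (absorb τ piece st p ≡ state (quotient N p ∷ picks st) (cov st ∪ piece p) × Live k st × τ ≤ ∣ piece p ─ cov st ∣)
    ⊎ (absorb τ piece st p ≡ st × (Live k st → ∣ piece p ─ cov st ∣ < τ))
  absorb-cases τ piece st p with liveᵇ k st in eq₁ | τ ≤ᵇ ∣ piece p ─ cov st ∣ in eq₂
  ... | true  | true  = inj₁ (refl , ≤ᵇ-true⁻¹ {suc (length (picks st))} eq₁ , ≤ᵇ-true⁻¹ eq₂)
  ... | true  | false = inj₂ (refl , λ _ → ≤ᵇ-false⁻¹ eq₂)
  ... | false | _     = inj₂ (refl , λ l → contradiction l (<⇒≱ (≤ᵇ-false⁻¹ {suc (length (picks st))} eq₁)))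

  record _⊑_ (st st′ : State m N) : Set where
    constructor mk⊑
    field
      grow : cov st Subset.⊆ cov st′
      more : length (picks st) ≤ length (picks st′)
  open _⊑_

  ⊑-refl : ∀ {st} → st ⊑ st
  ⊑-refl = mk⊑ id ≤-refl

  ⊑-trans : ∀ {s t u} → s ⊑ t → t ⊑ u → s ⊑ u
  ⊑-trans p q = mk⊑ (λ x∈ → grow q (grow p x∈)) (≤-trans (more p) (more q))

  module _ (τ : ℕ) (piece : Fin (m * N) → Subset N) where

    absorb-⊑ : ∀ st p → st ⊑ absorb τ piece st p
    absorb-⊑ st p with absorb-cases τ piece st p
    ... | inj₁ (eq , _) = subst (st ⊑_) (sym eq) (mk⊑ (Subset.p⊆p∪q (piece p)) (n≤1+n _))
    ... | inj₂ (eq , _) = subst (st ⊑_) (sym eq) ⊑-refl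

    foldl-⊑ : ∀ ps st → st ⊑ List.foldl (absorb τ piece) st ps
    foldl-⊑ []       st = ⊑-refl
    foldl-⊑ (p ∷ ps) st = ⊑-trans (absorb-⊑ st p) (foldl-⊑ ps _)

    -- A piece that was taken gains nothing more. One that was refused had a gain below τ, which can
    -- only decrease; since picks are left at the end, the limit k was not what refused it.
    absorbed : 0 < τ → ∀ ps st {p} → p ∈ ps → let st′ = List.foldl (absorb τ piece) st ps in
               Live k st′ → ∣ piece p ─ cov st′ ∣ < τ
    absorbed 0<τ (p ∷ ps) st (there p∈) live = absorbed 0<τ ps (absorb τ piece st p) p∈ live
    absorbed 0<τ (p ∷ ps) st (here refl) live with absorb-cases τ piece st p
    ... | inj₁ (eq , _) = ≤-trans (s≤s (≤-reflexive (⊆⇒─≡⊥ inside))) 0<τ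
      where
      inside : piece p Subset.⊆ cov (List.foldl (absorb τ piece) (absorb τ piece st p) ps)
      inside x∈ = grow (foldl-⊑ ps (absorb τ piece st p)) (subst (λ s → _ Subset.∈ cov s) (sym eq) (Subset.q⊆p∪q (cov st) (piece p) x∈))
    ... | inj₂ (eq , small) = ≤-trans (s≤s (─-anti-card (piece p) (grow up))) (small (≤-trans (s≤s (more up)) live))
      where
      up : st ⊑ List.foldl (absorb τ piece) (absorb τ piece st p) ps
      up = ⊑-trans (absorb-⊑ st p) (foldl-⊑ ps _)

    foldl-invariant : ∀ (P : State m N → Set) →
      (∀ st p → P st → Live k st → τ ≤ ∣ piece p ─ cov st ∣ → P (state (quotient N p ∷ picks st) (cov st ∪ piece p))) →
      ∀ ps st → P st → P (List.foldl (absorb τ piece) st ps)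
    foldl-invariant P step []       st Pst = Pst
    foldl-invariant P step (p ∷ ps) st Pst with absorb-cases τ piece st p
    ... | inj₁ (eq , live , gain) = foldl-invariant P step ps _ (subst P (sym eq) (step st p Pst live gain))
    ... | inj₂ (eq , _)           = foldl-invariant P step ps _ (subst P (sym eq) Pst)

-- How one round shrinks the total residual

count-pieces : ∀ N ρ s → sum {N} (λ c → indicator (suc (toℕ c * s) ≤ᵇ ρ)) * s ≤ ρ + s
count-pieces N ρ s = proj₂ (go N ρ)
  where
  open ≤-Reasoning
  f : ℕ → ℕ → ℕ
  f N ρ = sum {N} (λ c → indicator (suc (toℕ c * s) ≤ᵇ ρ))
  shift : ∀ x ρ → indicator (suc (s + x) ≤ᵇ ρ) ≤ indicator (suc x ≤ᵇ ρ ∸ s)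
  shift x ρ with suc (s + x) ≤ᵇ ρ in eq
  ... | false = z≤n
  ... | true  = ≤-reflexive (cong indicator (sym (≤ᵇ-true {suc x} {ρ ∸ s} (m+n≤o⇒n≤o∸m s
    (≤-trans (≤-reflexive (+-suc s x)) (≤ᵇ-true⁻¹ {suc (s + x)} eq))))))
    where
    m+n≤o⇒n≤o∸m : ∀ m {n o} → m + n ≤ o → n ≤ o ∸ m
    m+n≤o⇒n≤o∸m m {n} le = ≤-trans (≤-reflexive (sym (m+n∸m≡n m n))) (∸-monoˡ-≤ m le)
  step : ∀ N ρ → f (suc N) ρ ≤ indicator (1 ≤ᵇ ρ) + f N (ρ ∸ s)
  step N ρ = +-monoʳ-≤ (indicator (1 ≤ᵇ ρ)) (sum-mono {N} (λ c → shift (toℕ c * s) ρ))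
  -- When ρ ≤ s, the inductive bound would still allow s for the remaining pieces. That nothing
  -- remains at ρ = 0 has to be carried along.
  go : ∀ N ρ → (ρ ≡ 0 → f N ρ ≡ 0) × f N ρ * s ≤ ρ + s
  go zero    ρ = (λ _ → refl) , z≤n
  go (suc N) zero = (λ _ → none) , ≤-trans (≤-reflexive (cong (_* s) none)) z≤n
    where
    none : f (suc N) 0 ≡ 0
    none = n≤0⇒n≡0 (≤-trans (step N 0) (≤-reflexive (proj₁ (go N (0 ∸ s)) (0∸n≡0 s))))
  go (suc N) (suc ρ) = (λ ()) , (begin
    f (suc N) (suc ρ) * s      ≤⟨ *-monoˡ-≤ s (step N (suc ρ)) ⟩
    s + f N (suc ρ ∸ s) * s    ≤⟨ rest ⟩
    suc ρ + s                  ∎)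
    where
    rest : s + f N (suc ρ ∸ s) * s ≤ suc ρ + s
    rest with suc ρ ≤? s
    ... | yes p = ≤-trans (≤-reflexive (trans (cong (λ y → s + y * s) (proj₁ (go N (suc ρ ∸ s)) (m≤n⇒m∸n≡0 p))) (+-identityʳ s))) (m≤n+m s (suc ρ))
    ... | no ¬p = begin
      s + f N (suc ρ ∸ s) * s   ≤⟨ +-monoʳ-≤ s (proj₂ (go N (suc ρ ∸ s))) ⟩
      s + (suc ρ ∸ s + s)       ≡⟨ cong (s +_) (m∸n+n≡m (<⇒≤ (≰⇒> ¬p))) ⟩
      s + suc ρ                 ≡⟨ +-comm s (suc ρ) ⟩
      suc ρ + s                 ∎

gate : Bool → ℕ → ℕ
gate true  x = x
gate false x = 0

gate≤ : ∀ b x → gate b x ≤ x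
gate≤ true  x = ≤-refl
gate≤ false x = z≤n

module Prune {m N : ℕ} (F : Fin m → Subset N) where
  open ≤-Reasoning

  ρ : Subset N → Fin m → ℕ
  ρ C i = ∣ F i ─ C ∣

  -- Residuals never grow, so a set below τ is settled for this threshold and counts nothing.
  -- Consequently Φ < τ means that no set reaches τ.
  Φ : ℕ → Subset N → ℕ
  Φ τ C = sum (λ i → gate (τ ≤ᵇ ρ C i) (ρ C i))

  -- Determined by the coverings before and after the round, without reference to the hash. A fixed
  -- pair of coverings thus gives a fixed family, to which a tail bound applies.
  survives : ℕ → ℕ → Subset N → Subset N → Fin m → Fin N → Bool
  survives τ s C C′ i c = (τ ≤ᵇ ρ C i) ∧ (τ ≤ᵇ ∣ slice (F i ─ C) (toℕ c * s) s ─ C′ ∣)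

  survivors : ℕ → ℕ → Subset N → Subset N → Subset (m * N)
  survivors τ s C C′ = tabulate (λ p → survives τ s C C′ (quotient N p) (remainder {m} N p))

  offers : ℕ → ℕ → Subset N → Fin m → Fin N → Bool
  offers τ s C i c = (τ ≤ᵇ ρ C i) ∧ (suc (toℕ c * s) ≤ᵇ ρ C i)

  offered : ℕ → ℕ → Subset N → Subset (m * N)
  offered τ s C = tabulate (λ p → offers τ s C (quotient N p) (remainder {m} N p))

  private
    sum-tabulate : ∀ (P : Fin m → Fin N → Bool) →
      ∣ tabulate {n = m * N} (λ p → P (quotient N p) (remainder {m} N p)) ∣ ≡ sum (λ i → sum (λ c → indicator (P i c)))
    sum-tabulate P = trans (∣tabulate∣ {m * N} (λ p → P (quotient N p) (remainder {m} N p))) (sum-remQuot m N (λ i c → indicator (P i c)))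

  module _ {τ g : ℕ} (0<τ : 0 < τ) (0<g : 0 < g) (C : Subset N) where
    private
      s = g * τ

    -- A set with residual ρ ≥ τ offers at most ρ/s + 1 pieces, and with s = g τ this is at most 2
    -- ρ/τ.
    offered-bound : ∣ offered τ s C ∣ * τ ≤ 2 * Φ τ C
    offered-bound = *-cancelˡ-≤ g {{>-nonZero 0<g}} (begin
      g * (∣ offered τ s C ∣ * τ)                   ≡⟨ shuffle₁ g ∣ offered τ s C ∣ τ ⟩
      ∣ offered τ s C ∣ * s                         ≡⟨ cong (_* s) (sum-tabulate (offers τ s C)) ⟩
      sum (λ i → sum (λ c → indicator (offers τ s C i c))) * s ≡⟨ *-distribʳ-sum s (λ i → sum (λ c → indicator (offers τ s C i c))) ⟩
      sum (λ i → sum (λ c → indicator (offers τ s C i c)) * s) ≤⟨ sum-mono each ⟩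
      sum (λ i → (2 * g) * gate (τ ≤ᵇ ρ C i) (ρ C i)) ≡⟨ sym (*-distribˡ-sum (2 * g) (λ i → gate (τ ≤ᵇ ρ C i) (ρ C i))) ⟩
      2 * g * Φ τ C                                 ≡⟨ shuffle₂ g (Φ τ C) ⟩
      g * (2 * Φ τ C)                               ∎)
      where
      shuffle₁ : ∀ g x t → g * (x * t) ≡ x * (g * t)
      shuffle₁ = solve-∀
      shuffle₂ : ∀ g x → 2 * g * x ≡ g * (2 * x)
      shuffle₂ = solve-∀
      each : ∀ i → sum (λ c → indicator (offers τ s C i c)) * s ≤ (2 * g) * gate (τ ≤ᵇ ρ C i) (ρ C i)
      each i with τ ≤ᵇ ρ C i in eq
      ... | false = ≤-trans (≤-reflexive (cong (_* s) (trans (sum-const N 0) (*-zeroʳ N)))) z≤n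
      ... | true  = begin
        sum {N} (λ c → indicator (suc (toℕ c * s) ≤ᵇ ρ C i)) * s ≤⟨ count-pieces N (ρ C i) s ⟩
        ρ C i + g * τ             ≤⟨ +-mono-≤ (m≤n*m (ρ C i) g {{>-nonZero 0<g}}) (*-monoʳ-≤ g (≤ᵇ-true⁻¹ {τ} eq)) ⟩
        g * ρ C i + g * ρ C i     ≡⟨ shuffle₃ g (ρ C i) ⟩
        2 * g * ρ C i             ∎
        where
        shuffle₃ : ∀ g x → g * x + g * x ≡ 2 * g * x
        shuffle₃ = solve-∀

    module _ {C′ : Subset N} (C⊆C′ : C Subset.⊆ C′) where

      private
        left : Fin m → Fin N → ℕ
        left i c = ∣ slice (F i ─ C) (toℕ c * s) s ─ C′ ∣

      -- A piece that dies leaves less than τ, a 1/g fraction of its span, and an empty piece leaves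
      -- nothing.
      left-bound : ∀ i c → left i c ≤ s * indicator (τ ≤ᵇ left i c) + τ * indicator (suc (toℕ c * s) ≤ᵇ ρ C i)
      left-bound i c with τ ≤ᵇ left i c in eq | suc (toℕ c * s) ≤ᵇ ρ C i in eq₂
      ... | true  | _     = ≤-trans (≤-trans (Subset.∣p─q∣≤∣p∣ (slice (F i ─ C) (toℕ c * s) s) C′) (∣slice∣≤ (F i ─ C) _ s)) (≤-trans (≤-reflexive (sym (*-identityʳ s))) (m≤m+n (s * 1) _))
      ... | false | true  = ≤-trans (<⇒≤ (≤ᵇ-false⁻¹ {τ} eq)) (≤-trans (≤-reflexive (sym (*-identityʳ τ))) (m≤n+m (τ * 1) _))
      ... | false | false = ≤-trans (Subset.∣p─q∣≤∣p∣ (slice (F i ─ C) (toℕ c * s) s) C′) (≤-trans (≤-reflexive (trans (cong ∣_∣ (slice-beyond (F i ─ C) _ s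
              (≤-pred (≤ᵇ-false⁻¹ {suc (toℕ c * s)} eq₂)))) (Subset.∣⊥∣≡0 N))) z≤n)

      remaining : ∀ i → ρ C′ i ≤ sum (left i)
      remaining i = begin
        ∣ F i ─ C′ ∣                                ≤⟨ Subset.p⊆q⇒∣p∣≤∣q∣ sub ⟩
        ∣ (F i ─ C) ─ C′ ∣                          ≡⟨ cong (λ A → ∣ A ─ C′ ∣) (sym (slice-whole (F i ─ C) (N * s) big)) ⟩
        ∣ slice (F i ─ C) 0 (N * s) ─ C′ ∣          ≤⟨ slices-cover (F i ─ C) C′ s N 0 ⟩
        sum (left i)                                ∎
        where
        big : ρ C i ≤ N * s
        big = ≤-trans (Subset.∣p∣≤n (F i ─ C)) (m≤m*n N s {{m*n≢0 g τ {{>-nonZero 0<g}} {{>-nonZero 0<τ}}}})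
        sub : (F i ─ C′) Subset.⊆ ((F i ─ C) ─ C′)
        sub x∈ = subst (_ Subset.∈_) (sym (trans (Subset.p─q─r≡p─q∪r (F i) C C′) (cong (F i ─_) C∪C′≡C′))) x∈
          where
          C∪C′≡C′ : C ∪ C′ ≡ C′
          C∪C′≡C′ = Subset.⊆-antisym (λ x∈ → case Subset.x∈p∪q⁻ C C′ x∈ of λ { (inj₁ p) → C⊆C′ p ; (inj₂ q) → q }) (Subset.q⊆p∪q C C′)

      -- If ρ ≥ s, at most 2 ρ/s pieces are nonempty and the dead ones leave less than τ each,
      -- together at most 2 ρ/g. If ρ < s, the first piece is the whole residual: when it dies, less
      -- than τ is left and the gate closes.
      set-bound : ∀ i → gate (τ ≤ᵇ ρ C′ i) (ρ C′ i) * g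
                ≤ s * g * sum (λ c → indicator (survives τ s C C′ i c)) + 2 * gate (τ ≤ᵇ ρ C i) (ρ C i)
      set-bound i with τ ≤ᵇ ρ C i in eq
      ... | false = ≤-trans (≤-reflexive (cong (λ b → gate b (ρ C′ i) * g) dead)) z≤n
        where
        dead : (τ ≤ᵇ ρ C′ i) ≡ false
        dead with τ ≤ᵇ ρ C′ i in eq′
        ... | false = refl
        ... | true  = contradiction (≤-trans (≤ᵇ-true⁻¹ {τ} eq′) (─-anti-card (F i) C⊆C′)) (<⇒≱ (≤ᵇ-false⁻¹ {τ} eq))
      ... | true with s ≤? ρ C i
      ...   | yes s≤ρ = begin
        gate (τ ≤ᵇ ρ C′ i) (ρ C′ i) * g   ≤⟨ *-monoˡ-≤ g (≤-trans (gate≤ (τ ≤ᵇ ρ C′ i) _) bound) ⟩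
        (s * b + τ * n) * g               ≡⟨ shuffle₁ s b τ n g ⟩
        s * g * b + n * s                 ≤⟨ +-monoʳ-≤ (s * g * b) (≤-trans (count-pieces N (ρ C i) s) (+-monoʳ-≤ (ρ C i) s≤ρ)) ⟩
        s * g * b + (ρ C i + ρ C i)       ≡⟨ cong (λ y → s * g * b + (ρ C i + y)) (sym (+-identityʳ (ρ C i))) ⟩
        s * g * b + 2 * ρ C i             ∎
        where
        b = sum (λ c → indicator (τ ≤ᵇ left i c))
        n = sum {N} (λ c → indicator (suc (toℕ c * s) ≤ᵇ ρ C i))
        shuffle₁ : ∀ s b t n g → (s * b + t * n) * g ≡ s * g * b + n * (g * t)
        shuffle₁ = solve-∀
        bound : ρ C′ i ≤ s * b + τ * n
        bound = ≤-trans (remaining i) (≤-trans (sum-mono (left-bound i))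
          (≤-reflexive (trans (∑-distrib-+ (λ c → s * indicator (τ ≤ᵇ left i c)) (λ c → τ * indicator (suc (toℕ c * s) ≤ᵇ ρ C i))) (cong₂ _+_ (sym (*-distribˡ-sum s (λ c → indicator (τ ≤ᵇ left i c)))) (sym (*-distribˡ-sum τ (λ (c : Fin N) → indicator (suc (toℕ c * s) ≤ᵇ ρ C i))))))))
      ...   | no s≰ρ = small N refl
        where
        ρ≤s : ρ C i ≤ s
        ρ≤s = <⇒≤ (≰⇒> s≰ρ)
        small : ∀ N′ → N′ ≡ N → gate (τ ≤ᵇ ρ C′ i) (ρ C′ i) * g ≤ s * g * sum (λ c → indicator (τ ≤ᵇ left i c)) + 2 * ρ C i
        small zero    refl = ≤-trans (*-monoˡ-≤ g (≤-trans (gate≤ (τ ≤ᵇ ρ C′ i) _) (Subset.∣p∣≤n (F i ─ C′)))) z≤n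
        small (suc N′) refl with τ ≤ᵇ left i zero in eq₀
        ... | true  = begin
          gate (τ ≤ᵇ ρ C′ i) (ρ C′ i) * g   ≤⟨ *-monoˡ-≤ g (≤-trans (gate≤ (τ ≤ᵇ ρ C′ i) _) (≤-trans (─-anti-card (F i) C⊆C′) ρ≤s)) ⟩
          s * g                             ≡⟨ sym (*-identityʳ (s * g)) ⟩
          s * g * 1                         ≤⟨ *-monoʳ-≤ (s * g) (m≤m+n 1 _) ⟩
          s * g * (1 + others)              ≤⟨ m≤m+n _ (2 * ρ C i) ⟩
          s * g * (1 + others) + 2 * ρ C i  ∎
          where
          others = sum {N′} (λ c → indicator (τ ≤ᵇ left i (suc c)))
        ... | false = ≤-trans (≤-reflexive (cong (λ b → gate b (ρ C′ i) * g) dead)) z≤n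
          where
          shrunk : ρ C′ i < τ
          shrunk = begin-strict
            ∣ F i ─ C′ ∣                  ≤⟨ remaining₀ ⟩
            left i zero                   <⟨ ≤ᵇ-false⁻¹ {τ} eq₀ ⟩
            τ                             ∎
            where
            remaining₀ : ∣ F i ─ C′ ∣ ≤ left i zero
            remaining₀ = begin
              ∣ F i ─ C′ ∣                    ≤⟨ Subset.p⊆q⇒∣p∣≤∣q∣ (λ x∈ → subst (_ Subset.∈_) (sym same) x∈) ⟩
              ∣ slice (F i ─ C) 0 s ─ C′ ∣    ∎
              where
              same : slice (F i ─ C) 0 s ─ C′ ≡ F i ─ C′
              same = trans (cong (_─ C′) (slice-whole (F i ─ C) s ρ≤s)) (trans (Subset.p─q─r≡p─q∪r (F i) C C′)
                (cong (F i ─_) (Subset.⊆-antisym (λ x∈ → case Subset.x∈p∪q⁻ C C′ x∈ of λ { (inj₁ p) → C⊆C′ p ; (inj₂ q) → q }) (Subset.q⊆p∪q C C′))))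
          dead : (τ ≤ᵇ ρ C′ i) ≡ false
          dead with τ ≤ᵇ ρ C′ i in eq′
          ... | false = refl
          ... | true  = contradiction (≤ᵇ-true⁻¹ {τ} eq′) (<⇒≱ shrunk)

      Φ-step : Φ τ C′ * g ≤ s * g * ∣ survivors τ s C C′ ∣ + 2 * Φ τ C
      Φ-step = begin
        Φ τ C′ * g                                           ≡⟨ *-distribʳ-sum g (λ i → gate (τ ≤ᵇ ρ C′ i) (ρ C′ i)) ⟩
        sum (λ i → gate (τ ≤ᵇ ρ C′ i) (ρ C′ i) * g)          ≤⟨ sum-mono set-bound ⟩
        sum (λ i → s * g * b i + 2 * gate (τ ≤ᵇ ρ C i) (ρ C i)) ≡⟨ ∑-distrib-+ (λ i → s * g * b i) (λ i → 2 * gate (τ ≤ᵇ ρ C i) (ρ C i)) ⟩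
        sum (λ i → s * g * b i) + sum (λ i → 2 * gate (τ ≤ᵇ ρ C i) (ρ C i))
          ≡⟨ cong₂ _+_ (trans (sym (*-distribˡ-sum (s * g) b)) (cong (s * g *_) (sym (sum-tabulate (survives τ s C C′)))))
                       (sym (*-distribˡ-sum 2 (λ i → gate (τ ≤ᵇ ρ C i) (ρ C i)))) ⟩
        s * g * ∣ survivors τ s C C′ ∣ + 2 * Φ τ C           ∎
        where
        b = λ i → sum (λ c → indicator (survives τ s C C′ i c))

  Φ<τ⇒ρ<τ : ∀ {τ C} → Φ τ C < τ → ∀ i → ρ C i < τ
  Φ<τ⇒ρ<τ {τ} {C} Φ<τ i with τ ≤ᵇ ρ C i in eq
  ... | false = ≤ᵇ-false⁻¹ {τ} eq
  ... | true  = contradiction (≤-trans (≤ᵇ-true⁻¹ {τ} eq) (≤-trans (≤-reflexive (cong (λ b → gate b (ρ C i)) (sym eq))) (term≤sum (λ i → gate (τ ≤ᵇ ρ C i) (ρ C i)) i))) (<⇒≱ Φ<τ)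

  Φ≤ : ∀ {τ C x} → (∀ i → ρ C i ≤ x) → Φ τ C ≤ m * x
  Φ≤ {τ} {C} {x} ρ≤x = ≤-trans (sum-mono (λ i → ≤-trans (gate≤ (τ ≤ᵇ ρ C i) _) (ρ≤x i))) (≤-reflexive (sum-const m x))

lookup-tabulate : ∀ {n} (P : Fin n → Bool) {x} → x Subset.∈ tabulate P → P x ≡ true
lookup-tabulate P {x} x∈ = trans (sym (Vec.lookup∘tabulate P x)) (Vec.[]=⇒lookup x∈)

∧-true : ∀ {b c} → b ∧ c ≡ true → b ≡ true × c ≡ true
∧-true {true} {true} refl = refl , refl

item : ∀ {m N} → (Fin m → Subset N) → Fin (m * (suc N * suc N)) → Subset N
item {m} {N} F q =
  let lh = remainder {m} (suc N * suc N) q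
  in F (quotient (suc N * suc N) q) ∩ interval (toℕ (quotient {suc N} (suc N) lh)) (toℕ (remainder {suc N} (suc N) lh))

item-combine : ∀ {m N} (F : Fin m → Subset N) i l h → item F (combine i (combine l h)) ≡ F i ∩ interval (toℕ l) (toℕ h)
item-combine {N = N} F i l h = trans
  (cong₂ (λ x lh → F x ∩ interval (toℕ (quotient {suc N} (suc N) lh)) (toℕ (remainder {suc N} (suc N) lh)))
    (quotient-combine i (combine l h)) (remainder-combine i (combine l h)))
  (cong₂ (λ x y → F i ∩ interval (toℕ x) (toℕ y)) (quotient-combine l h) (remainder-combine l h))

-- Invariants of the process through all thresholds

record Admissible (K : Config) (m : ℕ) : Set where
  open Config K
  field
    0<k   : 0 < k
    0<β   : 0 < β
    0<Y   : 0 < Y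
    0<top : 0 < top
    wide  : 2 * m * k < 2 ^ (γ * Y)

-- What the analysis requires of the sample. Quantifying over all descriptions of coverings allows
-- an application to whichever pair the adaptive execution reaches.
record Suitable (K : Config) {m N : ℕ} (F : Fin m → Subset N) (hit : ℕ → Subset (m * N)) : Set where
  open Config K
  field
    hit-all : hit 0 ≡ ⊤
    F-small : ∀ i → ∣ F i ∣ ≤ k * (top * β)
    hitting : ∀ i rem → i < top → rem < Y → ∀ e e′ →
      let τ = suc i * β ; L = 2 ^ rate rem
          A = Prune.survivors F τ (span τ) (unionOf (item F) k e) (unionOf (item F) k e′)
      in ∣ A ∣ < L * 2 * ∣ A ∩ hit (rate rem) ∣ + L * 2 * 2 ^ ζ
    thinning : ∀ i rem → i < top → rem < Y → ∀ e →
      let τ = suc i * β ; L = 2 ^ rate rem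
          A = Prune.offered F τ (span τ) (unionOf (item F) k e)
      in L * 2 * ∣ A ∩ hit (rate rem) ∣ < 4 * ∣ A ∣ + L * 2 * 2 ^ ζ

module Analysis
  (K : Config) {m N : ℕ} (adm : Admissible K m)
  (F : Fin m → Subset N) (hit : ℕ → Subset (m * N)) (suitable : Suitable K F hit) (i₀ : Fin m)
  (target : ℕ)
  (target-small : target ≤ Config.k K * (Config.top K * Config.β K))
  (cover : ∀ C r → (∀ i → ∣ F i ─ C ∣ ≤ r) → target ≤ ∣ C ∣ + Config.k K * r)
  where

  open Config K
  open Admissible adm
  open Suitable suitable

  open Process K {m} {N}
  open Prune F
  open State
  open _⊑_

  g : ℕ
  g = 2 ^ (γ + 2)

  0<g : 0 < g
  0<g = m^n>0 2 (γ + 2)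

  -- Each of the k picks may gain β less than the best possible one, because thresholds are β apart;
  -- k β is given up for this at the outset.
  V : ℕ
  V = target ∸ k * β

  -- `progress` is the greedy bound: every pick removes a 1/k fraction of what is missing from V.
  -- `described` connects the state with the union bound.
  record Base (st : State m N) : Set where
    field
      size      : length (picks st) ≤ k
      described : Σ[ e ∈ Fin ((m * (suc N * suc N)) ^ length (picks st)) ] unionOf (item F) (length (picks st)) e ≡ cov st
      within    : cov st Subset.⊆ ⋃ (List.map F (picks st))
      small     : ∣ cov st ∣ ≤ length (picks st) * span (top * β)
      progress  : k ^ length (picks st) * (V ∸ ∣ cov st ∣) ≤ pred k ^ length (picks st) * V

  open Base

  -- The empty interval makes ⊥ an item, so that coverings with fewer than k picks also have
  -- descriptions by exactly k items.
  nothing-item : Σ[ o ∈ _ ] item F o ≡ ⊥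
  nothing-item = combine i₀ (combine {suc N} {suc N} zero zero) ,
    trans (item-combine F i₀ zero zero) (trans (cong (F i₀ ∩_) (interval-empty N)) (Subset.∩-zeroʳ (F i₀)))

  padded : ∀ {st} → Base st → Σ[ e ∈ Fin ((m * (suc N * suc N)) ^ k) ] unionOf (item F) k e ≡ cov st
  padded b =
    let e , eq = described b
        e′ , eq′ = unionOf-pad (item F) (proj₁ nothing-item) (proj₂ nothing-item) (size b) e
    in e′ , trans eq′ eq

  module _ (live : Bool) (C : Subset N) (i rem : ℕ) (p : Fin (m * N)) where
    private
      τ = suc i * β
      piece = pieceAt F hit live C (suc i , rem) p
      R = F (quotient N p) ─ C

    piece-form : Σ[ l ∈ Fin (suc N) ] Σ[ h ∈ Fin (suc N) ] piece ≡ R ∩ interval (toℕ l) (toℕ h)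
    piece-form with live ∧ (lookup (hit (rate rem)) p ∧ (τ ≤ᵇ ∣ R ∣))
    ... | true  = slice-interval R _ _
    ... | false = zero , zero , sym (trans (cong (R ∩_) (interval-empty N)) (Subset.∩-zeroʳ R))

    piece-size : ∣ piece ∣ ≤ span τ
    piece-size with live ∧ (lookup (hit (rate rem)) p ∧ (τ ≤ᵇ ∣ R ∣))
    ... | true  = ∣slice∣≤ R _ _
    ... | false = ≤-trans (≤-reflexive (Subset.∣⊥∣≡0 N)) z≤n

  module Round (i rem : ℕ) (i<top : i < top) (rem<Y : rem < Y) (st₀ : State m N) (base₀ : Base st₀) where
    open ≤-Reasoning
    τ = suc i * β
    s = span τ
    C = cov st₀
    piece = pieceAt F hit (liveᵇ k st₀) C (suc i , rem)
    st₁ = absorbAll τ piece st₀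

    0<τ : 0 < τ
    0<τ = ≤-trans 0<β (m≤m+n β (i * β))

    τ≤topβ : τ ≤ top * β
    τ≤topβ = *-monoˡ-≤ β i<top

    step : (Live k st₀ → V ≤ ∣ C ∣ + k * τ) → ∀ st p → Base st × st₀ ⊑ st → Live k st → τ ≤ ∣ piece p ─ cov st ∣ →
           let st′ = state (quotient N p ∷ picks st) (cov st ∪ piece p) in Base st′ × st₀ ⊑ st′
    step near st p (b , up) live gain = record
      { size      = live
      ; described = let e , eq = described b
                        e′ , eq′ = unionOf-cons (item F) {c} (combine j (combine l h)) e
                    in e′ , trans eq′ (trans (cong₂ _∪_ (item-combine F j l h) eq) join)
      ; within    = λ x∈ → case Subset.x∈p∪q⁻ (cov st) (piece p) x∈ of λ
          { (inj₁ q) → Subset.q⊆p∪q (F j) _ (within b q)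
          ; (inj₂ q) → Subset.p⊆p∪q _ (Subset.p─q⊆p (F j) C (Subset.p∩q⊆p R _ (subst (_ Subset.∈_) form q))) }
      ; small     = begin
          ∣ cov st ∪ piece p ∣                                  ≤⟨ ∣A∪B∣≤∣A∣+∣B∣ (cov st) (piece p) ⟩
          ∣ cov st ∣ + ∣ piece p ∣                              ≤⟨ +-mono-≤ (small b) (≤-trans (piece-size (liveᵇ k st₀) C i rem p) (*-monoʳ-≤ g τ≤topβ)) ⟩
          length (picks st) * span (top * β) + span (top * β)   ≡⟨ +-comm (length (picks st) * span (top * β)) _ ⟩
          span (top * β) + length (picks st) * span (top * β)   ∎
      ; progress  = begin
          k * k ^ c * (V ∸ ∣ cov st ∪ piece p ∣)                ≡⟨ shuffle₁ k (k ^ c) (V ∸ ∣ cov st ∪ piece p ∣) ⟩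
          k ^ c * (k * (V ∸ ∣ cov st ∪ piece p ∣))              ≤⟨ *-monoʳ-≤ (k ^ c) closer ⟩
          k ^ c * (pred k * (V ∸ ∣ cov st ∣))                   ≡⟨ shuffle₂ (k ^ c) (pred k) (V ∸ ∣ cov st ∣) ⟩
          pred k * (k ^ c * (V ∸ ∣ cov st ∣))                   ≤⟨ *-monoʳ-≤ (pred k) (progress b) ⟩
          pred k * (pred k ^ c * V)                             ≡⟨ sym (*-assoc (pred k) _ V) ⟩
          pred k * pred k ^ c * V                               ∎
      } , ⊑-trans up (mk⊑ (Subset.p⊆p∪q (piece p)) (n≤1+n _))
      where
      j = quotient N p
      R = F j ─ C
      c = length (picks st)
      lhf = piece-form (liveᵇ k st₀) C i rem p
      l = proj₁ lhf
      h = proj₁ (proj₂ lhf)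
      form : piece p ≡ R ∩ interval (toℕ l) (toℕ h)
      form = proj₂ (proj₂ lhf)
      J : Subset N
      J = interval (toℕ l) (toℕ h)
      -- The piece was cut from `F j ─ C`, but its item uses `F j` itself: what C removes is covered
      -- already, as C is part of `cov st`. Hence a description does not mention the history.
      join : (F j ∩ J) ∪ cov st ≡ cov st ∪ piece p
      join = Subset.⊆-antisym to from
        where
        to : ((F j ∩ J) ∪ cov st) Subset.⊆ (cov st ∪ piece p)
        to {x} x∈ with Subset.x∈p∪q⁻ (F j ∩ J) (cov st) x∈
        ... | inj₂ q = Subset.p⊆p∪q (piece p) q
        ... | inj₁ q with x Subset.∈? C
        ...   | yes x∈C = Subset.p⊆p∪q (piece p) (grow up x∈C)
        ...   | no  x∉C = Subset.q⊆p∪q (cov st) (piece p) (subst (x Subset.∈_) (sym form)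
                (Subset.x∈p∩q⁺ (Subset.x∈p∧x∉q⇒x∈p─q (Subset.p∩q⊆p (F j) J q) x∉C , Subset.p∩q⊆q (F j) J q)))
        from : (cov st ∪ piece p) Subset.⊆ ((F j ∩ J) ∪ cov st)
        from {x} x∈ with Subset.x∈p∪q⁻ (cov st) (piece p) x∈
        ... | inj₁ q = Subset.q⊆p∪q (F j ∩ J) (cov st) q
        ... | inj₂ q = let q′ = subst (x Subset.∈_) form q in
                       Subset.p⊆p∪q (cov st) (Subset.x∈p∩q⁺ (Subset.p─q⊆p (F j) C (Subset.p∩q⊆p R J q′) , Subset.p∩q⊆q R J q′))
      δ = ∣ piece p ─ cov st ∣
      shuffle₁ : ∀ a b c → a * b * c ≡ b * (a * c)
      shuffle₁ = solve-∀
      shuffle₂ : ∀ a b c → a * (b * c) ≡ b * (a * c)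
      shuffle₂ = solve-∀
      -- `near` was established at the start of the round and survives because coverings only grow;
      -- the accepted gain is at least τ.
      gap : V ∸ ∣ cov st ∣ ≤ k * δ
      gap = m≤n+o⇒m∸n≤o V ∣ cov st ∣ (begin
        V                        ≤⟨ near (≤-trans (s≤s (more up)) live) ⟩
        ∣ C ∣ + k * τ            ≤⟨ +-mono-≤ (Subset.p⊆q⇒∣p∣≤∣q∣ (grow up)) (*-monoʳ-≤ k gain) ⟩
        ∣ cov st ∣ + k * δ       ∎)
      closer : k * (V ∸ ∣ cov st ∪ piece p ∣) ≤ pred k * (V ∸ ∣ cov st ∣)
      closer = begin
        k * (V ∸ ∣ cov st ∪ piece p ∣)            ≡⟨ cong (λ y → k * (V ∸ y)) (∣A∪B∣≡∣A∣+∣B─A∣ (cov st) (piece p)) ⟩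
        k * (V ∸ (∣ cov st ∣ + δ))                ≡⟨ cong (k *_) (sym (∸-+-assoc V ∣ cov st ∣ δ)) ⟩
        k * (V ∸ ∣ cov st ∣ ∸ δ)                  ≡⟨ *-distribˡ-∸ k (V ∸ ∣ cov st ∣) δ ⟩
        k * (V ∸ ∣ cov st ∣) ∸ k * δ              ≤⟨ ∸-monoʳ-≤ (k * (V ∸ ∣ cov st ∣)) gap ⟩
        k * (V ∸ ∣ cov st ∣) ∸ (V ∸ ∣ cov st ∣)   ≡⟨ cong (λ y → y * (V ∸ ∣ cov st ∣) ∸ (V ∸ ∣ cov st ∣)) (sym (suc-pred k {{>-nonZero 0<k}})) ⟩
        suc (pred k) * (V ∸ ∣ cov st ∣) ∸ (V ∸ ∣ cov st ∣) ≡⟨ m+n∸m≡n (V ∸ ∣ cov st ∣) _ ⟩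
        pred k * (V ∸ ∣ cov st ∣)                 ∎

    result : (Live k st₀ → V ≤ ∣ C ∣ + k * τ) → Base st₁ × st₀ ⊑ st₁
    result near = foldl-invariant τ piece (λ st → Base st × st₀ ⊑ st) (step near) (List.allFin (m * N)) st₀ (base₀ , ⊑-refl)

    module _ (up : st₀ ⊑ st₁) (base₁ : Base st₁) (live₁ : Live k st₁) where
      C′ = cov st₁
      A = survivors τ s C C′

      live₀ : liveᵇ k st₀ ≡ true
      live₀ = ≤ᵇ-true (≤-trans (s≤s (more up)) live₁)

      -- A sampled survivor would still gain τ at the end of the round although picks are left,
      -- against `absorbed`. So the hash missed every survivor.
      unsampled : A ∩ hit (rate rem) ≡ ⊥
      unsampled = Subset.Empty-unique λ { (p , p∈) → clash p p∈ }
        where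
        clash : ∀ p → ¬ (p Subset.∈ (A ∩ hit (rate rem)))
        clash p p∈ = <⇒≱ nearly (≤ᵇ-true⁻¹ {τ} (proj₂ surv))
          where
          R = F (quotient N p) ─ C
          sl = slice R (toℕ (remainder {m} N p) * s) s
          surv : (τ ≤ᵇ ∣ R ∣) ≡ true × (τ ≤ᵇ ∣ sl ─ C′ ∣) ≡ true
          surv = ∧-true (lookup-tabulate _ (Subset.p∩q⊆p A _ p∈))
          sampled : piece p ≡ sl
          sampled = cong (λ b → if b then sl else ⊥)
            (cong₂ _∧_ live₀ (cong₂ _∧_ (Vec.[]=⇒lookup (Subset.p∩q⊆q A _ p∈)) (proj₁ surv)))
          nearly : ∣ sl ─ C′ ∣ < τ
          nearly = subst (λ X → ∣ X ─ C′ ∣ < τ) sampled (absorbed τ piece 0<τ (List.allFin (m * N)) st₀ (List.∈-allFin p) live₁)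

      -- `hitting` limits a family that the hash missed entirely, and `rate` was chosen to turn that
      -- limit into this one. At a truncated rate everything is sampled and nothing survives.
      few : ∣ A ∣ * (g * g) ≤ 2 ^ (γ * suc rem)
      few with 2 * γ + 5 + ζ ≤? γ * suc rem
      ... | yes le = begin
        ∣ A ∣ * (g * g)                       ≤⟨ *-monoˡ-≤ (g * g) (<⇒≤ A<) ⟩
        2 ^ l * 2 * 2 ^ ζ * (g * g)           ≡⟨ cong (λ y → 2 ^ l * 2 * 2 ^ ζ * (y * y)) (^-distribˡ-+-* 2 γ 2) ⟩
        2 ^ l * 2 * 2 ^ ζ * (2 ^ γ * 4 * (2 ^ γ * 4)) ≡⟨ shuffle (2 ^ l) (2 ^ ζ) (2 ^ γ) ⟩
        2 ^ l * (2 ^ γ * 2 ^ γ * 32 * 2 ^ ζ)  ≡⟨ cong (2 ^ l *_) (sym powers) ⟩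
        2 ^ l * 2 ^ (2 * γ + 5 + ζ)           ≡⟨ sym (^-distribˡ-+-* 2 l _) ⟩
        2 ^ (l + (2 * γ + 5 + ζ))             ≡⟨ cong (2 ^_) (m∸n+n≡m le) ⟩
        2 ^ (γ * suc rem)                     ∎
        where
        l = rate rem
        shuffle : ∀ a b c → a * 2 * b * (c * 4 * (c * 4)) ≡ a * (c * c * 32 * b)
        shuffle = solve-∀
        powers : 2 ^ (2 * γ + 5 + ζ) ≡ 2 ^ γ * 2 ^ γ * 32 * 2 ^ ζ
        powers = trans (^-distribˡ-+-* 2 (2 * γ + 5) ζ) (cong (_* 2 ^ ζ) (trans (^-distribˡ-+-* 2 (2 * γ) 5)
          (cong (_* 32) (trans (cong (λ y → 2 ^ (γ + y)) (+-identityʳ γ)) (^-distribˡ-+-* 2 γ γ)))))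
        A< : ∣ A ∣ < 2 ^ l * 2 * 2 ^ ζ
        A< = let e , eq = padded base₀ ; e′ , eq′ = padded base₁ in begin-strict
          ∣ A ∣                                       <⟨ subst₂ (λ X X′ → let B = survivors τ s X X′ in ∣ B ∣ < 2 ^ l * 2 * ∣ B ∩ hit l ∣ + 2 ^ l * 2 * 2 ^ ζ) eq eq′ (hitting i rem i<top rem<Y e e′) ⟩
          2 ^ l * 2 * ∣ A ∩ hit l ∣ + 2 ^ l * 2 * 2 ^ ζ ≡⟨ cong (λ y → 2 ^ l * 2 * y + 2 ^ l * 2 * 2 ^ ζ) (trans (cong ∣_∣ unsampled) (Subset.∣⊥∣≡0 (m * N))) ⟩
          2 ^ l * 2 * 0 + 2 ^ l * 2 * 2 ^ ζ           ≡⟨ cong (_+ 2 ^ l * 2 * 2 ^ ζ) (*-zeroʳ (2 ^ l * 2)) ⟩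
          2 ^ l * 2 * 2 ^ ζ                           ∎
      ... | no ≰ = ≤-trans (≤-reflexive (cong (_* (g * g)) (trans (cong ∣_∣ none) (Subset.∣⊥∣≡0 (m * N))))) z≤n
        where
        none : A ≡ ⊥
        none = trans (sym (Subset.∩-identityʳ A)) (trans (cong (A ∩_) (sym hit-all))
          (trans (cong (λ l → A ∩ hit l) (sym (m≤n⇒m∸n≡0 (<⇒≤ (≰⇒> ≰))))) unsampled))

      -- The factor 4 in g = 4 · 2^γ splits into one part for the survivors, two for the remains of
      -- dead pieces, and one to spare.
      pruned : Φ τ C < 2 ^ (γ * suc rem) * τ → Φ τ C′ < 2 ^ (γ * rem) * τ
      pruned Φ< = *-cancelʳ-< g (Φ τ C′) (2 ^ (γ * rem) * τ) (begin-strict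
        Φ τ C′ * g                                  ≤⟨ Φ-step 0<τ 0<g C (grow up) ⟩
        s * g * ∣ A ∣ + 2 * Φ τ C                   ≡⟨ cong (_+ 2 * Φ τ C) (shuffle₁ g τ ∣ A ∣) ⟩
        ∣ A ∣ * (g * g) * τ + 2 * Φ τ C             <⟨ +-mono-≤-< (*-monoˡ-≤ τ few) (*-monoʳ-< 2 Φ<) ⟩
        x * τ + 2 * (x * τ)                         ≤⟨ m≤m+n _ (x * τ) ⟩
        x * τ + 2 * (x * τ) + x * τ                 ≡⟨ cong (λ y → y * τ + 2 * (y * τ) + y * τ) x≡ ⟩
        a * b * τ + 2 * (a * b * τ) + a * b * τ     ≡⟨ shuffle₂ a b τ ⟩
        b * τ * (a * 4)                             ≡⟨ cong (b * τ *_) (sym (^-distribˡ-+-* 2 γ 2)) ⟩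
        b * τ * g                                   ∎)
        where
        x = 2 ^ (γ * suc rem)
        a = 2 ^ γ
        b = 2 ^ (γ * rem)
        x≡ : x ≡ a * b
        x≡ = trans (cong (2 ^_) (*-suc γ rem)) (^-distribˡ-+-* 2 γ (γ * rem))
        shuffle₁ : ∀ g t x → g * t * g * x ≡ x * (g * g) * t
        shuffle₁ = solve-∀
        shuffle₂ : ∀ a b t → a * b * t + 2 * (a * b * t) + a * b * t ≡ b * t * (a * 4)
        shuffle₂ = solve-∀

  Inv : Position → State m N → Set
  Inv (zero  , rem) st = Base st × (Live k st → V ≤ ∣ cov st ∣)
  Inv (suc i , rem) st = i < top × rem < Y × Base st ×
    (Live k st → Φ (suc i * β) (cov st) < 2 ^ (γ * suc rem) * (suc i * β) × V ≤ ∣ cov st ∣ + k * (suc i * β))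

  inv-base : ∀ pos {st} → Inv pos st → Base st
  inv-base (zero  , rem) (b , _)         = b
  inv-base (suc i , rem) (_ , _ , b , _) = b

  private
    suc-predY : suc (pred Y) ≡ Y
    suc-predY = suc-pred Y {{>-nonZero 0<Y}}

    predY<Y : pred Y < Y
    predY<Y = ≤-reflexive suc-predY

    V≤ : ∀ (C : Subset N) {x} → target ≤ ∣ C ∣ + k * (x + β) → V ≤ ∣ C ∣ + k * x
    V≤ C {x} le = m≤n+o⇒m∸n≤o target (k * β) (≤-trans le (≤-reflexive (shuffle ∣ C ∣ k x β)))
      where
      shuffle : ∀ c k x b → c + k * (x + b) ≡ k * b + (c + k * x)
      shuffle = solve-∀

    -- Serves both ways of reaching a threshold τ: initially the sets have at most k τ elements, and
    -- later the residuals are below τ + β ≤ 2 τ.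
    fresh : ∀ i {x} C → x ≤ 2 * k * (suc i * β) → Φ (suc i * β) C ≤ m * x → Φ (suc i * β) C < 2 ^ (γ * suc (pred Y)) * (suc i * β)
    fresh i {x} C x≤ Φ≤mx = begin-strict
      Φ τ C                           ≤⟨ Φ≤mx ⟩
      m * x                           ≤⟨ *-monoʳ-≤ m x≤ ⟩
      m * (2 * k * τ)                 ≡⟨ shuffle m k τ ⟩
      2 * m * k * τ                   <⟨ *-monoˡ-< τ {{>-nonZero (≤-trans 0<β (m≤m+n β (i * β)))}} wide ⟩
      2 ^ (γ * Y) * τ                 ≡⟨ cong (λ y → 2 ^ (γ * y) * τ) (sym suc-predY) ⟩
      2 ^ (γ * suc (pred Y)) * τ      ∎
      where
      open ≤-Reasoning
      τ = suc i * β
      shuffle : ∀ m k t → m * (2 * k * t) ≡ 2 * m * k * t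
      shuffle = solve-∀

  round-inv : ∀ pos st → Inv pos st → Inv (next Y pos) (round F hit pos st)
  round-inv (zero  , rem) st inv = inv
  round-inv (suc i , suc rem) st (i< , rem< , b , more-inv) =
    i< , ≤-trans (n≤1+n _) rem< , base₁ , λ live → Rd.pruned up base₁ live (proj₁ (more-inv (still live))) ,
      ≤-trans (proj₂ (more-inv (still live))) (+-monoˡ-≤ _ (Subset.p⊆q⇒∣p∣≤∣q∣ (grow up)))
    where
    module Rd = Round i (suc rem) i< rem< st b
    both = Rd.result (λ l → proj₂ (more-inv l))
    base₁ = proj₁ both
    up = proj₂ both
    still : Live k Rd.st₁ → Live k st
    still l = ≤-trans (s≤s (more up)) l
  round-inv (suc i , zero) st (i< , rem< , b , more-inv) = finish i refl
    where
    module Rd = Round i 0 i< rem< st b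
    both = Rd.result (λ l → proj₂ (more-inv l))
    base₁ = proj₁ both
    up = proj₂ both
    still : Live k Rd.st₁ → Live k st
    still l = ≤-trans (s≤s (more up)) l
    ρ< : Live k Rd.st₁ → ∀ j → ρ (cov Rd.st₁) j < suc i * β
    ρ< live = Φ<τ⇒ρ<τ {suc i * β} {cov Rd.st₁} (≤-trans (Rd.pruned up base₁ live (proj₁ (more-inv (still live))))
      (≤-reflexive (trans (cong (λ y → 2 ^ y * (suc i * β)) (*-zeroʳ γ)) (*-identityˡ _))))
    bound : Live k Rd.st₁ → target ≤ ∣ cov Rd.st₁ ∣ + k * (i * β + β)
    bound live = cover (cov Rd.st₁) (i * β + β) (λ j → ≤-trans (<⇒≤ (ρ< live j)) (≤-reflexive (+-comm β (i * β))))
    finish : ∀ i′ → i′ ≡ i → Inv (i′ , pred Y) Rd.st₁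
    finish zero     refl = base₁ , λ live → ≤-trans (V≤ (cov Rd.st₁) (bound live)) (≤-reflexive (trans (cong (∣ cov Rd.st₁ ∣ +_) (*-zeroʳ k)) (+-identityʳ _)))
    finish (suc i″) refl = ≤-trans (n≤1+n _) i< , predY<Y , base₁ , λ live →
      fresh i″ (cov Rd.st₁) double (Φ≤ {suc i″ * β} {cov Rd.st₁} (λ j → <⇒≤ (ρ< live j))) , V≤ (cov Rd.st₁) (bound live)
      where
      double : suc i * β ≤ 2 * k * (suc i″ * β)
      double = begin
        β + (β + i″ * β)                          ≤⟨ +-monoˡ-≤ (β + i″ * β) (m≤m+n β (i″ * β)) ⟩
        (β + i″ * β) + (β + i″ * β)               ≡⟨ cong ((β + i″ * β) +_) (sym (+-identityʳ _)) ⟩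
        2 * (suc i″ * β)                          ≤⟨ *-monoˡ-≤ (suc i″ * β) (≤-trans (≤-reflexive (sym (*-identityʳ 2))) (*-monoʳ-≤ 2 0<k)) ⟩
        2 * k * (suc i″ * β)                      ∎
        where open ≤-Reasoning

  start-inv : Inv (top , pred Y) start
  start-inv = go top refl
    where
    go : ∀ t → t ≡ top → Inv (t , pred Y) start
    go zero    refl = contradiction 0<top (λ ())
    go (suc t) refl = ≤-refl , predY<Y , record
      { size = z≤n ; described = zero , refl ; within = λ x∈ → x∈
      ; small = ≤-trans (≤-reflexive (Subset.∣⊥∣≡0 N)) z≤n
      ; progress = *-monoʳ-≤ 1 (m∸n≤m V ∣ ⊥ {N} ∣) } , λ _ →
      fresh t ⊥ (*-monoˡ-≤ (suc t * β) (m≤m+n k (k + 0))) (Φ≤ {suc t * β} {⊥} (λ i → ≤-trans (Subset.∣p─q∣≤∣p∣ (F i) ⊥) (F-small i))) ,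
      ≤-trans (m∸n≤m target (k * β)) (≤-trans target-small (m≤n+m _ ∣ ⊥ {N} ∣))

  run-inv : ∀ t → Inv (position t) (run F hit t)
  run-inv zero    = start-inv
  run-inv (suc t) = round-inv (position t) (run F hit t) (run-inv t)

  -- Either picks are left and V is covered, or exactly k were made and `progress` yields the factor
  -- (1 - 1/k)^k.
  quality : ∀ t → proj₁ (position t) ≡ 0 → let C = cov (run F hit t) in
            k ^ k * (V ∸ ∣ C ∣) ≤ pred k ^ k * V
  quality t eq with position t | run-inv t
  quality t refl | zero , rem | b , done with length (picks (run F hit t)) <? k
  ... | yes live = ≤-trans (≤-reflexive (trans (cong (k ^ k *_) (m≤n⇒m∸n≡0 (done live))) (*-zeroʳ (k ^ k)))) z≤n
  ... | no  full = subst (λ c → k ^ c * (V ∸ ∣ cov (run F hit t) ∣) ≤ pred k ^ c * V) (≤-antisym (size b) (≮⇒≥ full)) (progress b)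

  -- Only offered pieces are nonempty. The bound on Φ leaves fewer than 2 · 2^(γ (rem + 1)) of them,
  -- and `thinning` limits how many of those are sampled.
  sent-bound : ∀ pos {st} → Inv pos st → sum (λ p → ∣ pieceAt F hit (liveᵇ k st) (cov st) pos p ∣) ≤ volume
  sent-bound (zero  , rem) inv = ≤-trans (≤-reflexive (trans (sum-cong-≗ {m * N} (λ p → Subset.∣⊥∣≡0 N)) (trans (sum-const (m * N) 0) (*-zeroʳ (m * N))))) z≤n
  sent-bound (suc i , rem) {st} (i< , rem< , b , more-inv) with liveᵇ k st in eqL
  ... | false = ≤-trans (≤-reflexive (trans (sum-cong-≗ {m * N} (λ p → Subset.∣⊥∣≡0 N)) (trans (sum-const (m * N) 0) (*-zeroʳ (m * N))))) z≤n
  ... | true = begin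
    sum (λ p → ∣ piece p ∣)                     ≤⟨ sum-mono each ⟩
    sum (λ p → s * indicator (lookup (A ∩ hit l) p)) ≡⟨ sym (*-distribˡ-sum s (λ p → indicator (lookup (A ∩ hit l) p))) ⟩
    s * sum (λ p → indicator (lookup (A ∩ hit l) p)) ≡⟨ cong (s *_) (sym (∣∣≡sum (A ∩ hit l))) ⟩
    s * ∣ A ∩ hit l ∣                           ≤⟨ *-monoʳ-≤ s (<⇒≤ few-hits) ⟩
    s * (2 ^ ζ * (4 ^ γ * 128) + 2 ^ ζ)         ≤⟨ *-monoʳ-≤ s (+-monoʳ-≤ (2 ^ ζ * (4 ^ γ * 128)) (m≤m*n (2 ^ ζ) (4 ^ γ * 128) {{m*n≢0 (4 ^ γ) 128 {{m^n≢0 4 γ}}}})) ⟩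
    s * (2 ^ ζ * (4 ^ γ * 128) + 2 ^ ζ * (4 ^ γ * 128)) ≡⟨ cong (λ y → y * τ * (2 ^ ζ * (4 ^ γ * 128) + 2 ^ ζ * (4 ^ γ * 128))) (^-distribˡ-+-* 2 γ 2) ⟩
    2 ^ γ * 4 * τ * (2 ^ ζ * (4 ^ γ * 128) + 2 ^ ζ * (4 ^ γ * 128)) ≡⟨ shuffle (2 ^ γ) τ (2 ^ ζ) (4 ^ γ) ⟩
    2 ^ γ * 4 ^ γ * 1024 * 2 ^ ζ * τ            ≡⟨ cong (λ y → y * 1024 * 2 ^ ζ * τ) (trans (cong (2 ^ γ *_) (^-*-assoc 2 2 γ)) (sym (^-distribˡ-+-* 2 γ (2 * γ)))) ⟩
    2 ^ (3 * γ) * 1024 * 2 ^ ζ * τ              ≡⟨ cong (_* τ) (sym (trans (^-distribˡ-+-* 2 (3 * γ + 10) ζ) (cong (_* 2 ^ ζ) (^-distribˡ-+-* 2 (3 * γ) 10)))) ⟩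
    2 ^ (3 * γ + 10 + ζ) * τ                    ≤⟨ *-monoʳ-≤ (2 ^ (3 * γ + 10 + ζ)) (*-monoˡ-≤ β i<) ⟩
    volume                                      ∎
    where
    open ≤-Reasoning
    τ = suc i * β
    s = span τ
    l = rate rem
    C = cov st
    A = offered τ s C
    live : Live k st
    live = ≤ᵇ-true⁻¹ {suc (length (picks st))} eqL
    piece = pieceAt F hit true C (suc i , rem)
    0<τ : 0 < τ
    0<τ = ≤-trans 0<β (m≤m+n β (i * β))
    shuffle : ∀ a t z f → a * 4 * t * (z * (f * 128) + z * (f * 128)) ≡ a * f * 1024 * z * t
    shuffle = solve-∀
    each : ∀ p → ∣ piece p ∣ ≤ s * indicator (lookup (A ∩ hit l) p)
    each p with lookup (hit l) p in eq₁ | τ ≤ᵇ ∣ F (quotient N p) ─ C ∣ in eq₂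
    ... | false | _     = ≤-trans (≤-reflexive (Subset.∣⊥∣≡0 N)) z≤n
    ... | true  | false = ≤-trans (≤-reflexive (Subset.∣⊥∣≡0 N)) z≤n
    ... | true  | true with suc (toℕ (remainder {m} N p) * s) ≤ᵇ ∣ F (quotient N p) ─ C ∣ in eq₃
    ...   | false = ≤-trans (≤-reflexive (trans (cong ∣_∣ (slice-beyond (F (quotient N p) ─ C) _ s (≤-pred (≤ᵇ-false⁻¹ {suc (toℕ (remainder {m} N p) * s)} eq₃)))) (Subset.∣⊥∣≡0 N))) z≤n
    ...   | true  = ≤-trans (∣slice∣≤ (F (quotient N p) ─ C) _ s) (≤-reflexive (trans (sym (*-identityʳ s)) (cong (λ b → s * indicator b) (sym
              (trans (Vec.lookup-zipWith _∧_ p A (hit l)) (cong₂ _∧_ (trans (Vec.lookup∘tabulate _ p) (cong₂ _∧_ eq₂ eq₃)) eq₁))))))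
    offers< : ∣ A ∣ < 2 * 2 ^ (γ * suc rem)
    offers< = *-cancelʳ-< τ ∣ A ∣ _ (begin-strict
      ∣ A ∣ * τ                         ≤⟨ offered-bound 0<τ 0<g C ⟩
      2 * Φ τ C                         <⟨ *-monoʳ-< 2 (proj₁ (more-inv live)) ⟩
      2 * (2 ^ (γ * suc rem) * τ)       ≡⟨ sym (*-assoc 2 (2 ^ (γ * suc rem)) τ) ⟩
      2 * 2 ^ (γ * suc rem) * τ         ∎)
    rate-large : 2 ^ (γ * suc rem) ≤ 2 ^ l * (4 ^ γ * 32 * 2 ^ ζ)
    rate-large = begin
      2 ^ (γ * suc rem)                 ≤⟨ ^-monoʳ-≤ 2 (m≤n+m∸n (γ * suc rem) (2 * γ + 5 + ζ)) ⟩
      2 ^ (2 * γ + 5 + ζ + l)           ≡⟨ trans (^-distribˡ-+-* 2 (2 * γ + 5 + ζ) l) (*-comm _ (2 ^ l)) ⟩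
      2 ^ l * 2 ^ (2 * γ + 5 + ζ)       ≡⟨ cong (2 ^ l *_) (trans (^-distribˡ-+-* 2 (2 * γ + 5) ζ) (cong (_* 2 ^ ζ) (trans (^-distribˡ-+-* 2 (2 * γ) 5) (cong (_* 32) (sym (^-*-assoc 2 2 γ)))))) ⟩
      2 ^ l * (4 ^ γ * 32 * 2 ^ ζ)      ∎
    few-hits : ∣ A ∩ hit l ∣ < 2 ^ ζ * (4 ^ γ * 128) + 2 ^ ζ
    few-hits = let e , eq = padded b in *-cancelˡ-< (2 ^ l * 2) _ _ (begin-strict
      2 ^ l * 2 * ∣ A ∩ hit l ∣                         <⟨ subst (λ X → let B = offered τ s X in 2 ^ l * 2 * ∣ B ∩ hit l ∣ < 4 * ∣ B ∣ + 2 ^ l * 2 * 2 ^ ζ) eq (thinning i rem i< rem< e) ⟩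
      4 * ∣ A ∣ + 2 ^ l * 2 * 2 ^ ζ                     ≤⟨ +-monoˡ-≤ (2 ^ l * 2 * 2 ^ ζ) (*-monoʳ-≤ 4 (≤-trans (<⇒≤ offers<) (*-monoʳ-≤ 2 rate-large))) ⟩
      4 * (2 * (2 ^ l * (4 ^ γ * 32 * 2 ^ ζ))) + 2 ^ l * 2 * 2 ^ ζ ≡⟨ shuffle₂ (2 ^ l) (4 ^ γ) (2 ^ ζ) ⟩
      2 ^ l * 2 * (2 ^ ζ * (4 ^ γ * 128) + 2 ^ ζ)       ∎)
      where
      shuffle₂ : ∀ a f z → 4 * (2 * (a * (f * 32 * z))) + a * 2 * z ≡ a * 2 * (z * (f * 128) + z)
      shuffle₂ = solve-∀

record Outcome (K : Config) {m N : ℕ} (F : Fin m → Subset N) (hit : ℕ → Subset (m * N)) (t : ℕ) : Set where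
  open Config K
  open Process K {m} {N}
  st : State m N
  st = run F hit t
  field
    size   : length (State.picks st) ≤ k
    within : State.cov st Subset.⊆ ⋃ (List.map F (State.picks st))
    small  : ∣ State.cov st ∣ ≤ k * span (top * β)
    sent   : sum (λ p → ∣ pieceAt F hit (liveᵇ k st) (State.cov st) (position t) p ∣) ≤ volume

-- The target 0 makes the covering condition vacuous, so these facts hold at every sampling level,
-- also where sets were discarded and nothing is known about the optimum.
outcome : ∀ K {m N} {F : Fin m → Subset N} {hit} → Admissible K m → Suitable K F hit → Fin m → ∀ t → Outcome K F hit t
outcome K {m} {N} {F} {hit} adm suitable i₀ t = record
  { size   = An.Base.size base
  ; within = An.Base.within base
  ; small  = ≤-trans (An.Base.small base) (*-monoˡ-≤ (span (top * β)) (An.Base.size base))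
  ; sent   = An.sent-bound (position t) (An.run-inv t) }
  where
  open Config K
  module An = Analysis K adm F hit suitable i₀ 0 z≤n (λ C r _ → z≤n)
  base = An.inv-base (position t) (An.run-inv t)

-- Encoding sets as bit strings: the elements, each in 1 + w bits

digits : ℕ → ℕ → List Bool
digits zero    x = (1 ≤ᵇ x) ∷ []
digits (suc r) x = (2 ^ suc r ≤ᵇ x) ∷ digits r (if 2 ^ suc r ≤ᵇ x then x ∸ 2 ^ suc r else x)

-- r + 1 bits of the current number are still to come, and `acc` is its value so far. The fixed
-- width replaces separators.
parse : ℕ → ℕ → ℕ → List Bool → List ℕ
parse w r       acc []       = []
parse w zero    acc (b ∷ bs) = (2 * acc + indicator b) ∷ parse w w 0 bs
parse w (suc r) acc (b ∷ bs) = parse w r (2 * acc + indicator b) bs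

length-digits : ∀ r x → length (digits r x) ≡ suc r
length-digits zero    x = refl
length-digits (suc r) x = cong suc (length-digits r _)

parse-digits : ∀ w r acc {x} bs → x < 2 ^ suc r →
               parse w r acc (digits r x List.++ bs) ≡ (2 ^ suc r * acc + x) ∷ parse w w 0 bs
parse-digits w zero acc {zero}  bs x< = refl
parse-digits w zero acc {suc zero} bs x< = refl
parse-digits w zero acc {suc (suc x)} bs (s≤s (s≤s ()))
parse-digits w (suc r) acc {x} bs x< with 2 ^ suc r ≤ᵇ x in eq
... | true  = trans (parse-digits w r (2 * acc + 1) bs small) (cong (_∷ parse w w 0 bs) value)
  where
  open ≡-Reasoning
  P = 2 ^ suc r
  P≤x : P ≤ x
  P≤x = ≤ᵇ-true⁻¹ {P} eq
  small : x ∸ P < P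
  small = +-cancelʳ-< P (x ∸ P) P (subst (_< P + P) (sym (m∸n+n≡m P≤x)) (≤-trans x< (≤-reflexive (cong (P +_) (+-identityʳ P)))))
  shuffle : ∀ p a → p * (2 * a + 1) ≡ 2 * p * a + p
  shuffle = solve-∀
  value : P * (2 * acc + 1) + (x ∸ P) ≡ 2 * P * acc + x
  value = begin
    P * (2 * acc + 1) + (x ∸ P)       ≡⟨ cong (_+ (x ∸ P)) (shuffle P acc) ⟩
    2 * P * acc + P + (x ∸ P)         ≡⟨ +-assoc (2 * P * acc) P _ ⟩
    2 * P * acc + (P + (x ∸ P))       ≡⟨ cong (2 * P * acc +_) (m+[n∸m]≡n P≤x) ⟩
    2 * P * acc + x                   ∎
... | false = trans (parse-digits w r (2 * acc + 0) bs (≤ᵇ-false⁻¹ {2 ^ suc r} eq)) (cong (λ y → (y + x) ∷ parse w w 0 bs) (shuffle (2 ^ suc r) acc))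
  where
  shuffle : ∀ p a → p * (2 * a + 0) ≡ 2 * p * a
  shuffle = solve-∀

elementsFrom : ∀ {q} → ℕ → Subset q → List ℕ
elementsFrom x []          = []
elementsFrom x (true ∷ A)  = x ∷ elementsFrom (suc x) A
elementsFrom x (false ∷ A) = elementsFrom (suc x) A

elemᵇ : ℕ → List ℕ → Bool
elemᵇ x []       = false
elemᵇ x (y ∷ ys) = (x ≡ᵇ y) ∨ elemᵇ x ys

encodeAll : ℕ → List ℕ → Message
encodeAll w []       = []
encodeAll w (x ∷ xs) = digits w x List.++ encodeAll w xs

-- The length is proportional to the cardinality and ⊥ becomes the empty message, so a machine with
-- nothing to contribute costs nothing.
encode : ∀ {q} → ℕ → Subset q → Message
encode w A = encodeAll w (elementsFrom 0 A)

decode : ∀ q → ℕ → Message → Subset q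
decode q w msg = tabulate (λ x → elemᵇ (toℕ x) (parse w w 0 msg))

length-encode : ∀ {q} w (A : Subset q) → length (encode w A) ≡ ∣ A ∣ * suc w
length-encode w = go 0
  where
  go : ∀ {q} x (A : Subset q) → length (encodeAll w (elementsFrom x A)) ≡ ∣ A ∣ * suc w
  go x []          = refl
  go x (true ∷ A)  = trans (List.length-++ (digits w x)) (cong₂ _+_ (length-digits w x) (go (suc x) A))
  go x (false ∷ A) = go (suc x) A

parse-encodeAll : ∀ {q} w x (A : Subset q) → x + q ≤ 2 ^ suc w → parse w w 0 (encodeAll w (elementsFrom x A)) ≡ elementsFrom x A
parse-encodeAll w x []          le = refl
parse-encodeAll {suc q} w x (true ∷ A) le = trans (parse-digits w w 0 _ (≤-trans (s≤s (m≤m+n x q)) (≤-trans (≤-reflexive (sym (+-suc x q))) le)))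
  (cong₂ _∷_ (cong (_+ x) (*-zeroʳ (2 ^ suc w))) (parse-encodeAll w (suc x) A (≤-trans (≤-reflexive (sym (+-suc x q))) le)))
parse-encodeAll {suc q} w x (false ∷ A) le = parse-encodeAll w (suc x) A (≤-trans (≤-reflexive (sym (+-suc x q))) le)

≡ᵇ-refl : ∀ x → (x ≡ᵇ x) ≡ true
≡ᵇ-refl zero    = refl
≡ᵇ-refl (suc x) = ≡ᵇ-refl x

>⇒≢ᵇ : ∀ {x y} → x < y → (x ≡ᵇ y) ≡ false × (y ≡ᵇ x) ≡ false
>⇒≢ᵇ {zero}  {suc y} p       = refl , refl
>⇒≢ᵇ {suc x} {suc y} (s≤s p) = >⇒≢ᵇ p

elementsFrom-fresh : ∀ {q} (A : Subset q) {x y} → x < y → elemᵇ x (elementsFrom y A) ≡ false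
elementsFrom-fresh []          x<y = refl
elementsFrom-fresh (true ∷ A)  x<y = cong₂ _∨_ (proj₁ (>⇒≢ᵇ x<y)) (elementsFrom-fresh A (≤-trans x<y (n≤1+n _)))
elementsFrom-fresh (false ∷ A) x<y = elementsFrom-fresh A (≤-trans x<y (n≤1+n _))

tabulate-elements : ∀ {q} x (A : Subset q) → tabulate (λ y → elemᵇ (toℕ y + x) (elementsFrom x A)) ≡ A
tabulate-elements x []          = refl
tabulate-elements x (true ∷ A)  = cong₂ _∷_ (cong (_∨ elemᵇ x (elementsFrom (suc x) A)) (≡ᵇ-refl x))
  (trans (Vec.tabulate-cong (λ y → cong₂ _∨_ (proj₂ (>⇒≢ᵇ (s≤s (m≤n+m x (toℕ y))))) (cong (λ z → elemᵇ z (elementsFrom (suc x) A)) (sym (+-suc (toℕ y) x)))))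
    (tabulate-elements (suc x) A))
tabulate-elements x (false ∷ A) = cong₂ _∷_ (elementsFrom-fresh A ≤-refl)
  (trans (Vec.tabulate-cong (λ y → cong (λ z → elemᵇ z (elementsFrom (suc x) A)) (sym (+-suc (toℕ y) x)))) (tabulate-elements (suc x) A))

decode-encode : ∀ {q w} → q ≤ 2 ^ suc w → (A : Subset q) → decode q w (encode w A) ≡ A
decode-encode {q} {w} q≤ A = trans (Vec.tabulate-cong (λ y → cong₂ elemᵇ (sym (+-identityʳ (toℕ y))) (parse-encodeAll w 0 A q≤))) (tabulate-elements 0 A)

pack : ∀ {a b} → (Fin a → Subset b) → Subset (a * b)
pack {a} {b} f = tabulate (λ e → lookup (f (quotient b e)) (remainder {a} b e))

unpack : ∀ a {b} → Subset (a * b) → Fin a → Subset b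
unpack a A i = tabulate (λ x → lookup A (combine i x))

unpack-pack : ∀ {a b} (f : Fin a → Subset b) i → unpack a (pack f) i ≡ f i
unpack-pack {a} {b} f i = trans (Vec.tabulate-cong (λ x → trans (Vec.lookup∘tabulate _ (combine i x))
  (cong₂ (λ j y → lookup (f j) y) (quotient-combine i x) (remainder-combine i x)))) (Vec.tabulate∘lookup (f i))

∣pack∣ : ∀ {a b} (f : Fin a → Subset b) → ∣ pack f ∣ ≡ sum (λ i → ∣ f i ∣)
∣pack∣ {a} {b} f = trans (∣tabulate∣ {a * b} (λ e → lookup (f (quotient b e)) (remainder {a} b e)))
  (trans (sum-remQuot a b (λ i x → indicator (lookup (f i) x))) (sum-cong-≗ (λ i → sym (∣∣≡sum (f i)))))

pack-cong : ∀ {a b} {f g : Fin a → Subset b} → (∀ i → f i ≡ g i) → pack f ≡ pack g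
pack-cong {a} {b} eq = Vec.tabulate-cong (λ e → cong (λ A → lookup A (remainder {a} b e)) (eq (quotient b e)))

-- Assembling what the machines send

restrict : ∀ {N} → Bool → Subset N → Subset N
restrict true  A = A
restrict false A = ⊥

owned : ∀ {p} → Fin p → Fin p → Bool
owned o i = does (o Fin.≟ i)

owned-suc : ∀ {p} (o i : Fin p) → owned (suc o) (suc i) ≡ owned o i
owned-suc o i with o Fin.≟ i
... | yes _ = refl
... | no  _ = refl

sum-owned : ∀ {p} (o : Fin p) x → sum (λ i → indicator (owned o i) * x) ≡ x
sum-owned {suc p} zero    x = trans (cong (x + 0 +_) (trans (sum-const p 0) (*-zeroʳ p))) (trans (+-identityʳ _) (+-identityʳ x))
sum-owned {suc p} (suc o) x = trans (sum-cong-≗ (λ i → cong (λ b → indicator b * x) (owned-suc o i))) (sum-owned o x)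

∣restrict∣ : ∀ {N} b (A : Subset N) → ∣ restrict b A ∣ ≡ indicator b * ∣ A ∣
∣restrict∣     true  A = sym (*-identityˡ ∣ A ∣)
∣restrict∣ {N} false A = Subset.∣⊥∣≡0 N

union : ∀ {p q} → Vec (Subset q) p → Subset q
union []       = ⊥
union (A ∷ As) = A ∪ union As

lookup-⊥ : ∀ {q} (x : Fin q) → lookup (⊥ {n = q}) x ≡ false
lookup-⊥ x = Vec.lookup-replicate x false

lookup-union : ∀ {p q} (f : Fin p → Subset q) x → lookup (union (tabulate f)) x ≡ anyᵇ (λ i → lookup (f i) x)
lookup-union {zero}  f x = lookup-⊥ x
lookup-union {suc p} f x = trans (Vec.lookup-zipWith _∨_ x (f zero) (union (tabulate (f ∘ suc)))) (cong (lookup (f zero) x ∨_) (lookup-union (f ∘ suc) x))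

anyᵇ-cong : ∀ {q} {P Q : Fin q → Bool} → (∀ i → P i ≡ Q i) → anyᵇ P ≡ anyᵇ Q
anyᵇ-cong {zero}  eq = refl
anyᵇ-cong {suc q} eq = cong₂ _∨_ (eq zero) (anyᵇ-cong (eq ∘ suc))

anyᵇ-none : ∀ q → anyᵇ {q} (λ _ → false) ≡ false
anyᵇ-none zero    = refl
anyᵇ-none (suc q) = anyᵇ-none q

anyᵇ-owned : ∀ {p} (o : Fin p) b → anyᵇ (λ i → owned o i ∧ b) ≡ b
anyᵇ-owned {suc p} zero    b = trans (cong (b ∨_) (anyᵇ-none p)) (Bool.∨-identityʳ b)
anyᵇ-owned {suc p} (suc o) b = trans (anyᵇ-cong (λ i → cong (_∧ b) (owned-suc o i))) (anyᵇ-owned o b)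

lookup-ext : ∀ {q} {A B : Subset q} → (∀ x → lookup A x ≡ lookup B x) → A ≡ B
lookup-ext {A = A} {B} eq = trans (sym (Vec.tabulate∘lookup A)) (trans (Vec.tabulate-cong eq) (Vec.tabulate∘lookup B))

lookup-restrict : ∀ {N} b (A : Subset N) x → lookup (restrict b A) x ≡ b ∧ lookup A x
lookup-restrict true  A x = refl
lookup-restrict false A x = lookup-⊥ x

module _ {a b p : ℕ} (owner : Fin a → Fin p) (f : Fin a → Subset b) where

  union-owned : union (tabulate (λ i → pack (λ x → restrict (owned (owner x) i) (f x)))) ≡ pack f
  union-owned = lookup-ext (λ e → let x = quotient b e ; y = remainder {a} b e in begin
    lookup (union (tabulate (λ i → pack (λ x → restrict (owned (owner x) i) (f x))))) e
      ≡⟨ lookup-union (λ i → pack (λ x → restrict (owned (owner x) i) (f x))) e ⟩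
    anyᵇ (λ i → lookup (pack (λ x → restrict (owned (owner x) i) (f x))) e)
      ≡⟨ anyᵇ-cong (λ i → trans (Vec.lookup∘tabulate _ e) (lookup-restrict (owned (owner x) i) (f x) y)) ⟩
    anyᵇ (λ i → owned (owner x) i ∧ lookup (f x) y)   ≡⟨ anyᵇ-owned (owner x) (lookup (f x) y) ⟩
    lookup (f x) y                                    ≡⟨ sym (Vec.lookup∘tabulate _ e) ⟩
    lookup (pack f) e                                 ∎)
    where
    open ≡-Reasoning

  -- Every set has exactly one owner, so the messages together are as large as the data they carry.
  -- This keeps p out of the communication bound.
  size-owned : sum (λ i → ∣ pack (λ x → restrict (owned (owner x) i) (f x)) ∣) ≡ ∣ pack f ∣
  size-owned = begin
    sum (λ i → ∣ pack (λ x → restrict (owned (owner x) i) (f x)) ∣)   ≡⟨ sum-cong-≗ (λ i → ∣pack∣ (λ x → restrict (owned (owner x) i) (f x))) ⟩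
    sum (λ i → sum (λ x → ∣ restrict (owned (owner x) i) (f x) ∣))    ≡⟨ ∑-comm (λ i x → ∣ restrict (owned (owner x) i) (f x) ∣) ⟩
    sum (λ x → sum (λ i → ∣ restrict (owned (owner x) i) (f x) ∣))    ≡⟨ sum-cong-≗ (λ x → trans (sum-cong-≗ (λ i → ∣restrict∣ (owned (owner x) i) (f x))) (sum-owned (owner x) ∣ f x ∣)) ⟩
    sum (λ x → ∣ f x ∣)                                               ≡⟨ sym (∣pack∣ f) ⟩
    ∣ pack f ∣                                                        ∎
    where open ≡-Reasoning

-- The interactive protocol and its communication

sum-tabulate : ∀ {p} (f : Fin p → ℕ) → Vec.sum (tabulate f) ≡ sum f
sum-tabulate {zero}  f = refl
sum-tabulate {suc p} f = cong (f zero +_) (sum-tabulate (f ∘ suc))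

-- The number of active rounds left, the present one included. It pays for the communication: a
-- round either lowers it by one or sends nothing, so the cost does not grow with r once all
-- thresholds are done.
pot : ℕ → Position → ℕ
pot Y (zero  , rem) = 0
pot Y (suc i , rem) = i * Y + suc rem

pot-next : ∀ Y .{{_ : NonZero Y}} pos → pot Y (next Y pos) ≡ pred (pot Y pos)
pot-next Y (zero  , rem) = refl
pot-next Y (suc zero , zero) = refl
pot-next (suc Y) (suc (suc i) , zero) = trans (+-comm (i * suc Y) (suc Y)) (trans (sym (+-identityʳ _)) (cong pred (sym (+-suc (suc Y + i * suc Y) 0))))
pot-next Y (suc i , suc rem) = trans (+-suc (i * Y) rem) (cong pred (sym (trans (+-suc (i * Y) (suc rem)) (cong suc (+-suc (i * Y) rem)))))

pot-zero : ∀ Y pos → pot Y pos ≡ 0 → proj₁ pos ≡ 0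
pot-zero Y (zero  , rem) eq = refl
pot-zero Y (suc i , rem) eq = contradiction (trans (sym (+-suc (i * Y) rem)) eq) (λ ())

pot-suc : ∀ Y .{{_ : NonZero Y}} {i rem} → pot Y (suc i , rem) ≡ suc (pot Y (next Y (suc i , rem)))
pot-suc Y {i} {rem} = sym (trans (cong suc (pot-next Y (suc i , rem))) (suc-pred (i * Y + suc rem) {{>-nonZero (≤-trans (s≤s z≤n) (m≤n+m (suc rem) (i * Y)))}}))

module Coordinator
  (K : Config) (Lv w Su Sv : ℕ) {{seed-exists : NonZero (Su * Sv)}} {n m p N : ℕ}
  (inst : View n m → Fin Su → Fin Lv → Fin m → Subset N) (hit : Fin Sv → ℕ → Subset (m * N))
  (choose : Fin Su → (Fin Lv → State m N) → Subset m) where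

  open Config K
  open Process K {m} {N}
  open State

  upSize downSize : ℕ
  upSize   = Lv * (m * N) * N
  downSize = Lv * suc N

  level : Fin (Lv * (m * N)) → Fin Lv
  level = quotient (m * N)

  label : Fin (Lv * (m * N)) → Fin (m * N)
  label = remainder {Lv} (m * N)

  -- Besides the covering, a summary carries one bit per level saying whether picks are left. Before
  -- the first summary the machines know the initial state.
  heardState : ∀ {t} → Vec Message t → Fin Lv → Bool × Subset N
  heardState []        j = liveᵇ k (start {m} {N}) , ⊥
  heardState (msg ∷ _) j = let A = unpack Lv {suc N} (decode downSize w msg) j in Vec.head A , Vec.tail A

  received : Vec Message p → Subset upSize
  received ms = union (Vec.map (decode upSize w) ms)

  replay : ∀ {t} → Vec (Vec Message p) t → Fin Lv → State m N
  replay           []        j = start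
  replay {suc t} (ms ∷ hist) j = advance (position t) (λ q → unpack (Lv * (m * N)) (received ms) (combine j q)) (replay hist j)

  -- Silence at threshold zero makes surplus rounds free.
  broadcast : Position → (Fin Lv → State m N) → Message
  broadcast (zero  , _) st = []
  broadcast (suc _ , _) st = encode w (pack {Lv} (λ j → liveᵇ k (st j) ∷ cov (st j)))

  transmit : ∀ {t} → Fin Su → Fin Sv → View n m → Vec Message t → Fin (Lv * (m * N)) → Subset N
  transmit {t} u v vw heard e = let live , C = heardState heard (level e) in
    pieceAt (inst vw u (level e)) (hit v) live C (position t) (label e)

  protocol : Protocol n m p
  protocol = record
    { seeds   = Su * Sv
    ; seeds≢0 = seed-exists
    ; machine = λ s i vw heard → encode w (pack (transmit (quotient Sv s) (remainder {Su} Sv s) vw heard))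
    ; summary = λ s {t} hist → broadcast (position t) (replay hist)
    ; output  = λ s hist → choose (quotient Sv s) (replay hist)
    }

  module Run (S : Sets n m) (owner : Fin m → Fin p) (s : Fin (Su * Sv))
    (full : Fin Lv → Fin m → Subset N)
    (inst-view : ∀ i j x → inst (view S owner i) (quotient Sv s) j x ≡ restrict (owned (owner x) i) (full j x))
    (upSize≤ : upSize ≤ 2 ^ suc w) (downSize≤ : downSize ≤ 2 ^ suc w) where

    open Execution protocol S owner s

    u : Fin Su
    u = quotient Sv s

    v : Fin Sv
    v = remainder {Su} Sv s

    trace : ℕ → Fin Lv → State m N
    trace t j = run (full j) (hit v) t

    offer : ℕ → Fin (Lv * (m * N)) → Subset N
    offer t e = pieceAt (full (level e)) (hit v) (liveᵇ k (trace t (level e))) (cov (trace t (level e))) (position t) (label e)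

    holder : Fin (Lv * (m * N)) → Fin p
    holder e = owner (quotient N (label e))

    share : ℕ → Fin p → Fin (Lv * (m * N)) → Subset N
    share t i e = restrict (owned (holder e) i) (offer t e)

    private
      -- A machine takes ⊥ for a set held elsewhere. All pieces of an empty residual are empty, so
      -- it sends nothing on behalf of that set.
      pieceAt-restrict : ∀ {F F′} b live C pos q → F′ (quotient N q) ≡ restrict b (F (quotient N q)) →
                         pieceAt F′ (hit v) live C pos q ≡ restrict b (pieceAt F (hit v) live C pos q)
      pieceAt-restrict true  live C (zero  , rem) q eq = refl
      pieceAt-restrict false live C (zero  , rem) q eq = refl
      pieceAt-restrict true  live C (suc i , rem) q eq rewrite eq = refl
      pieceAt-restrict false live C (suc i , rem) q eq rewrite eq = empty _
        where
        ∣⊥─∣ : ∣ ⊥ ─ C ∣ ≤ 0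
        ∣⊥─∣ = ≤-trans (Subset.∣p─q∣≤∣p∣ ⊥ C) (≤-reflexive (Subset.∣⊥∣≡0 N))
        empty : ∀ b {lo s} → (if b then slice (⊥ ─ C) lo s else ⊥) ≡ ⊥
        empty true {lo} {s} = slice-beyond (⊥ ─ C) lo s (≤-trans ∣⊥─∣ z≤n)
        empty false = refl

      -- Stated at positive thresholds, where the latest summary really carries the state; at
      -- threshold zero it is empty.
      heard-state : ∀ t i rem → position t ≡ (suc i , rem) → (∀ j → replay (sent t) j ≡ trace t j) →
                    ∀ j → heardState (heard t) j ≡ (liveᵇ k (trace t j) , cov (trace t j))
      heard-state zero    i rem eq same j = refl
      heard-state (suc t) i rem eq same j = cong (λ A → Vec.head A , Vec.tail A) (begin
        unpack Lv (decode downSize w (broadcast (position (suc t)) (replay (sent (suc t))))) j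
          ≡⟨ cong (λ pos → unpack Lv (decode downSize w (broadcast pos (replay (sent (suc t))))) j) eq ⟩
        unpack Lv (decode downSize w (encode w (pack (λ j → flagged (replay (sent (suc t)) j))))) j
          ≡⟨ cong (λ A → unpack Lv A j) (decode-encode {downSize} {w} downSize≤ (pack (λ j → flagged (replay (sent (suc t)) j)))) ⟩
        unpack Lv (pack (λ j → flagged (replay (sent (suc t)) j))) j   ≡⟨ unpack-pack (λ j → flagged (replay (sent (suc t)) j)) j ⟩
        flagged (replay (sent (suc t)) j)                              ≡⟨ cong flagged (same j) ⟩
        flagged (trace (suc t) j)                                      ∎)
        where
        open ≡-Reasoning
        flagged : State m N → Subset (suc N)
        flagged st = liveᵇ k st ∷ cov st

      transmit-share : ∀ t → (∀ j → replay (sent t) j ≡ trace t j) → ∀ i e →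
                       transmit u v (view S owner i) (heard t) e ≡ share t i e
      transmit-share t same i e with position t in eq
      ... | zero  , rem = sym (restrict-⊥ (owned (holder e) i))
        where
        restrict-⊥ : ∀ b → restrict {N} b ⊥ ≡ ⊥
        restrict-⊥ true  = refl
        restrict-⊥ false = refl
      ... | suc x , rem = trans
        (cong (λ lC → pieceAt (inst (view S owner i) u (level e)) (hit v) (proj₁ lC) (proj₂ lC) (suc x , rem) (label e)) (heard-state t x rem eq same (level e)))
        (pieceAt-restrict {full (level e)} {inst (view S owner i) u (level e)} (owned (holder e) i)
          (liveᵇ k (trace t (level e))) (cov (trace t (level e))) (suc x , rem) (label e) (inst-view i (level e) (quotient N (label e))))

    message-eq : ∀ t → (∀ j → replay (sent t) j ≡ trace t j) → ∀ i →
                 Protocol.machine protocol s i (view S owner i) (heard t) ≡ encode w (pack (share t i))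
    message-eq t same i = cong (encode w) (pack-cong (transmit-share t same i))

    replay-sent : ∀ t j → replay (sent t) j ≡ trace t j
    replay-sent zero    j = refl
    replay-sent (suc t) j = trans (cong (advance (position t) (λ q → unpack (Lv * (m * N)) (received messages) (combine j q))) (replay-sent t j))
      (advance-cong (position t) (λ q → trans (cong (λ A → unpack (Lv * (m * N)) A (combine j q)) assembled)
        (trans (unpack-pack (offer t) (combine j q)) (offer-combine q))) (trace t j))
      where
      messages = tabulate (λ i → Protocol.machine protocol s i (view S owner i) (heard t))
      assembled : received messages ≡ pack (offer t)
      assembled = trans (cong union (trans (sym (Vec.tabulate-∘ (decode upSize w) (λ i → Protocol.machine protocol s i (view S owner i) (heard t)))) (Vec.tabulate-cong (λ i →
        trans (cong (decode upSize w) (message-eq t (replay-sent t) i)) (decode-encode {upSize} {w} upSize≤ (pack (share t i)))))))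
        (union-owned holder (offer t))
      offer-combine : ∀ q → offer t (combine j q) ≡ pieceAt (full j) (hit v) (liveᵇ k (trace t j)) (cov (trace t j)) (position t) q
      offer-combine q = cong₂ (λ j q → pieceAt (full j) (hit v) (liveᵇ k (trace t j)) (cov (trace t j)) (position t) q)
        (quotient-combine j q) (remainder-combine j q)

    result-eq : ∀ r → result r ≡ choose u (replay (sent r))
    result-eq r = refl

    module Bits (0<Y : 0 < Y) (volume width : ℕ)
      (sent≤ : ∀ t j → sum (λ q → ∣ pieceAt (full j) (hit v) (liveᵇ k (trace t j)) (cov (trace t j)) (position t) q ∣) ≤ volume)
      (cov≤ : ∀ t j → ∣ cov (trace t j) ∣ ≤ width) where

      private instance
        Y≢0 : NonZero Y
        Y≢0 = >-nonZero 0<Y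

      up down : ℕ
      up   = Lv * volume * suc w
      down = Lv * suc width * suc w

      upBits : ℕ → ℕ
      upBits r = Vec.sum (Vec.map (λ ms → Vec.sum (Vec.map length ms)) (sent r))

      downBits : ℕ → ℕ
      downBits t = Vec.sum (Vec.map length (heard t))

      private
        spoken : ℕ → Fin p → Message
        spoken t i = Protocol.machine protocol s i (view S owner i) (heard t)

        round-bits : ∀ t → Vec.sum (Vec.map length (tabulate (spoken t))) ≡ ∣ pack (offer t) ∣ * suc w
        round-bits t = begin
          Vec.sum (Vec.map length (tabulate (spoken t)))
            ≡⟨ cong Vec.sum (sym (Vec.tabulate-∘ length (spoken t))) ⟩
          Vec.sum (tabulate (λ i → length (spoken t i)))
            ≡⟨ sum-tabulate (λ i → length (spoken t i)) ⟩
          sum (λ i → length (spoken t i))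
            ≡⟨ sum-cong-≗ (λ i → trans (cong length (message-eq t (replay-sent t) i)) (length-encode w (pack (share t i)))) ⟩
          sum (λ i → ∣ pack (share t i) ∣ * suc w)          ≡⟨ sym (*-distribʳ-sum (suc w) (λ i → ∣ pack (share t i) ∣)) ⟩
          sum (λ i → ∣ pack (share t i) ∣) * suc w          ≡⟨ cong (_* suc w) (size-owned holder (offer t)) ⟩
          ∣ pack (offer t) ∣ * suc w                        ∎
          where open ≡-Reasoning

        offer-total : ∀ t → ∣ pack (offer t) ∣ ≡ sum (λ j → sum (λ q → ∣ pieceAt (full j) (hit v) (liveᵇ k (trace t j)) (cov (trace t j)) (position t) q ∣))
        offer-total t = trans (∣pack∣ (offer t))
          (sum-remQuot Lv (m * N) (λ j q → ∣ pieceAt (full j) (hit v) (liveᵇ k (trace t j)) (cov (trace t j)) (position t) q ∣))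

        up-step : ∀ t → ∣ pack (offer t) ∣ * suc w + pot Y (next Y (position t)) * up ≤ pot Y (position t) * up
        up-step t with position t | offer-total t | sent≤ t
        ... | zero  , rem | eq | le = ≤-reflexive (trans (+-identityʳ _) (cong (_* suc w) (trans eq
                (trans (sum-cong-≗ {Lv} (λ j → trans (sum-cong-≗ {m * N} (λ q → Subset.∣⊥∣≡0 N)) (trans (sum-const (m * N) 0) (*-zeroʳ (m * N)))))
                (trans (sum-const Lv 0) (*-zeroʳ Lv))))))
        ... | suc i , rem | eq | le = ≤-trans (+-monoˡ-≤ _ (*-monoˡ-≤ (suc w) (≤-trans (≤-reflexive eq) (≤-trans (sum-mono le) (≤-reflexive (sum-const Lv volume))))))
                (≤-reflexive (cong (_* up) (sym (pot-suc Y {i} {rem}))))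

        up-total : ∀ r → upBits r + pot Y (position r) * up ≤ pot Y (position 0) * up
        up-total zero    = ≤-refl
        up-total (suc r) = begin
          Vec.sum (Vec.map length (tabulate (spoken r))) + upBits r + pot Y (next Y (position r)) * up
            ≡⟨ cong (λ y → y + upBits r + pot Y (next Y (position r)) * up) (round-bits r) ⟩
          ∣ pack (offer r) ∣ * suc w + upBits r + pot Y (next Y (position r)) * up   ≡⟨ shuffle (∣ pack (offer r) ∣ * suc w) (upBits r) _ ⟩
          upBits r + (∣ pack (offer r) ∣ * suc w + pot Y (next Y (position r)) * up) ≤⟨ +-monoʳ-≤ (upBits r) (up-step r) ⟩
          upBits r + pot Y (position r) * up                                         ≤⟨ up-total r ⟩
          pot Y (position 0) * up                                                    ∎
          where
          open ≤-Reasoning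
          shuffle : ∀ a b c → a + b + c ≡ b + (a + c)
          shuffle = solve-∀

        down-step : ∀ pos st → (∀ j → ∣ cov (st j) ∣ ≤ width) →
                    length (broadcast (next Y pos) st) + pot Y (next Y pos) * down ≤ pot Y pos * down
        down-step (zero  , rem) st st≤ = z≤n
        down-step (suc i , rem) st st≤ with next Y (suc i , rem) | pot-suc Y {i} {rem}
        ... | zero  , rem′ | eq = z≤n
        ... | suc i′ , rem′ | eq = ≤-trans (+-monoˡ-≤ _ one) (≤-reflexive (cong (_* down) (sym eq)))
          where
          flagged : Fin Lv → Subset (suc N)
          flagged j = liveᵇ k (st j) ∷ cov (st j)
          ∣∷∣ : ∀ b (A : Subset N) → ∣ b ∷ A ∣ ≤ suc ∣ A ∣
          ∣∷∣ true  A = ≤-refl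
          ∣∷∣ false A = n≤1+n _
          one : length (encode w (pack flagged)) ≤ down
          one = ≤-trans (≤-reflexive (length-encode w (pack flagged))) (*-monoˡ-≤ (suc w)
            (≤-trans (≤-reflexive (∣pack∣ flagged)) (≤-trans (sum-mono (λ j → ≤-trans (∣∷∣ (liveᵇ k (st j)) (cov (st j))) (s≤s (st≤ j)))) (≤-reflexive (sum-const Lv (suc width))))))

        down-total : ∀ t → downBits t + pot Y (position t) * down ≤ pot Y (position 0) * down
        down-total zero    = ≤-refl
        down-total (suc t) = begin
          length (broadcast (position (suc t)) (replay (sent (suc t)))) + downBits t + pot Y (position (suc t)) * down
            ≡⟨ shuffle (length (broadcast (position (suc t)) (replay (sent (suc t))))) (downBits t) _ ⟩
          downBits t + (length (broadcast (position (suc t)) (replay (sent (suc t)))) + pot Y (position (suc t)) * down)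
            ≤⟨ +-monoʳ-≤ (downBits t) (down-step (position t) (replay (sent (suc t)))
              (λ j → ≤-trans (≤-reflexive (cong (λ st → ∣ cov st ∣) (replay-sent (suc t) j))) (cov≤ (suc t) j))) ⟩
          downBits t + pot Y (position t) * down   ≤⟨ down-total t ⟩
          pot Y (position 0) * down                                        ∎
          where
          open ≤-Reasoning
          shuffle : ∀ a b c → a + b + c ≡ b + (a + c)
          shuffle = solve-∀

        pot-start : pot Y (position 0) ≤ top * Y
        pot-start = go top refl
          where
          go : ∀ i → i ≡ top → pot Y (i , pred Y) ≤ top * Y
          go zero    eq   = z≤n
          go (suc i) refl = ≤-reflexive (trans (cong (i * Y +_) (suc-pred Y)) (+-comm (i * Y) Y))

      communication-bound : ∀ r → communication r ≤ top * Y * (up + down)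
      communication-bound r = begin
        communication r                                          ≤⟨ +-mono-≤ {upBits r} {pot Y (position 0) * up} {downBits (pred r)}
                                                                       (≤-trans (m≤m+n (upBits r) _) (up-total r))
                                                                       (≤-trans (m≤m+n (downBits (pred r)) _) (down-total (pred r))) ⟩
        pot Y (position 0) * up + pot Y (position 0) * down      ≡⟨ sym (*-distribˡ-+ (pot Y (position 0)) up down) ⟩
        pot Y (position 0) * (up + down)                         ≤⟨ *-monoˡ-≤ (up + down) pot-start ⟩
        top * Y * (up + down)                                    ∎
        where open ≤-Reasoning

position-done : ∀ K .{{_ : NonZero (Config.Y K)}} t → Config.top K * Config.Y K ≤ t → proj₁ (Config.position K t) ≡ 0
position-done K t le = pot-zero Y (position t) (trans (pot-position t) (m≤n⇒m∸n≡0 (≤-trans (start≤ top) le)))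
  where
  open Config K
  start≤ : ∀ i → pot Y (i , pred Y) ≤ i * Y
  start≤ zero    = z≤n
  start≤ (suc i) = ≤-reflexive (trans (cong (i * Y +_) (suc-pred Y)) (+-comm (i * Y) Y))
  pot-position : ∀ t → pot Y (position t) ≡ pot Y (position 0) ∸ t
  pot-position zero    = refl
  pot-position (suc t) = trans (pot-next Y (position t)) (trans (cong pred (pot-position t)) (pred[m∸n]≡m∸[1+n] (pot Y (position 0)) t))

-- With too few rounds the machines send all their sampled sets, and the coordinator runs the process on its own.
module Centralised
  (K : Config) (T Lv w Su Sv : ℕ) {{seed-exists : NonZero (Su * Sv)}} {n m p N : ℕ}
  (inst : View n m → Fin Su → Fin Lv → Fin m → Subset N) (hit : Fin Sv → ℕ → Subset (m * N))
  (choose : Fin Su → (Fin Lv → State m N) → Subset m) where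

  open Process K {m} {N}

  size : ℕ
  size = Lv * m * N

  received : Vec Message p → Fin Lv → Fin m → Subset N
  received ms j i = unpack (Lv * m) (union (Vec.map (decode size w) ms)) (combine j i)

  states : ∀ {t} → Fin Sv → Vec (Vec Message p) t → Fin Lv → State m N
  states v []       j = start
  states v (ms ∷ _) j = run (received ms j) (hit v) T

  protocol : Protocol n m p
  protocol = record
    { seeds   = Su * Sv
    ; seeds≢0 = seed-exists
    ; machine = λ s i vw heard → encode w (pack (λ e → inst vw (quotient Sv s) (quotient m e) (remainder {Lv} m e)))
    ; summary = λ s hist → []
    ; output  = λ s hist → choose (quotient Sv s) (states (remainder {Su} Sv s) hist)
    }

  module Run (S : Sets n m) (owner : Fin m → Fin p) (s : Fin (Su * Sv))
    (full : Fin Lv → Fin m → Subset N)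
    (inst-view : ∀ i j x → inst (view S owner i) (quotient Sv s) j x ≡ restrict (owned (owner x) i) (full j x))
    (size≤ : size ≤ 2 ^ suc w) where

    open Execution protocol S owner s

    u : Fin Su
    u = quotient Sv s

    v : Fin Sv
    v = remainder {Su} Sv s

    private
      whole : Fin (Lv * m) → Subset N
      whole e = full (quotient m e) (remainder {Lv} m e)

      holder : Fin (Lv * m) → Fin p
      holder e = owner (remainder {Lv} m e)

      share : Fin p → Fin (Lv * m) → Subset N
      share i e = restrict (owned (holder e) i) (whole e)

      spoken : ∀ t → Fin p → Message
      spoken t i = Protocol.machine protocol s i (view S owner i) (heard t)

      spoken-eq : ∀ t i → spoken t i ≡ encode w (pack (share i))
      spoken-eq t i = cong (encode w) (pack-cong (λ e → inst-view i (quotient m e) (remainder {Lv} m e)))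

    received-eq : ∀ t j i → received (tabulate (spoken t)) j i ≡ full j i
    received-eq t j i = trans (cong (λ A → unpack (Lv * m) A (combine j i)) assembled)
      (trans (unpack-pack whole (combine j i)) (cong₂ full (quotient-combine j i) (remainder-combine j i)))
      where
      assembled : union (Vec.map (decode size w) (tabulate (spoken t))) ≡ pack whole
      assembled = trans (cong union (trans (sym (Vec.tabulate-∘ (decode size w) (spoken t))) (Vec.tabulate-cong (λ i →
        trans (cong (decode size w) (spoken-eq t i)) (decode-encode {size} {w} size≤ (pack (share i)))))))
        (union-owned holder whole)

    states-sent : ∀ r .{{_ : NonZero r}} j → states v (sent r) j ≡ run (full j) (hit v) T
    states-sent (suc t) j = run-cong (hit v) (received-eq t j) T

    result-eq : ∀ r → result r ≡ choose u (states v (sent r))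
    result-eq r = refl

    -- Every round repeats the same messages. This regime has r ≤ top, so the repetition fits into
    -- the factor that the thresholds take up otherwise.
    communication-bound : ∀ cap → (∀ j i → ∣ full j i ∣ ≤ cap) → ∀ r → communication r ≤ r * (Lv * m * cap * suc w)
    communication-bound cap full≤ r = ≤-trans (+-mono-≤ (up r) (silent (pred r))) (≤-reflexive (+-identityʳ _))
      where
      open ≤-Reasoning
      silent : ∀ t → Vec.sum (Vec.map length (heard t)) ≤ 0
      silent zero    = z≤n
      silent (suc t) = silent t
      once : ∀ t → Vec.sum (Vec.map length (tabulate (spoken t))) ≤ Lv * m * cap * suc w
      once t = begin
        Vec.sum (Vec.map length (tabulate (spoken t)))      ≡⟨ cong Vec.sum (sym (Vec.tabulate-∘ length (spoken t))) ⟩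
        Vec.sum (tabulate (λ i → length (spoken t i)))      ≡⟨ sum-tabulate (λ i → length (spoken t i)) ⟩
        sum (λ i → length (spoken t i))                     ≡⟨ sum-cong-≗ (λ i → trans (cong length (spoken-eq t i)) (length-encode w (pack (share i)))) ⟩
        sum (λ i → ∣ pack (share i) ∣ * suc w)              ≡⟨ sym (*-distribʳ-sum (suc w) (λ i → ∣ pack (share i) ∣)) ⟩
        sum (λ i → ∣ pack (share i) ∣) * suc w              ≡⟨ cong (_* suc w) (trans (size-owned holder whole) (∣pack∣ whole)) ⟩
        sum (λ e → ∣ whole e ∣) * suc w                     ≤⟨ *-monoˡ-≤ (suc w) (≤-trans (sum-mono (λ e → full≤ (quotient m e) (remainder {Lv} m e))) (≤-reflexive (sum-const (Lv * m) cap))) ⟩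
        Lv * m * cap * suc w                                ∎
      up : ∀ r → Vec.sum (Vec.map (λ ms → Vec.sum (Vec.map length ms)) (sent r)) ≤ r * (Lv * m * cap * suc w)
      up zero    = z≤n
      up (suc t) = +-mono-≤ (once t) (up t)

-- Binary logarithms and the parameters

n≤2^⌈log₂n⌉ : ∀ n → n ≤ 2 ^ ⌈log₂ n ⌉
n≤2^⌈log₂n⌉ = <-rec _ go
  where
  open ≤-Reasoning
  go : ∀ n → (∀ {x} → x < n → x ≤ 2 ^ ⌈log₂ x ⌉) → n ≤ 2 ^ ⌈log₂ n ⌉
  go zero          rec = z≤n
  go (suc zero)    rec = m^n>0 2 ⌈log₂ 1 ⌉
  go (suc (suc n)) rec = begin
    N                                     ≡⟨ sym (⌊n/2⌋+⌈n/2⌉≡n N) ⟩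
    ⌊ N /2⌋ + ⌈ N /2⌉                     ≤⟨ +-monoˡ-≤ ⌈ N /2⌉ (⌊n/2⌋≤⌈n/2⌉ N) ⟩
    ⌈ N /2⌉ + ⌈ N /2⌉                     ≡⟨ cong (⌈ N /2⌉ +_) (sym (+-identityʳ ⌈ N /2⌉)) ⟩
    2 * ⌈ N /2⌉                           ≤⟨ *-monoʳ-≤ 2 (rec (⌈n/2⌉<n n)) ⟩
    2 ^ suc ⌈log₂ ⌈ N /2⌉ ⌉               ≡⟨ cong (λ y → 2 ^ suc y) (⌈log₂⌈n/2⌉⌉≡⌈log₂n⌉∸1 N) ⟩
    2 ^ suc (pred ⌈log₂ N ⌉)              ≡⟨ cong (2 ^_) (suc-pred ⌈log₂ N ⌉ {{>-nonZero (⌈log₂⌉-mono-≤ {2} {N} (s≤s (s≤s z≤n)))}}) ⟩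
    2 ^ ⌈log₂ N ⌉                         ∎
    where
    N = suc (suc n)

round-log : ∀ x → 0 < x → Σ[ c ∈ ℕ ] (x ≤ 2 ^ c × 2 ^ c ≤ 2 * x)
round-log (suc zero)    _ = 0 , ≤-refl , s≤s z≤n
round-log (suc (suc x)) _ with round-log (suc x) (s≤s z≤n)
... | c , le , ge with suc (suc x) ≤? 2 ^ c
...   | yes p = c , p , ≤-trans ge (*-monoʳ-≤ 2 (n≤1+n (suc x)))
...   | no ¬p = suc c , ≤-trans (s≤s (m≤n+m (suc x) x)) (≤-trans (≤-reflexive (cong (suc x +_) (sym (+-identityʳ (suc x))))) (*-monoʳ-≤ 2 le)) ,
                *-monoʳ-≤ 2 (≤-trans (≤-pred (≰⇒> ¬p)) (n≤1+n (suc x)))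

suc≤2^ : ∀ n → suc n ≤ 2 ^ n
suc≤2^ zero    = ≤-refl
suc≤2^ (suc n) = ≤-trans (s≤s (suc≤2^ n)) (≤-trans (+-monoˡ-≤ (2 ^ n) (m^n>0 2 n)) (≤-reflexive (cong (2 ^ n +_) (sym (+-identityʳ (2 ^ n))))))

*-mono-2^ : ∀ a b {x y} → x ≤ 2 ^ a → y ≤ 2 ^ b → x * y ≤ 2 ^ (a + b)
*-mono-2^ a b p q = ≤-trans (*-mono-≤ p q) (≤-reflexive (sym (^-distribˡ-+-* 2 a b)))

^-mono-2^ : ∀ {x} a c → x ≤ 2 ^ a → x ^ c ≤ 2 ^ (c * a)
^-mono-2^ a c p = ≤-trans (^-monoˡ-≤ c p) (≤-reflexive (trans (^-*-assoc 2 a c) (cong (2 ^_) (*-comm a c))))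

-- A is between 32/ε and 128/ε. Every element of [n] is replaced by D copies, and at the right
-- sampling rate 2^-j the optimum keeps between D and 2 D of them. A sampled set larger than cap
-- reveals that the rate is too high and is discarded. β is the step between thresholds, z₁ the
-- sampling error, ν and κ bound the logarithms of the sampled universe and of the number of items.
module Constants (d n m k α γ Y : ℕ) where

  lg A L β z₁ D cap N ν κ L₂ t₂ w : ℕ
  lg  = ⌈log₂ (n + m) ⌉
  A   = 2 ^ (α + 5)
  -- k L bits of certainty outweigh the (m + 1)^k unions, both tails, all levels and the failure
  -- probability. The factor A in β then gives z₁ = A (k L), the deviation at which the tails reach
  -- 2^(-k L).
  L   = (d + 2) * suc lg
  β   = A * L
  z₁  = k * β
  -- Makes the sampling error z₁ a 1/A fraction of D, hence of order ε relative to the sampled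
  -- optimum.
  D   = A * z₁
  cap = 4 * D
  N   = n * D
  ν   = lg + ((α + 5) + (lg + ((α + 5) + L)))
  κ   = lg + (suc ν + suc ν)
  -- The summands stand for the events of the second union bound: levels, thresholds, rounds, two
  -- coverings of k items each, and the failure probability.
  L₂  = lg + (α + 7) + (lg + 2) + κ + (κ + 1) + (d * lg + 1)
  t₂  = k * L₂
  w   = lg + (lg + ν) + ν

  Lv : ℕ
  Lv = suc lg

  top : ℕ
  top = 4 * A

  rounding : Σ[ ζ ∈ ℕ ] (suc (2 * t₂) ≤ 2 ^ ζ × 2 ^ ζ ≤ 2 * suc (2 * t₂))
  rounding = round-log (suc (2 * t₂)) (s≤s z≤n)

  config : Config
  config = record { k = k ; β = β ; γ = γ ; ζ = proj₁ rounding ; Y = Y ; top = top }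

  Su Sv : ℕ
  -- The digits are fine enough for every rate in use: levels go up to `lg`, and the rates for
  -- pieces up to γ Y.
  Su = (2 ^ lg) ^ N
  Sv = (2 ^ (γ * Y)) ^ (m * N)

  instance
    seed-exists : NonZero (Su * Sv)
    seed-exists = m*n≢0 Su Sv {{m^n≢0 (2 ^ lg) N {{m^n≢0 2 lg}}}} {{m^n≢0 (2 ^ (γ * Y)) (m * N) {{m^n≢0 2 (γ * Y)}}}}

  universe : Fin Su → Fin Lv → Subset N
  universe u j = sample lg (toℕ j) N u

  cut : Subset N → Subset N
  cut A = restrict (∣ A ∣ ≤ᵇ cap) A

  inst : View n m → Fin Su → Fin Lv → Fin m → Subset N
  inst vw u j i = cut (lift D (fromMaybe ⊥ (vw i)) ∩ universe u j)

  full : Sets n m → Fin Su → Fin Lv → Fin m → Subset N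
  full S u j i = cut (lift D (S i) ∩ universe u j)

  hit : Fin Sv → ℕ → Subset (m * N)
  hit v l = sample (γ * Y) l (m * N) v

  score : (Fin Lv → State m N) → Fin Lv → ℕ
  score st j = 2 ^ toℕ j * (∣ State.cov (st j) ∣ ∸ z₁)

  best : (Fin Lv → State m N) → Fin Lv
  best st = argmax (score st) zero (List.allFin Lv)

  choose : Fin Su → (Fin Lv → State m N) → Subset m
  choose u st = ⋃ (List.map ⁅_⁆ (State.picks (st (best st))))

  best-score : ∀ st j → score st j ≤ score st (best st)
  best-score st j = All.lookup (f[xs]≤f[argmax] {f = score st} zero (List.allFin Lv)) (List.∈-allFin j)

  -- Index zero is ⊥, so that a union of k members may consist of fewer than k sets.
  family : Sets n m → Fin (suc m) → Subset N
  family S zero    = ⊥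
  family S (suc i) = lift D (S i)

  cap-size : ∀ A → ∣ cut A ∣ ≤ cap
  cap-size A with ∣ A ∣ ≤ᵇ cap in eq
  ... | true  = ≤ᵇ-true⁻¹ {∣ A ∣} eq
  ... | false = ≤-trans (≤-reflexive (Subset.∣⊥∣≡0 N)) z≤n

  cut⊆ : ∀ A → cut A Subset.⊆ A
  cut⊆ A with ∣ A ∣ ≤ᵇ cap
  ... | true  = id
  ... | false = Subset.⊥⊆

  inst-view : ∀ {p} (S : Sets n m) (owner : Fin m → Fin p) u i j x →
              inst (view S owner i) u j x ≡ restrict (owned (owner x) i) (full S u j x)
  inst-view S owner u i j x with does (owner x Fin.≟ i)
  ... | true  = refl
  ... | false = trans (cong (λ A → cut (A ∩ universe u j)) (lift-⊥ D n)) (trans (cong cut (Subset.∩-zeroˡ (universe u j))) (restrict-⊥ (∣ ⊥ {N} ∣ ≤ᵇ cap)))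
    where
    restrict-⊥ : ∀ b → restrict b (⊥ {N}) ≡ ⊥
    restrict-⊥ true  = refl
    restrict-⊥ false = refl

  cap≡ : cap ≡ k * (top * β)
  cap≡ = shuffle A k β
    where
    shuffle : ∀ A k β → 4 * (A * (k * β)) ≡ k * (4 * A * β)
    shuffle = solve-∀

  A≡ : A ≡ suc (pred A)
  A≡ = sym (suc-pred A {{m^n≢0 2 (α + 5)}})

  0<A : 0 < A
  0<A = m^n>0 2 (α + 5)

-- Bad seeds are rare

module Seeds (d n m k α γ Y : ℕ)
  (0<k : 0 < k) (0<n : 0 < n) (k<m : k < m) (0<Y : 0 < Y) (Y-small : Y ≤ 2 ^ (⌈log₂ (n + m) ⌉ + 2)) (S : Sets n m) where

  open Constants d n m k α γ Y
  open Config config using (rate; span; ζ)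

  n≤ : n ≤ 2 ^ lg
  n≤ = ≤-trans (m≤m+n n m) (n≤2^⌈log₂n⌉ (n + m))

  m≤ : m ≤ 2 ^ lg
  m≤ = ≤-trans (m≤n+m m n) (n≤2^⌈log₂n⌉ (n + m))

  suc-m≤ : suc m ≤ 2 ^ lg
  suc-m≤ = ≤-trans (+-monoˡ-≤ m 0<n) (n≤2^⌈log₂n⌉ (n + m))

  k≤ : k ≤ 2 ^ lg
  k≤ = ≤-trans (<⇒≤ k<m) m≤

  N≤ : N ≤ 2 ^ ν
  N≤ = *-mono-2^ lg (α + 5 + (lg + (α + 5 + L))) n≤ (*-mono-2^ (α + 5) (lg + (α + 5 + L)) ≤-refl
    (*-mono-2^ lg (α + 5 + L) k≤ (*-mono-2^ (α + 5) L ≤-refl (n≤2^n L))))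

  suc-N≤ : suc N ≤ 2 ^ suc ν
  suc-N≤ = ≤-trans (+-mono-≤ (m^n>0 2 ν) N≤) (≤-reflexive (cong (2 ^ ν +_) (sym (+-identityʳ (2 ^ ν)))))

  items : ℕ
  items = m * (suc N * suc N)

  items≤ : items ≤ 2 ^ κ
  items≤ = *-mono-2^ lg (suc ν + suc ν) m≤ (*-mono-2^ (suc ν) (suc ν) suc-N≤ suc-N≤)

  union₁ : Fin (suc m ^ k) → Subset N
  union₁ = unionOf (family S) k

  X : Fin Su → Fin Lv → Fin (suc m ^ k) → ℕ
  X u j e = ∣ union₁ e ∩ universe u j ∣

  scale : ∀ {l} → Fin l → ℕ
  scale j = 2 ^ toℕ j * suc (pred A)

  upperᵇ lowerᵇ : Fin Lv → Fin (suc m ^ k) → Fin Su → Bool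
  upperᵇ j e u = (suc (pred A) + 2) * ∣ union₁ e ∣ + scale j * z₁ ≤ᵇ scale j * X u j e
  lowerᵇ j e u = scale j * X u j e + scale j * z₁ ≤ᵇ pred A * ∣ union₁ e ∣

  bad₁ : Fin Su → Bool
  bad₁ u = anyᵇ (λ j → anyᵇ (λ e → upperᵇ j e u ∨ lowerᵇ j e u))

  private
    instance
      predA≢0 : NonZero (pred A)
      predA≢0 = >-nonZero (<⇒<pred (≤-trans (s≤s (s≤s z≤n)) (^-monoʳ-≤ 2 {1} {α + 5} (≤-trans (s≤s z≤n) (m≤n+m 5 α)))))
        where
        <⇒<pred : ∀ {x} → 1 < x → 0 < pred x
        <⇒<pred (s≤s p) = p

    j≤lg : ∀ (j : Fin Lv) → toℕ j ≤ lg
    j≤lg j = ≤-pred (Fin.toℕ<n j)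

    z₁-large : suc (pred A) * (k * L) ≤ z₁
    z₁-large = ≤-reflexive (trans (cong (_* (k * L)) (sym A≡)) (shuffle A k L))
      where
      shuffle : ∀ A k L → A * (k * L) ≡ k * (A * L)
      shuffle = solve-∀

    rare₁ : Rare (k * L) (Lv * (suc m ^ k * 2)) bad₁
    rare₁ = Rare-any Lv (λ j → Rare-any (suc m ^ k) (λ e →
      Rare-∨ (sample-upper-tail (pred A) lg (toℕ j) (union₁ e) (j≤lg j) z₁ z₁-large)
             (sample-lower-tail (pred A) lg (toℕ j) (union₁ e) (j≤lg j) z₁ z₁-large)))

    bound₁ : Lv * (suc m ^ k * 2) * 2 ^ suc (d * lg) ≤ 2 ^ (k * L)
    bound₁ = ≤-trans (*-mono-2^ (lg + (k * lg + 1)) (suc (d * lg)) (*-mono-2^ lg (k * lg + 1) (suc≤2^ lg) (*-mono-2^ (k * lg) 1 (^-mono-2^ lg k suc-m≤) (≤-refl {2}))) (≤-refl {2 ^ suc (d * lg)}))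
      (^-monoʳ-≤ 2 (begin
        lg + (k * lg + 1) + suc (d * lg)                 ≡⟨ shuffle₁ lg d k ⟩
        k * lg + 1 * ((d + 1) * lg + 2)                  ≤⟨ +-monoʳ-≤ (k * lg) (*-mono-≤ 0<k (+-monoʳ-≤ ((d + 1) * lg) (m≤n+m 2 d))) ⟩
        k * lg + k * ((d + 1) * lg + (d + 2))            ≡⟨ shuffle₂ lg d k ⟩
        k * ((d + 2) * suc lg)                           ∎))
      where
      open ≤-Reasoning
      shuffle₁ : ∀ l d k → l + (k * l + 1) + suc (d * l) ≡ k * l + 1 * ((d + 1) * l + 2)
      shuffle₁ = solve-∀
      shuffle₂ : ∀ l d k → k * l + k * ((d + 1) * l + (d + 2)) ≡ k * ((d + 2) * suc l)
      shuffle₂ = solve-∀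

  module Second (u : Fin Su) where

    survivors offered : ∀ (j : Fin Lv) (i : ℕ) → Fin (items ^ k) → Fin (items ^ k) → Subset (m * N)
    survivors j i e e′ = let F = full S u j ; τ = suc i * β in
      Prune.survivors F τ (span τ) (unionOf (item F) k e) (unionOf (item F) k e′)
    offered j i e _ = let F = full S u j ; τ = suc i * β in Prune.offered F τ (span τ) (unionOf (item F) k e)

    -- For pieces a constant relative accuracy suffices: with a = 2 in the tails, the number of hits
    -- is at least half and at most twice its mean, up to the additive error 2^ζ.
    hitᵇ thinᵇ : Fin Lv → ℕ → ℕ → Fin (items ^ k) → Fin (items ^ k) → Fin Sv → Bool
    hitᵇ j i rem e e′ v = let B = survivors j i e e′ ; M = 2 ^ rate rem in
      M * 2 * ∣ B ∩ hit v (rate rem) ∣ + M * 2 * 2 ^ ζ ≤ᵇ 1 * ∣ B ∣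
    thinᵇ j i rem e e′ v = let B = offered j i e e′ ; M = 2 ^ rate rem in
      (2 + 2) * ∣ B ∣ + M * 2 * 2 ^ ζ ≤ᵇ M * 2 * ∣ B ∩ hit v (rate rem) ∣

    bad₂ : Fin Sv → Bool
    bad₂ v = anyᵇ {Lv} (λ j → anyᵇ {top} (λ i → anyᵇ {Y} (λ rem → anyᵇ (λ e → anyᵇ (λ e′ →
      hitᵇ j (toℕ i) (toℕ rem) e e′ v ∨ thinᵇ j (toℕ i) (toℕ rem) e e′ v)))))

    private
      rate≤ : ∀ (rem : Fin Y) → rate (toℕ rem) ≤ γ * Y
      rate≤ rem = ≤-trans (m∸n≤m _ (2 * γ + 5 + ζ)) (*-monoʳ-≤ γ (Fin.toℕ<n rem))

      ζ-large : 2 * t₂ ≤ 2 ^ ζ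
      ζ-large = ≤-trans (n≤1+n _) (proj₁ (proj₂ rounding))

      rare₂ : Rare t₂ (Lv * (top * (Y * (items ^ k * (items ^ k * 2))))) bad₂
      rare₂ = Rare-any Lv (λ j → Rare-any top (λ i → Rare-any Y (λ rem → Rare-any (items ^ k) (λ e → Rare-any (items ^ k) (λ e′ →
        Rare-∨ (sample-lower-tail 1 (γ * Y) (rate (toℕ rem)) (survivors j (toℕ i) e e′) (rate≤ rem) (2 ^ ζ) ζ-large)
               (sample-upper-tail 1 (γ * Y) (rate (toℕ rem)) (offered j (toℕ i) e e′) (rate≤ rem) (2 ^ ζ) ζ-large))))))

      top≤ : top ≤ 2 ^ (α + 7)
      top≤ = ≤-reflexive (trans (*-comm 4 A) (trans (sym (^-distribˡ-+-* 2 (α + 5) 2)) (cong (2 ^_) (+-assoc α 5 2))))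

      bound₂ : Lv * (top * (Y * (items ^ k * (items ^ k * 2)))) * 2 ^ suc (d * lg) ≤ 2 ^ t₂
      bound₂ = ≤-trans (*-mono-2^ (lg + ((α + 7) + ((lg + 2) + (k * κ + (k * κ + 1))))) (suc (d * lg))
        (*-mono-2^ lg ((α + 7) + ((lg + 2) + (k * κ + (k * κ + 1)))) (suc≤2^ lg)
          (*-mono-2^ (α + 7) ((lg + 2) + (k * κ + (k * κ + 1))) top≤
          (*-mono-2^ (lg + 2) (k * κ + (k * κ + 1)) Y-small
          (*-mono-2^ (k * κ) (k * κ + 1) (^-mono-2^ κ k items≤)
          (*-mono-2^ (k * κ) 1 (^-mono-2^ κ k items≤) (≤-refl {2}))))))
        (≤-refl {2 ^ suc (d * lg)}))
        (^-monoʳ-≤ 2 (begin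
          lg + ((α + 7) + ((lg + 2) + (k * κ + (k * κ + 1)))) + suc (d * lg)   ≡⟨ shuffle₁ lg (α + 7) (k * κ) (d * lg) ⟩
          1 * (lg + (α + 7) + (lg + 2) + 1 + (d * lg + 1)) + (k * κ + k * κ)   ≤⟨ +-monoˡ-≤ (k * κ + k * κ) (*-monoˡ-≤ _ 0<k) ⟩
          k * (lg + (α + 7) + (lg + 2) + 1 + (d * lg + 1)) + (k * κ + k * κ)   ≡⟨ shuffle₂ lg (α + 7) κ (d * lg) k ⟩
          t₂                                                                   ∎))
        where
        open ≤-Reasoning
        shuffle₁ : ∀ l a q e → l + (a + ((l + 2) + (q + (q + 1)))) + suc e ≡ 1 * (l + a + (l + 2) + 1 + (e + 1)) + (q + q)
        shuffle₁ = solve-∀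
        shuffle₂ : ∀ l a q e k → k * (l + a + (l + 2) + 1 + (e + 1)) + (k * q + k * q) ≡ k * (l + a + (l + 2) + q + (q + 1) + (e + 1))
        shuffle₂ = solve-∀

    few₂ : tally bad₂ * 2 ^ suc (d * lg) ≤ Sv
    few₂ = Rare-shrink {x = suc (d * lg)} bound₂ rare₂

    module _ {v : Fin Sv} (good : bad₂ v ≡ false) where
      private
        single : ∀ j i rem → i < top → rem < Y → ∀ e e′ → hitᵇ j i rem e e′ v ∨ thinᵇ j i rem e e′ v ≡ false
        single j i rem i< rem< e e′ = subst₂ (λ i rem → hitᵇ j i rem e e′ v ∨ thinᵇ j i rem e e′ v ≡ false)
          (Fin.toℕ-fromℕ< i<) (Fin.toℕ-fromℕ< rem<)
          (anyᵇ-false (bad-at j i′ rem′ e) (anyᵇ-false (λ e → anyᵇ (bad-at j i′ rem′ e))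
            (anyᵇ-false (λ rem → anyᵇ (λ e → anyᵇ (bad-at j i′ rem e))) (anyᵇ-false (λ i → anyᵇ (λ rem → anyᵇ (λ e → anyᵇ (bad-at j i rem e))))
            (anyᵇ-false (λ j → anyᵇ (λ i → anyᵇ (λ rem → anyᵇ (λ e → anyᵇ (bad-at j i rem e))))) good j) i′) rem′) e) e′)
          where
          i′ = Fin.fromℕ< i<
          rem′ = Fin.fromℕ< rem<
          bad-at : Fin Lv → Fin top → Fin Y → Fin (items ^ k) → Fin (items ^ k) → Bool
          bad-at j i rem e e′ = hitᵇ j (toℕ i) (toℕ rem) e e′ v ∨ thinᵇ j (toℕ i) (toℕ rem) e e′ v

      hitting : ∀ j i rem → i < top → rem < Y → ∀ e e′ → let M = 2 ^ rate rem ; B = survivors j i e e′ in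
                ∣ B ∣ < M * 2 * ∣ B ∩ hit v (rate rem) ∣ + M * 2 * 2 ^ ζ
      hitting j i rem i< rem< e e′ = subst (_< 2 ^ rate rem * 2 * ∣ survivors j i e e′ ∩ hit v (rate rem) ∣ + 2 ^ rate rem * 2 * 2 ^ ζ) (*-identityˡ ∣ survivors j i e e′ ∣)
        (≤ᵇ-false⁻¹ {2 ^ rate rem * 2 * ∣ survivors j i e e′ ∩ hit v (rate rem) ∣ + 2 ^ rate rem * 2 * 2 ^ ζ}
          (proj₁ (∨-false (single j i rem i< rem< e e′))))

      thinning : ∀ j i rem → i < top → rem < Y → ∀ e → let M = 2 ^ rate rem ; B = offered j i e e in
                 M * 2 * ∣ B ∩ hit v (rate rem) ∣ < 4 * ∣ B ∣ + M * 2 * 2 ^ ζ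
      thinning j i rem i< rem< e = ≤ᵇ-false⁻¹ {4 * ∣ offered j i e e ∣ + 2 ^ rate rem * 2 * 2 ^ ζ}
        (proj₂ (∨-false {hitᵇ j i rem e e v} (single j i rem i< rem< e e)))

  few₁ : tally bad₁ * 2 ^ suc (d * lg) ≤ Su
  few₁ = Rare-shrink {x = suc (d * lg)} bound₁ rare₁

  bad : Subset (Su * Sv)
  bad = tabulate (λ s → bad₁ (quotient Sv s) ∨ Second.bad₂ (quotient Sv s) (remainder {Su} Sv s))

  bad-rare : ∣ bad ∣ * (n + m) ^ d ≤ Su * Sv
  bad-rare = begin
    ∣ bad ∣ * (n + m) ^ d                        ≤⟨ *-monoʳ-≤ ∣ bad ∣ (^-mono-2^ lg d (n≤2^⌈log₂n⌉ (n + m))) ⟩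
    ∣ bad ∣ * 2 ^ (d * lg)                       ≡⟨ cong (_* 2 ^ (d * lg)) (∣tabulate∣ {Su * Sv} (λ s → bad₁ (quotient Sv s) ∨ Second.bad₂ (quotient Sv s) (remainder {Su} Sv s))) ⟩
    tally (λ s → bad₁ (quotient Sv s) ∨ Second.bad₂ (quotient Sv s) (remainder {Su} Sv s)) * 2 ^ (d * lg)
                                                 ≤⟨ union-seed Su Sv (d * lg) bad₁ Second.bad₂ few₁ Second.few₂ ⟩
    Su * Sv                                      ∎
    where open ≤-Reasoning

  private
    single₁ : ∀ {u} → bad₁ u ≡ false → ∀ j e → upperᵇ j e u ∨ lowerᵇ j e u ≡ false
    single₁ {u} good j e = anyᵇ-false (λ e → upperᵇ j e u ∨ lowerᵇ j e u)
      (anyᵇ-false (λ j → anyᵇ (λ e → upperᵇ j e u ∨ lowerᵇ j e u)) good j) e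

  upper : ∀ {u} → bad₁ u ≡ false → ∀ j e → 2 ^ toℕ j * A * X u j e < (A + 2) * ∣ union₁ e ∣ + 2 ^ toℕ j * A * z₁
  upper {u} good j e = subst (λ a → 2 ^ toℕ j * a * X u j e < (a + 2) * ∣ union₁ e ∣ + 2 ^ toℕ j * a * z₁) (sym A≡)
    (≤ᵇ-false⁻¹ {(suc (pred A) + 2) * ∣ union₁ e ∣ + scale j * z₁} (proj₁ (∨-false (single₁ good j e))))

  lower : ∀ {u} → bad₁ u ≡ false → ∀ j e → pred A * ∣ union₁ e ∣ < 2 ^ toℕ j * A * X u j e + 2 ^ toℕ j * A * z₁
  lower {u} good j e = subst (λ a → pred A * ∣ union₁ e ∣ < 2 ^ toℕ j * a * X u j e + 2 ^ toℕ j * a * z₁) (sym A≡)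
    (≤ᵇ-false⁻¹ {scale j * X u j e + scale j * z₁} (proj₂ (∨-false {upperᵇ j e u} (single₁ good j e))))

-- Coverage by lists of sets, and the optimum

∈⋃⁺ : ∀ {n x} {A : Subset n} {As} → A ∈ As → x Subset.∈ A → x Subset.∈ ⋃ As
∈⋃⁺ {As = B ∷ As} (here refl) x∈ = Subset.p⊆p∪q (⋃ As) x∈
∈⋃⁺ {As = B ∷ As} (there A∈)  x∈ = Subset.q⊆p∪q B (⋃ As) (∈⋃⁺ A∈ x∈)

∈⋃⁻ : ∀ {n x} (As : List (Subset n)) → x Subset.∈ ⋃ As → Σ[ A ∈ Subset n ] (A ∈ As × x Subset.∈ A)
∈⋃⁻ []       x∈ = contradiction x∈ Subset.∉⊥
∈⋃⁻ (A ∷ As) x∈ with Subset.x∈p∪q⁻ A (⋃ As) x∈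
... | inj₁ p = A , here refl , p
... | inj₂ q = let B , B∈ , x∈B = ∈⋃⁻ As q in B , there B∈ , x∈B

members : ∀ {m} → Subset m → List (Fin m)
members []          = []
members (true ∷ T)  = zero ∷ List.map suc (members T)
members (false ∷ T) = List.map suc (members T)

length-members : ∀ {m} (T : Subset m) → length (members T) ≡ ∣ T ∣
length-members []          = refl
length-members (true ∷ T)  = cong suc (trans (List.length-map suc (members T)) (length-members T))
length-members (false ∷ T) = trans (List.length-map suc (members T)) (length-members T)

∈-members : ∀ {m} {T : Subset m} {i} → i Subset.∈ T → i ∈ members T
∈-members {T = true ∷ T}  Vec.here       = here refl
∈-members {T = true ∷ T}  (Vec.there i∈) = there (List.∈-map⁺ suc (∈-members i∈))
∈-members {T = false ∷ T} (Vec.there i∈) = List.∈-map⁺ suc (∈-members i∈)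

module _ {n m : ℕ} (S : Sets n m) where

  covered⊆ : ∀ {xs} (T : Subset m) → (∀ {i} → i Subset.∈ T → i ∈ xs) → covered S T Subset.⊆ ⋃ (List.map S xs)
  covered⊆ T sub x∈ with ∈⋃⁻ _ x∈
  ... | A , A∈ , x∈A with List.∈-map⁻ S A∈
  ...   | i , i∈ , refl = ∈⋃⁺ (List.∈-map⁺ S (sub (proj₂ (List.∈-filter⁻ (Subset._∈? T) {xs = List.allFin m} i∈)))) x∈A

  ⊆covered : ∀ {xs} (T : Subset m) → (∀ {i} → i ∈ xs → i Subset.∈ T) → ⋃ (List.map S xs) Subset.⊆ covered S T
  ⊆covered T sub x∈ with ∈⋃⁻ _ x∈
  ... | A , A∈ , x∈A with List.∈-map⁻ S A∈
  ...   | i , i∈ , refl = ∈⋃⁺ (List.∈-map⁺ S (List.∈-filter⁺ (Subset._∈? T) (List.∈-allFin i) (sub i∈))) x∈A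

  coverage≤n : ∀ T → coverage S T ≤ n
  coverage≤n T = Subset.∣p∣≤n (covered S T)

  ∈-allSubsets : ∀ {m} (T : Subset m) → T ∈ allSubsets m
  ∈-allSubsets []          = here refl
  ∈-allSubsets (false ∷ T) = List.∈-++⁺ˡ (List.∈-map⁺ _ (∈-allSubsets T))
  ∈-allSubsets {suc m} (true ∷ T)  = List.∈-++⁺ʳ (List.map (false ∷_) (allSubsets m)) (List.∈-map⁺ _ (∈-allSubsets T))

  coverage≤opt : ∀ {k T} → ∣ T ∣ ≤ k → coverage S T ≤ opt S k
  coverage≤opt {k} {T} size = All.lookup (xs≤max 0 (List.map (coverage S) (List.filter (λ T → ∣ T ∣ ≤? k) (allSubsets m))))
    (List.∈-map⁺ (coverage S) (List.∈-filter⁺ (λ T → ∣ T ∣ ≤? k) (∈-allSubsets T) size))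

  opt-attained : ∀ k → Σ[ T ∈ Subset m ] (∣ T ∣ ≤ k × opt S k ≤ coverage S T)
  opt-attained k with argmax-sel id 0 (List.map (coverage S) (List.filter (λ T → ∣ T ∣ ≤? k) (allSubsets m)))
  ... | inj₁ eq = ⊥ , ≤-trans (≤-reflexive (Subset.∣⊥∣≡0 m)) z≤n , ≤-trans (≤-reflexive eq) z≤n
  ... | inj₂ o∈ with List.∈-map⁻ (coverage S) o∈
  ...   | T , T∈ , eq = T , proj₂ (List.∈-filter⁻ (λ T → ∣ T ∣ ≤? k) {xs = allSubsets m} T∈) , ≤-reflexive eq

singletons : ∀ {m} → List (Fin m) → Subset m
singletons xs = ⋃ (List.map ⁅_⁆ xs)

∈-singletons : ∀ {m i} {xs : List (Fin m)} → i ∈ xs → i Subset.∈ singletons xs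
∈-singletons {i = i} i∈ = ∈⋃⁺ (List.∈-map⁺ ⁅_⁆ i∈) (Subset.x∈⁅x⁆ i)

∣singletons∣ : ∀ {m} (xs : List (Fin m)) → ∣ singletons xs ∣ ≤ length xs
∣singletons∣ {m} []   = ≤-reflexive (Subset.∣⊥∣≡0 m)
∣singletons∣ (x ∷ xs) = ≤-trans (∣A∪B∣≤∣A∣+∣B∣ ⁅ x ⁆ (singletons xs)) (+-mono-≤ (≤-reflexive (Subset.∣⁅x⁆∣≡1 x)) (∣singletons∣ xs))

-- From sampled coverage to the approximation ratio

floor-log : ∀ o → 0 < o → Σ[ j ∈ ℕ ] (2 ^ j ≤ o × o < 2 * 2 ^ j)
floor-log (suc zero)    _ = 0 , ≤-refl , ≤-refl
floor-log (suc (suc o)) _ with floor-log (suc o) (s≤s z≤n)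
... | j , le , lt with 2 ^ suc j ≤? suc (suc o)
...   | yes p = suc j , p , ≤-trans (s≤s lt) (≤-trans (+-monoˡ-≤ (2 ^ suc j) (m^n>0 2 (suc j))) (≤-reflexive (cong (2 ^ suc j +_) (sym (+-identityʳ (2 ^ suc j))))))
...   | no ¬p = j , ≤-trans le (n≤1+n _) , ≰⇒> ¬p

-- o is the optimum and c the coverage obtained; (P + R)/P approximates e/(e-1), and A = 32 a.
final-ratio : ∀ {k A D z M C x o c P R a} → 0 < k → A ≡ 32 * a → 0 < a → 0 < D → R ≤ P → D ≡ A * z → M ≤ o →
  A * (M * (C ∸ z)) ≤ (A + 2) * (c * D) →
  k ^ k * ((x ∸ z) ∸ C) ≤ pred k ^ k * (x ∸ z) →
  pred A * (o * D) ≤ M * A * x + M * A * z →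
  (P + R) * pred k ^ k ≤ R * k ^ k →
  P * a * o ≤ ((P + R) * a + P) * c
final-ratio {k} {A} {D} {z} {M} {C} {x} {o} {c} {P} {R} {a} 0<k A≡ 0<a 0<D R≤P D≡ M≤o score greedy sampled euler =
  *-cancelˡ-≤ q {{>-nonZero 0<q}} (begin
    q * (P * a * o)                         ≡⟨ s₁ q P a o ⟩
    a * (P * q * o)                         ≤⟨ *-monoʳ-≤ a almost ⟩
    a * (E * (32 * a + 2) * c)              ≡⟨ cong (λ y → a * (E * (y + 2) * c)) (sym q≡) ⟩
    a * (E * (q + 5 + 2) * c)               ≡⟨ s₂ a E q c ⟩
    q * (E * a * c) + 7 * (a * E) * c       ≤⟨ +-monoʳ-≤ (q * (E * a * c)) (*-monoˡ-≤ c slack) ⟩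
    q * (E * a * c) + q * P * c             ≡⟨ s₃ q E a P c ⟩
    q * ((E * a + P) * c)                   ∎)
  where
  open ≤-Reasoning
  E = P + R
  V = x ∸ z
  G = C ∸ z
  -- A - 5, as `main` loses 5 P o. The remaining factor (A + 2)/(A - 5) exceeds 1 by 7/q, and times
  -- E ≤ 2 P this excess stays within P/a.
  q = 32 * a ∸ 5
  0<32a : 5 ≤ 32 * a
  0<32a = ≤-trans (≤-trans (m≤m+n 5 27) (≤-reflexive (sym (*-identityʳ 32)))) (*-monoʳ-≤ 32 0<a)
  q≡ : q + 5 ≡ 32 * a
  q≡ = m∸n+n≡m 0<32a
  s₁ : ∀ q P a o → q * (P * a * o) ≡ a * (P * q * o)
  s₁ = solve-∀
  s₂ : ∀ a E q c → a * (E * (q + 5 + 2) * c) ≡ q * (E * a * c) + 7 * (a * E) * c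
  s₂ = solve-∀
  s₃ : ∀ q E a P c → q * (E * a * c) + q * P * c ≡ q * ((E * a + P) * c)
  s₃ = solve-∀
  E≤2P : E ≤ 2 * P
  E≤2P = ≤-trans (+-monoʳ-≤ P R≤P) (≤-reflexive (cong (P +_) (sym (+-identityʳ P))))
  14a≤q : 14 * a ≤ q
  14a≤q = +-cancelʳ-≤ 5 (14 * a) q (begin
    14 * a + 5            ≤⟨ +-monoʳ-≤ (14 * a) (≤-trans (≤-trans (m≤m+n 5 13) (≤-reflexive (sym (*-identityʳ 18)))) (*-monoʳ-≤ 18 0<a)) ⟩
    14 * a + 18 * a       ≡⟨ sym (*-distribʳ-+ a 14 18) ⟩
    32 * a                ≡⟨ sym q≡ ⟩
    q + 5                 ∎)
  0<q : 0 < q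
  0<q = ≤-trans 0<a (≤-trans (m≤m+n a (13 * a)) 14a≤q)
  slack : 7 * (a * E) ≤ q * P
  slack = begin
    7 * (a * E)           ≤⟨ *-monoʳ-≤ 7 (*-monoʳ-≤ a E≤2P) ⟩
    7 * (a * (2 * P))     ≡⟨ s a P ⟩
    14 * a * P            ≤⟨ *-monoˡ-≤ P 14a≤q ⟩
    q * P                 ∎
    where
    s : ∀ a P → 7 * (a * (2 * P)) ≡ 14 * a * P
    s = solve-∀
  -- `euler` reads (1 - 1/k)^k ≤ R/(P + R), which turns the greedy bound into C ≥ V P/(P + R).
  E[V∸C]≤RV : E * (V ∸ C) ≤ R * V
  E[V∸C]≤RV = *-cancelˡ-≤ (k ^ k) {{m^n≢0 k k {{>-nonZero 0<k}}}} (begin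
    k ^ k * (E * (V ∸ C))         ≡⟨ s (k ^ k) E (V ∸ C) ⟩
    E * (k ^ k * (V ∸ C))         ≤⟨ *-monoʳ-≤ E greedy ⟩
    E * (pred k ^ k * V)          ≡⟨ sym (*-assoc E _ V) ⟩
    E * pred k ^ k * V            ≤⟨ *-monoˡ-≤ V euler ⟩
    R * k ^ k * V                 ≡⟨ s′ R (k ^ k) V ⟩
    k ^ k * (R * V)               ∎)
    where
    s : ∀ a b c → a * (b * c) ≡ b * (a * c)
    s = solve-∀
    s′ : ∀ a b c → a * b * c ≡ b * (a * c)
    s′ = solve-∀
  PV≤EC : P * V ≤ E * C
  PV≤EC = +-cancelʳ-≤ (R * V) _ _ (begin
    P * V + R * V                 ≡⟨ sym (*-distribʳ-+ V P R) ⟩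
    E * V                         ≤⟨ *-monoʳ-≤ E (m≤n+m∸n V C) ⟩
    E * (C + (V ∸ C))             ≡⟨ *-distribˡ-+ E C (V ∸ C) ⟩
    E * C + E * (V ∸ C)           ≤⟨ +-monoʳ-≤ (E * C) E[V∸C]≤RV ⟩
    E * C + R * V                 ∎)
  Px≤ : P * x ≤ E * G + (E + P) * z
  Px≤ = begin
    P * x                         ≤⟨ *-monoʳ-≤ P (m≤n+m∸n x z) ⟩
    P * (z + V)                   ≡⟨ *-distribˡ-+ P z V ⟩
    P * z + P * V                 ≤⟨ +-monoʳ-≤ (P * z) (≤-trans PV≤EC (*-monoʳ-≤ E (m≤n+m∸n C z))) ⟩
    P * z + E * (z + G)           ≡⟨ s P z E G ⟩
    E * G + (E + P) * z           ∎
    where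
    s : ∀ P z E G → P * z + E * (z + G) ≡ E * G + (E + P) * z
    s = solve-∀
  -- One P o comes from replacing A by A - 1 in the sampled optimum. The other four come from the
  -- errors z, because E + 2 P ≤ 4 P and M A z = M D ≤ o D.
  main : P * A * o ≤ E * (A + 2) * c + 5 * P * o
  main = *-cancelʳ-≤ _ _ D {{>-nonZero 0<D}} (begin
    P * A * o * D                                             ≤⟨ *-monoˡ-≤ D (*-monoˡ-≤ o (*-monoʳ-≤ P (m≤n+m∸n A 1))) ⟩
    P * (1 + pred A) * o * D                                  ≡⟨ s P (pred A) o D ⟩
    P * (pred A * (o * D)) + P * o * D                        ≤⟨ +-monoˡ-≤ (P * o * D) (*-monoʳ-≤ P sampled) ⟩
    P * (M * A * x + M * A * z) + P * o * D                   ≡⟨ s′ P M A x z o D ⟩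
    M * A * (P * x) + P * M * (A * z) + P * (o * D)           ≤⟨ +-monoˡ-≤ (P * (o * D)) (+-monoˡ-≤ (P * M * (A * z)) (*-monoʳ-≤ (M * A) Px≤)) ⟩
    M * A * (E * G + (E + P) * z) + P * M * (A * z) + P * (o * D)    ≡⟨ s″ M A E G P z (o * D) ⟩
    E * (A * (M * G)) + (E + P + P) * M * (A * z) + P * (o * D)      ≡⟨ cong (λ y → E * (A * (M * G)) + (E + P + P) * M * y + P * (o * D)) (sym D≡) ⟩
    E * (A * (M * G)) + (E + P + P) * M * D + P * (o * D)     ≤⟨ +-monoˡ-≤ (P * (o * D)) (+-mono-≤ (*-monoʳ-≤ E score) (*-monoˡ-≤ D (*-mono-≤ (+-monoˡ-≤ P (+-monoˡ-≤ P E≤2P)) M≤o))) ⟩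
    E * ((A + 2) * (c * D)) + (2 * P + P + P) * o * D + P * (o * D)  ≡⟨ s‴ E A c D P o ⟩
    (E * (A + 2) * c + 5 * P * o) * D                         ∎)
    where
    s : ∀ P v o D → P * (1 + v) * o * D ≡ P * (v * (o * D)) + P * o * D
    s = solve-∀
    s′ : ∀ P M A x z o D → P * (M * A * x + M * A * z) + P * o * D ≡ M * A * (P * x) + P * M * (A * z) + P * (o * D)
    s′ = solve-∀
    s″ : ∀ M A E G P z y → M * A * (E * G + (E + P) * z) + P * M * (A * z) + P * y ≡ E * (A * (M * G)) + (E + P + P) * M * (A * z) + P * y
    s″ = solve-∀
    s‴ : ∀ E A c D P o → E * ((A + 2) * (c * D)) + (2 * P + P + P) * o * D + P * (o * D) ≡ (E * (A + 2) * c + 5 * P * o) * D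
    s‴ = solve-∀
  almost : P * q * o ≤ E * (32 * a + 2) * c
  almost = +-cancelʳ-≤ (5 * P * o) _ _ (begin
    P * q * o + 5 * P * o                   ≡⟨ s P q o ⟩
    P * (q + 5) * o                         ≡⟨ cong (λ y → P * y * o) (trans q≡ (sym A≡)) ⟩
    P * A * o                               ≤⟨ main ⟩
    E * (A + 2) * c + 5 * P * o             ≡⟨ cong (λ y → E * (y + 2) * c + 5 * P * o) A≡ ⟩
    E * (32 * a + 2) * c + 5 * P * o        ∎)
    where
    s : ∀ P q o → P * q * o + 5 * P * o ≡ P * (q + 5) * o
    s = solve-∀

module Quality (d n m k α γ Y : ℕ)
  (0<k : 0 < k) (0<n : 0 < n) (k<m : k < m) (0<Y : 0 < Y) (Y-small : Y ≤ 2 ^ (⌈log₂ (n + m) ⌉ + 2)) (wide : 2 * m * k < 2 ^ (γ * Y))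
  (S : Sets n m) {u : Fin (Constants.Su d n m k α γ Y)} {v : Fin (Constants.Sv d n m k α γ Y)}
  (good₁ : Seeds.bad₁ d n m k α γ Y 0<k 0<n k<m 0<Y Y-small S u ≡ false)
  (good₂ : Seeds.Second.bad₂ d n m k α γ Y 0<k 0<n k<m 0<Y Y-small S u v ≡ false) where

  open Constants d n m k α γ Y
  open Config config using (position)
  open Seeds d n m k α γ Y 0<k 0<n k<m 0<Y Y-small S

  open Process config {m} {N} using (run)
  open State

  adm : Admissible config m
  adm = record
    { 0<k = 0<k
    ; 0<β = *-mono-≤ 0<A (≤-trans (s≤s z≤n) (*-mono-≤ (m≤n+m 2 d) (s≤s {0} {lg} z≤n)))
    ; 0<Y = 0<Y
    ; 0<top = *-mono-≤ {1} {4} (s≤s z≤n) 0<A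
    ; wide = wide }

  i₀ : Fin m
  i₀ = Fin.fromℕ< k<m

  suitable : ∀ j → Suitable config (full S u j) (hit v)
  suitable j = record
    { hit-all  = sample-zero (γ * Y) (m * N) v
    ; F-small  = λ i → ≤-trans (cap-size (lift D (S i) ∩ universe u j)) (≤-reflexive cap≡)
    ; hitting  = Second.hitting u good₂ j
    ; thinning = Second.thinning u good₂ j }

  trace : ℕ → Fin Lv → State m N
  trace t j = run (full S u j) (hit v) t

  outcomes : ∀ t j → Outcome config (full S u j) (hit v) t
  outcomes t j = outcome config adm (suitable j) i₀ t

  indexed : ∀ xs → length xs ≤ k → Σ[ e ∈ Fin (suc m ^ k) ] union₁ e ≡ lift D (⋃ (List.map S xs))
  indexed xs size = let e , eq = exact xs ; e′ , eq′ = unionOf-pad (family S) zero refl size e in e′ , trans eq′ eq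
    where
    exact : ∀ xs → Σ[ e ∈ Fin (suc m ^ length xs) ] unionOf (family S) (length xs) e ≡ lift D (⋃ (List.map S xs))
    exact []       = zero , sym (lift-⊥ D n)
    exact (x ∷ xs) = let e , eq = exact xs ; e′ , eq′ = unionOf-cons (family S) {length xs} (suc x) e in
      e′ , trans eq′ (trans (cong (lift D (S x) ∪_) eq) (sym (lift-∪ D (S x) (⋃ (List.map S xs)))))

  -- At a level with a poor sample the subtracted z₁ absorbs the sampling error, so a high score is never spurious.
  module _ (t : ℕ) (j : Fin Lv) where
    private
      C = cov (trace t j)
      xs = picks (trace t j)
      chosen = singletons xs

    score-bound : A * (2 ^ toℕ j * (∣ C ∣ ∸ z₁)) ≤ (A + 2) * (coverage S chosen * D)
    score-bound = begin
      A * (M * (∣ C ∣ ∸ z₁))                ≤⟨ *-monoʳ-≤ A (*-monoʳ-≤ M (∸-monoˡ-≤ z₁ C≤X)) ⟩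
      A * (M * (X u j e ∸ z₁))              ≡⟨ shuffle A M (X u j e ∸ z₁) ⟩
      M * A * (X u j e ∸ z₁)                ≡⟨ *-distribˡ-∸ (M * A) (X u j e) z₁ ⟩
      M * A * X u j e ∸ M * A * z₁          ≤⟨ ∸-monoˡ-≤ (M * A * z₁) (<⇒≤ (upper good₁ j e)) ⟩
      (A + 2) * ∣ union₁ e ∣ + M * A * z₁ ∸ M * A * z₁   ≡⟨ m+n∸n≡m _ (M * A * z₁) ⟩
      (A + 2) * ∣ union₁ e ∣                ≤⟨ *-monoʳ-≤ (A + 2) U≤ ⟩
      (A + 2) * (coverage S chosen * D)          ∎
      where
      open ≤-Reasoning
      M = 2 ^ toℕ j
      index = indexed xs (Outcome.size (outcomes t j))
      e = proj₁ index
      shuffle : ∀ a m x → a * (m * x) ≡ m * a * x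
      shuffle = solve-∀
      picked : ∀ ys {x} → x Subset.∈ ⋃ (List.map (full S u j) ys) → x Subset.∈ lift D (⋃ (List.map S ys)) × x Subset.∈ universe u j
      picked []       x∈ = contradiction x∈ Subset.∉⊥
      picked (y ∷ ys) x∈ with Subset.x∈p∪q⁻ (full S u j y) _ x∈
      ... | inj₁ p = let p′ = cut⊆ (lift D (S y) ∩ universe u j) p in
                     subst (_ Subset.∈_) (sym (lift-∪ D (S y) (⋃ (List.map S ys)))) (Subset.p⊆p∪q _ (Subset.p∩q⊆p (lift D (S y)) (universe u j) p′)) ,
                     Subset.p∩q⊆q (lift D (S y)) (universe u j) p′
      ... | inj₂ q = let l , r = picked ys q in subst (_ Subset.∈_) (sym (lift-∪ D (S y) (⋃ (List.map S ys)))) (Subset.q⊆p∪q (lift D (S y)) _ l) , r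
      C≤X : ∣ C ∣ ≤ X u j e
      C≤X = Subset.p⊆q⇒∣p∣≤∣q∣ (λ x∈ → let l , r = picked xs (Outcome.within (outcomes t j) x∈) in
        Subset.x∈p∩q⁺ (subst (_ Subset.∈_) (sym (proj₂ index)) l , r))
      U≤ : ∣ union₁ e ∣ ≤ coverage S chosen * D
      U≤ = ≤-trans (≤-reflexive (trans (cong ∣_∣ (proj₂ index)) (∣lift∣ D (⋃ (List.map S xs)))))
        (*-monoˡ-≤ D (Subset.p⊆q⇒∣p∣≤∣q∣ (⊆covered S {xs} chosen ∈-singletons)))

  module _ (o : ℕ) (j : Fin Lv) (o<2M : o < 2 * 2 ^ toℕ j) where
    private
      M = 2 ^ toℕ j
      5≤2A : 5 ≤ 2 * A
      5≤2A = ≤-trans (m≤m+n 5 59) (^-monoʳ-≤ 2 {6} {suc (α + 5)} (s≤s (m≤n+m 5 α)))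

    -- At the level fitting o the mean of the sample is below 2 D, and the deviations add at most 5
    -- D/A ≤ 2 D.
    uncapped : ∀ e → ∣ union₁ e ∣ ≤ o * D → X u j e ≤ cap
    uncapped e U≤ = <⇒≤ (*-cancelˡ-< (M * A) (X u j e) cap (begin-strict
      M * A * X u j e                               <⟨ upper good₁ j e ⟩
      (A + 2) * ∣ union₁ e ∣ + M * A * z₁           ≤⟨ +-monoˡ-≤ (M * A * z₁) (*-monoʳ-≤ (A + 2) (≤-trans U≤ (*-monoˡ-≤ D (<⇒≤ o<2M)))) ⟩
      (A + 2) * (2 * M * D) + M * A * z₁            ≡⟨ s₁ A M z₁ ⟩
      (2 * A + 5) * (M * D)                         ≤⟨ *-monoˡ-≤ (M * D) (+-monoʳ-≤ (2 * A) 5≤2A) ⟩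
      (2 * A + 2 * A) * (M * D)                     ≡⟨ s₂ A M D ⟩
      M * A * cap                                   ∎))
      where
      open ≤-Reasoning
      s₁ : ∀ A M z → (A + 2) * (2 * M * (A * z)) + M * A * z ≡ (2 * A + 5) * (M * (A * z))
      s₁ = solve-∀
      s₂ : ∀ A M D → (2 * A + 2 * A) * (M * D) ≡ M * A * (4 * D)
      s₂ = solve-∀

  module _ (t : ℕ) (done : proj₁ (position t) ≡ 0) (st : Fin Lv → State m N) (st-eq : ∀ j → st j ≡ trace t j) where
    private
      o = opt S k
      ĵ = best st
      T̂ = choose u st

      T̂≡ : T̂ ≡ singletons (picks (trace t ĵ))
      T̂≡ = cong (singletons ∘ picks) (st-eq ĵ)

    choose-size : ∣ T̂ ∣ ≤ k
    choose-size = ≤-trans (≤-reflexive (cong ∣_∣ T̂≡)) (≤-trans (∣singletons∣ (picks (trace t ĵ))) (Outcome.size (outcomes t ĵ)))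

    module _ (0<o : 0 < o) {P R : ℕ} (R≤P : R ≤ P) (euler : (P + R) * pred k ^ k ≤ R * k ^ k) where

      private
        flog = floor-log o 0<o
        open ≤-Reasoning
        attained = opt-attained S k
        optimal = proj₁ attained
        o≤n : o ≤ n
        o≤n = ≤-trans (proj₂ (proj₂ attained)) (coverage≤n S optimal)
        j≤lg : proj₁ flog < Lv
        j≤lg = s≤s (≮⇒≥ (λ lt → <⇒≱ (^-monoʳ-< 2 (s≤s (s≤s z≤n)) lt) (≤-trans (proj₁ (proj₂ flog)) (≤-trans o≤n n≤))))
        j : Fin Lv
        j = Fin.fromℕ< j≤lg
        toℕ-j : toℕ j ≡ proj₁ flog
        toℕ-j = Fin.toℕ-fromℕ< j≤lg
        o<2M : o < 2 * 2 ^ toℕ j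
        o<2M = subst (λ y → o < 2 * 2 ^ y) (sym toℕ-j) (proj₂ (proj₂ flog))
        score₀ : Fin Lv → ℕ
        score₀ j = 2 ^ toℕ j * (∣ cov (trace t j) ∣ ∸ z₁)
        C = cov (trace t j)
        xs = members optimal
        index = indexed xs (≤-trans (≤-reflexive (length-members optimal)) (proj₁ (proj₂ attained)))
        e = proj₁ index
        target = X u j e
        U≡ : ∣ union₁ e ∣ ≡ ∣ ⋃ (List.map S xs) ∣ * D
        U≡ = trans (cong ∣_∣ (proj₂ index)) (∣lift∣ D (⋃ (List.map S xs)))
        o≤U : o * D ≤ ∣ union₁ e ∣
        o≤U = ≤-trans (*-monoˡ-≤ D (≤-trans (proj₂ (proj₂ attained)) (Subset.p⊆q⇒∣p∣≤∣q∣ (covered⊆ S {xs} optimal ∈-members)))) (≤-reflexive (sym U≡))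
        achievable : ∀ ys → length ys ≤ k → ∣ ⋃ (List.map S ys) ∣ ≤ o
        achievable ys size = ≤-trans (Subset.p⊆q⇒∣p∣≤∣q∣ (⊆covered S {ys} (singletons ys) ∈-singletons)) (coverage≤opt S (≤-trans (∣singletons∣ ys) size))
        U≤ : ∣ union₁ e ∣ ≤ o * D
        U≤ = ≤-trans (≤-reflexive U≡) (*-monoˡ-≤ D (achievable xs (≤-trans (≤-reflexive (length-members optimal)) (proj₁ (proj₂ attained)))))
        target≤ : target ≤ k * (top * β)
        target≤ = ≤-trans (uncapped o j o<2M e U≤) (≤-reflexive cap≡)
        -- A single set covers no more than the optimum, because k > 0. So at the level fitting the
        -- optimum no set exceeds the cap.
        whole : ∀ i → full S u j i ≡ lift D (S i) ∩ universe u j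
        whole i = cong (λ b → restrict b (lift D (S i) ∩ universe u j)) (≤ᵇ-true small)
          where
          single = indexed (i ∷ []) 0<k
          eq : ⋃ (List.map S (i ∷ [])) ≡ S i
          eq = Subset.∪-identityʳ (S i)
          small : ∣ lift D (S i) ∩ universe u j ∣ ≤ cap
          small = subst (λ B → ∣ B ∩ universe u j ∣ ≤ cap) (trans (proj₂ single) (cong (lift D) eq))
            (uncapped o j o<2M (proj₁ single) (≤-trans (≤-reflexive (trans (cong ∣_∣ (proj₂ single)) (∣lift∣ D (⋃ (List.map S (i ∷ [])))))) (*-monoˡ-≤ D (achievable (i ∷ []) 0<k))))
        A≡32a : A ≡ 32 * 2 ^ α
        A≡32a = trans (^-distribˡ-+-* 2 α 5) (*-comm (2 ^ α) 32)
        spread : ∀ C r → (∀ i → ∣ full S u j i ─ C ∣ ≤ r) → ∀ c (e : Fin (suc m ^ c)) → ∣ (unionOf (family S) c e ∩ universe u j) ─ C ∣ ≤ c * r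
        spread C r small zero e = ≤-trans (Subset.∣p─q∣≤∣p∣ (⊥ ∩ universe u j) C) (≤-trans (Subset.∣p∩q∣≤∣p∣ ⊥ (universe u j)) (≤-reflexive (Subset.∣⊥∣≡0 N)))
        spread C r small (suc c) e = begin
          ∣ ((B ∪ Bs) ∩ H) ─ C ∣                  ≡⟨ cong (λ Z → ∣ Z ─ C ∣) (Subset.∩-distribʳ-∪ H B Bs) ⟩
          ∣ ((B ∩ H) ∪ (Bs ∩ H)) ─ C ∣            ≤⟨ ∣A∪B─C∣≤ (B ∩ H) (Bs ∩ H) C ⟩
          ∣ (B ∩ H) ─ C ∣ + ∣ (Bs ∩ H) ─ C ∣      ≤⟨ +-mono-≤ (one (quotient (suc m ^ c) e)) (spread C r small c (remainder {suc m} (suc m ^ c) e)) ⟩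
          r + c * r                               ∎
          where
          H = universe u j
          B = family S (quotient (suc m ^ c) e)
          Bs = unionOf (family S) c (remainder {suc m} (suc m ^ c) e)
          one : ∀ q → ∣ (family S q ∩ H) ─ C ∣ ≤ r
          one zero    = ≤-trans (spread C r small zero zero) z≤n
          one (suc i) = subst (λ Z → ∣ Z ─ C ∣ ≤ r) (whole i) (small i)
        cover : ∀ C r → (∀ i → ∣ full S u j i ─ C ∣ ≤ r) → target ≤ ∣ C ∣ + k * r
        cover C r small = ≤-trans (∣A∣≤∣B∣+∣A─B∣ (union₁ e ∩ universe u j) C) (+-monoʳ-≤ ∣ C ∣ (spread C r small k e))

      choose-ratio⁺ : P * 2 ^ α * o ≤ ((P + R) * 2 ^ α + P) * coverage S T̂
      choose-ratio⁺ = final-ratio {k} {A} {D} {z₁} {2 ^ toℕ j} {∣ C ∣} {target} {o} {coverage S T̂} {P} {R} {2 ^ α}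
        0<k A≡32a (m^n>0 2 α) (*-mono-≤ 0<A (*-mono-≤ 0<k (Admissible.0<β adm))) R≤P refl
        (subst (λ y → 2 ^ y ≤ o) (sym toℕ-j) (proj₁ (proj₂ flog)))
        (begin
          A * score₀ j                                    ≤⟨ *-monoʳ-≤ A (≤-trans (≤-reflexive (cong (λ s → 2 ^ toℕ j * (∣ cov s ∣ ∸ z₁)) (sym (st-eq j)))) (best-score st j)) ⟩
          A * score st ĵ                                  ≡⟨ cong (λ s → A * (2 ^ toℕ ĵ * (∣ cov s ∣ ∸ z₁))) (st-eq ĵ) ⟩
          A * score₀ ĵ                                    ≤⟨ score-bound t ĵ ⟩
          (A + 2) * (coverage S (singletons (picks (trace t ĵ))) * D) ≡⟨ cong (λ B → (A + 2) * (coverage S B * D)) (sym T̂≡) ⟩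
          (A + 2) * (coverage S T̂ * D)                    ∎)
        (Analysis.quality config adm (full S u j) (hit v) (suitable j) i₀ target target≤ cover t done)
        (≤-trans (*-monoʳ-≤ (pred A) o≤U) (<⇒≤ (lower good₁ j e)))
        euler

    choose-ratio : ∀ {P R} → R ≤ P → (P + R) * pred k ^ k ≤ R * k ^ k → P * 2 ^ α * o ≤ ((P + R) * 2 ^ α + P) * coverage S T̂
    choose-ratio {P} {R} R≤P euler = case n≡0⊎n>0 o of λ
      { (inj₁ o≡0) → ≤-trans (≤-reflexive (trans (cong (P * 2 ^ α *_) o≡0) (*-zeroʳ (P * 2 ^ α)))) z≤n
      ; (inj₂ 0<o) → choose-ratio⁺ 0<o R≤P euler }
      where
      n≡0⊎n>0 : ∀ n → n ≡ 0 ⊎ 0 < n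
      n≡0⊎n>0 zero    = inj₁ refl
      n≡0⊎n>0 (suc n) = inj₂ (s≤s z≤n)

-- A partial sum of the series for e lies below (1 - 1/k)^(-k)

-- The increment of x^(N + 1) between c and c + 1 is at most the derivative at the right end.
power-step : ∀ c N → suc c ^ suc N ≤ suc N * suc c ^ N + c ^ suc N
power-step c zero = ≤-reflexive (shuffle c)
  where
  shuffle : ∀ c → suc c * 1 ≡ 1 * 1 + c * 1
  shuffle = solve-∀
power-step c (suc N) = begin
  suc c * p                               ≡⟨⟩
  p + c * p                               ≤⟨ +-monoʳ-≤ p (*-monoʳ-≤ c (power-step c N)) ⟩
  p + c * (suc N * q + c ^ suc N)         ≡⟨ expand c N p q (c ^ suc N) ⟩
  p + suc N * (c * q) + c * c ^ suc N     ≤⟨ +-monoˡ-≤ (c * c ^ suc N) (+-monoʳ-≤ p (*-monoʳ-≤ (suc N) (m≤n+m (c * q) q))) ⟩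
  p + suc N * p + c * c ^ suc N           ∎
  where
  open ≤-Reasoning
  q = suc c ^ N
  p = suc c * q
  expand : ∀ c N p q r → p + c * (suc N * q + r) ≡ p + suc N * (c * q) + c * r
  expand = solve-∀

-- N! k^N Σ_{i ≤ N} (c/k)^i / i!
expScaled : ℕ → ℕ → ℕ → ℕ
expScaled k zero    c = 1
expScaled k (suc N) c = suc N * k * expScaled k N c + c ^ suc N

-- N! Σ_{i ≤ N} 1/i!, so that the partial sum is this over N!.
expNumerator : ℕ → ℕ
expNumerator zero    = 1
expNumerator (suc N) = suc N * expNumerator N + 1

-- The derivative of a partial sum is the sum without its last term. Moving from c/k to (c + 1)/k
-- therefore adds at most 1/k times that shorter sum at the right end; (c + 1)^N is the omitted
-- term.
expScaled-step : ∀ k N c → k * expScaled k N (suc c) + suc c ^ N ≤ k * expScaled k N c + expScaled k N (suc c)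
expScaled-step k zero    c = ≤-refl
expScaled-step k (suc N) c = begin
  k * (suc N * k * b + y) + y                                           ≡⟨ e₁ k N b y ⟩
  suc N * k * (k * b) + k * y + y                                       ≤⟨ +-monoˡ-≤ y (+-monoʳ-≤ (suc N * k * (k * b)) (*-monoʳ-≤ k (power-step c N))) ⟩
  suc N * k * (k * b) + k * (suc N * x + z) + y                         ≡⟨ e₂ k N b x y z ⟩
  suc N * k * (k * b + x) + k * z + y                                   ≤⟨ +-monoˡ-≤ y (+-monoˡ-≤ (k * z) (*-monoʳ-≤ (suc N * k) (expScaled-step k N c))) ⟩
  suc N * k * (k * a + b) + k * z + y                                   ≡⟨ e₃ k N a b y z ⟩
  k * (suc N * k * a + z) + (suc N * k * b + y)                         ∎
  where
  open ≤-Reasoning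
  a = expScaled k N c
  b = expScaled k N (suc c)
  x = suc c ^ N
  y = suc c ^ suc N
  z = c ^ suc N
  e₁ : ∀ k N b y → k * (suc N * k * b + y) + y ≡ suc N * k * (k * b) + k * y + y
  e₁ = solve-∀
  e₂ : ∀ k N b x y z → suc N * k * (k * b) + k * (suc N * x + z) + y ≡ suc N * k * (k * b + x) + k * z + y
  e₂ = solve-∀
  e₃ : ∀ k N a b y z → suc N * k * (k * a + b) + k * z + y ≡ k * (suc N * k * a + z) + (suc N * k * b + y)
  e₃ = solve-∀

expScaled-zero : ∀ k N → expScaled k N 0 ≡ N ! * k ^ N
expScaled-zero k zero    = refl
expScaled-zero k (suc N) = trans (+-identityʳ _) (trans (cong (suc N * k *_) (expScaled-zero k N)) (shuffle N k (N !) (k ^ N)))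
  where
  shuffle : ∀ N k f p → suc N * k * (f * p) ≡ suc N * f * (k * p)
  shuffle = solve-∀

expScaled-diagonal : ∀ k N → expScaled k N k ≡ k ^ N * expNumerator N
expScaled-diagonal k zero    = refl
expScaled-diagonal k (suc N) = trans (cong (λ y → suc N * k * y + k * k ^ N) (expScaled-diagonal k N)) (shuffle N k (k ^ N) (expNumerator N))
  where
  shuffle : ∀ N k p e → suc N * k * (p * e) + k * p ≡ k * p * (suc N * e + 1)
  shuffle = solve-∀

-- By `expScaled-step` each of the c steps multiplies the partial sum by at most k/(k - 1), starting
-- from its value 1 at zero. At c = k the partial sum for e appears.
expScaled-bound : ∀ v N c → expScaled (suc v) N c * v ^ c ≤ N ! * suc v ^ (N + c)
expScaled-bound v N zero    = ≤-reflexive (trans (*-identityʳ _) (trans (expScaled-zero (suc v) N) (cong (λ y → N ! * suc v ^ y) (sym (+-identityʳ N)))))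
expScaled-bound v N (suc c) = begin
  b * (v * v ^ c)                     ≡⟨ sym (*-assoc b v (v ^ c)) ⟩
  b * v * v ^ c                       ≤⟨ *-monoˡ-≤ (v ^ c) bv≤ka ⟩
  k * a * v ^ c                       ≡⟨ *-assoc k a (v ^ c) ⟩
  k * (a * v ^ c)                     ≤⟨ *-monoʳ-≤ k (expScaled-bound v N c) ⟩
  k * (N ! * k ^ (N + c))             ≡⟨ shuffle k (N !) (k ^ (N + c)) ⟩
  N ! * k ^ suc (N + c)               ≡⟨ cong (λ y → N ! * k ^ y) (sym (+-suc N c)) ⟩
  N ! * k ^ (N + suc c)               ∎
  where
  open ≤-Reasoning
  k = suc v
  a = expScaled k N c
  b = expScaled k N (suc c)
  shuffle : ∀ k f p → k * (f * p) ≡ f * (k * p)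
  shuffle = solve-∀
  bv≤ka : b * v ≤ k * a
  bv≤ka = +-cancelʳ-≤ b (b * v) (k * a) (begin
    b * v + b                         ≡⟨ trans (+-comm (b * v) b) (sym (*-suc b v)) ⟩
    b * k                             ≡⟨ *-comm b k ⟩
    k * b                             ≤⟨ m≤m+n (k * b) (suc c ^ N) ⟩
    k * b + suc c ^ N                 ≤⟨ expScaled-step k N c ⟩
    k * a + b                         ∎)

euler-bound : ∀ k N → 0 < k → expNumerator N * pred k ^ k ≤ N ! * k ^ k
euler-bound (suc v) N _ = *-cancelˡ-≤ (k ^ N) {{m^n≢0 k N}} (begin
  k ^ N * (expNumerator N * v ^ k)    ≡⟨ sym (*-assoc (k ^ N) _ _) ⟩
  k ^ N * expNumerator N * v ^ k      ≡⟨ cong (_* v ^ k) (sym (expScaled-diagonal k N)) ⟩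
  expScaled k N k * v ^ k             ≤⟨ expScaled-bound v N k ⟩
  N ! * k ^ (N + k)                   ≡⟨ cong (N ! *_) (^-distribˡ-+-* k N k) ⟩
  N ! * (k ^ N * k ^ k)               ≡⟨ shuffle (N !) (k ^ N) (k ^ k) ⟩
  k ^ N * (N ! * k ^ k)               ∎)
  where
  open ≤-Reasoning
  k = suc v
  shuffle : ∀ a b c → a * (b * c) ≡ b * (a * c)
  shuffle = solve-∀

-- Partial sums for e that include 1/1! are at least 2, which becomes R ≤ P in the approximation
-- ratio.
2N!≤expNumerator : ∀ N → 2 * suc N ! ≤ expNumerator (suc N)
2N!≤expNumerator zero    = ≤-refl
2N!≤expNumerator (suc N) = begin
  2 * (suc (suc N) * suc N !)           ≡⟨ shuffle (suc (suc N)) (suc N !) ⟩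
  suc (suc N) * (2 * suc N !)           ≤⟨ *-monoʳ-≤ (suc (suc N)) (2N!≤expNumerator N) ⟩
  suc (suc N) * expNumerator (suc N)    ≤⟨ m≤m+n _ 1 ⟩
  expNumerator (suc (suc N))            ∎
  where
  open ≤-Reasoning
  shuffle : ∀ a b → 2 * (a * b) ≡ a * (2 * b)
  shuffle = solve-∀

-- Rational arithmetic

toℚᵘ-fromℕ : ∀ n → ℚ.toℚᵘ (fromℕ n) ℚᵘ.≃ mkℚᵘ (ℤ.+ n) 0
toℚᵘ-fromℕ n = ℚ.toℚᵘ-fromℚᵘ (mkℚᵘ (ℤ.+ n) 0)

fromℕ-+ : ∀ a b → fromℕ (a + b) ≡ fromℕ a ℚ.+ fromℕ b
fromℕ-+ a b = ℚ.toℚᵘ-injective (begin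
  ℚ.toℚᵘ (fromℕ (a + b))                      ≈⟨ toℚᵘ-fromℕ (a + b) ⟩
  mkℚᵘ (ℤ.+ (a + b)) 0                        ≈⟨ *≡* (cong (ℤ._* ℤ.+ 1) (trans (ℤ.pos-+ a b) (sym (cong₂ ℤ._+_ (ℤ.*-identityʳ (ℤ.+ a)) (ℤ.*-identityʳ (ℤ.+ b)))))) ⟩
  mkℚᵘ (ℤ.+ a) 0 ℚᵘ.+ mkℚᵘ (ℤ.+ b) 0          ≈⟨ ℚᵘ.+-cong (ℚᵘ.≃-sym (toℚᵘ-fromℕ a)) (ℚᵘ.≃-sym (toℚᵘ-fromℕ b)) ⟩
  ℚ.toℚᵘ (fromℕ a) ℚᵘ.+ ℚ.toℚᵘ (fromℕ b)      ≈⟨ ℚᵘ.≃-sym (ℚ.toℚᵘ-homo-+ (fromℕ a) (fromℕ b)) ⟩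
  ℚ.toℚᵘ (fromℕ a ℚ.+ fromℕ b)                ∎)
  where open import Relation.Binary.Reasoning.Setoid ℚᵘ.≃-setoid

fromℕ-* : ∀ a b → fromℕ (a * b) ≡ fromℕ a ℚ.* fromℕ b
fromℕ-* a b = ℚ.toℚᵘ-injective (begin
  ℚ.toℚᵘ (fromℕ (a * b))                      ≈⟨ toℚᵘ-fromℕ (a * b) ⟩
  mkℚᵘ (ℤ.+ (a * b)) 0                        ≈⟨ *≡* (cong (ℤ._* ℤ.+ 1) (ℤ.pos-* a b)) ⟩
  mkℚᵘ (ℤ.+ a) 0 ℚᵘ.* mkℚᵘ (ℤ.+ b) 0          ≈⟨ ℚᵘ.*-cong (ℚᵘ.≃-sym (toℚᵘ-fromℕ a)) (ℚᵘ.≃-sym (toℚᵘ-fromℕ b)) ⟩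
  ℚ.toℚᵘ (fromℕ a) ℚᵘ.* ℚ.toℚᵘ (fromℕ b)      ≈⟨ ℚᵘ.≃-sym (ℚ.toℚᵘ-homo-* (fromℕ a) (fromℕ b)) ⟩
  ℚ.toℚᵘ (fromℕ a ℚ.* fromℕ b)                ∎)
  where open import Relation.Binary.Reasoning.Setoid ℚᵘ.≃-setoid

fromℕ-mono : ∀ {a b} → a ≤ b → fromℕ a ℚ.≤ fromℕ b
fromℕ-mono {a} {b} a≤b = ℚ.toℚᵘ-cancel-≤ (ℚᵘ.≤-trans (ℚᵘ.≤-reflexive (toℚᵘ-fromℕ a))
  (ℚᵘ.≤-trans (*≤* (ℤ.*-monoʳ-≤-nonNeg (ℤ.+ 1) (ℤ.+≤+ a≤b))) (ℚᵘ.≤-reflexive (ℚᵘ.≃-sym (toℚᵘ-fromℕ b)))))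

fromℕ-cancel : ∀ {a b} → fromℕ a ℚ.≤ fromℕ b → a ≤ b
fromℕ-cancel {a} {b} le with a ≤? b
... | yes p = p
... | no ¬p = contradiction (ℚ.≤-trans (fromℕ-mono (≰⇒> ¬p)) le) (λ le′ → 1≰0 (ℚ.≤-trans (ℚ.≤-reflexive (sym (diff b))) (ℚ.≤-trans (ℚ.+-monoˡ-≤ (ℚ.- fromℕ b) le′) (ℚ.≤-reflexive (ℚ.+-inverseʳ (fromℕ b))))))
  where
  1≰0 : ¬ (1ℚ ℚ.≤ 0ℚ)
  1≰0 (ℚ.*≤* (ℤ.+≤+ ()))
  diff : ∀ b → fromℕ (suc b) ℚ.+ ℚ.- fromℕ b ≡ 1ℚ
  diff b = trans (cong (ℚ._+ ℚ.- fromℕ b) (fromℕ-+ 1 b)) (trans (ℚ.+-assoc 1ℚ (fromℕ b) _) (trans (cong (1ℚ ℚ.+_) (ℚ.+-inverseʳ (fromℕ b))) (ℚ.+-identityʳ 1ℚ)))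

inverse-fromℕ : ∀ d .{{_ : NonZero d}} → fromℕ d ℚ.* ((ℤ.+ 1) ℚ./ d) ≡ 1ℚ
inverse-fromℕ (suc d) = ℚ.toℚᵘ-injective (begin
  ℚ.toℚᵘ (fromℕ (suc d) ℚ.* ((ℤ.+ 1) ℚ./ suc d))              ≈⟨ ℚ.toℚᵘ-homo-* (fromℕ (suc d)) ((ℤ.+ 1) ℚ./ suc d) ⟩
  ℚ.toℚᵘ (fromℕ (suc d)) ℚᵘ.* ℚ.toℚᵘ ((ℤ.+ 1) ℚ./ suc d)      ≈⟨ ℚᵘ.*-cong (toℚᵘ-fromℕ (suc d)) (ℚ.toℚᵘ-fromℚᵘ (mkℚᵘ (ℤ.+ 1) d)) ⟩
  mkℚᵘ (ℤ.+ suc d) 0 ℚᵘ.* mkℚᵘ (ℤ.+ 1) d                      ≈⟨ *≡* (trans (cong (ℤ._* ℤ.+ 1) (ℤ.*-identityʳ (ℤ.+ suc d))) (trans (ℤ.*-identityʳ (ℤ.+ suc d)) (sym (trans (ℤ.*-identityˡ _) (cong (λ y → ℤ.+ suc y) (+-identityʳ d)))))) ⟩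
  ℚ.toℚᵘ 1ℚ                                                   ∎)
  where open import Relation.Binary.Reasoning.Setoid ℚᵘ.≃-setoid

0≤fromℕ : ∀ n → 0ℚ ℚ.≤ fromℕ n
0≤fromℕ n = fromℕ-mono {0} {n} z≤n

*-mono-≤ᵠ : ∀ {a b c d} → 0ℚ ℚ.≤ c → 0ℚ ℚ.≤ b → a ℚ.≤ b → c ℚ.≤ d → a ℚ.* c ℚ.≤ b ℚ.* d
*-mono-≤ᵠ {a} {b} {c} {d} 0≤c 0≤b a≤b c≤d =
  ℚ.≤-trans (ℚ.*-monoʳ-≤-nonNeg c {{ℚ.nonNegative 0≤c}} a≤b) (ℚ.*-monoˡ-≤-nonNeg b {{ℚ.nonNegative 0≤b}} c≤d)

expSum-numerator : ∀ N → fromℕ (N !) ℚ.* expSum N ≡ fromℕ (expNumerator N)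
expSum-numerator zero    = refl
expSum-numerator (suc N) = begin
  fromℕ (suc N !) ℚ.* (expSum N ℚ.+ inv)                          ≡⟨ ℚ.*-distribˡ-+ (fromℕ (suc N !)) (expSum N) inv ⟩
  fromℕ (suc N !) ℚ.* expSum N ℚ.+ fromℕ (suc N !) ℚ.* inv        ≡⟨ cong₂ (λ x y → x ℚ.* expSum N ℚ.+ y) (fromℕ-* (suc N) (N !)) (inverse-fromℕ (suc N !) {{suc N !≢0}}) ⟩
  fromℕ (suc N) ℚ.* fromℕ (N !) ℚ.* expSum N ℚ.+ 1ℚ               ≡⟨ cong (ℚ._+ 1ℚ) (trans (ℚ.*-assoc (fromℕ (suc N)) _ _) (cong (fromℕ (suc N) ℚ.*_) (expSum-numerator N))) ⟩
  fromℕ (suc N) ℚ.* fromℕ (expNumerator N) ℚ.+ 1ℚ                 ≡⟨ cong (ℚ._+ 1ℚ) (sym (fromℕ-* (suc N) (expNumerator N))) ⟩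
  fromℕ (suc N * expNumerator N) ℚ.+ fromℕ 1                      ≡⟨ sym (fromℕ-+ (suc N * expNumerator N) 1) ⟩
  fromℕ (expNumerator (suc N))                                    ∎
  where
  open ≡-Reasoning
  inv = ℚ._/_ (ℤ.+ 1) (suc N !) {{suc N !≢0}}

-- Powers of one half, and the precision they give for ε

abstract
  ½^ : ℕ → ℚ
  ½^ i = ½ ^ᵠ i

  ½^-zero : ½^ 0 ≡ 1ℚ
  ½^-zero = refl

  ½^-suc : ∀ i → ½^ (suc i) ≡ ½ ℚ.* ½^ i
  ½^-suc i = refl

2^*½^ : ∀ i → fromℕ (2 ^ i) ℚ.* ½^ i ≡ 1ℚ
2^*½^ zero    = trans (cong (fromℕ 1 ℚ.*_) ½^-zero) refl
2^*½^ (suc i) = begin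
  fromℕ (2 * 2 ^ i) ℚ.* ½^ (suc i)                  ≡⟨ cong (fromℕ (2 * 2 ^ i) ℚ.*_) (½^-suc i) ⟩
  fromℕ (2 * 2 ^ i) ℚ.* (½ ℚ.* ½^ i)                ≡⟨ cong (ℚ._* (½ ℚ.* ½^ i)) (fromℕ-* 2 (2 ^ i)) ⟩
  fromℕ 2 ℚ.* fromℕ (2 ^ i) ℚ.* (½ ℚ.* ½^ i)        ≡⟨ shuffle (fromℕ 2) (fromℕ (2 ^ i)) ½ (½^ i) ⟩
  fromℕ 2 ℚ.* ½ ℚ.* (fromℕ (2 ^ i) ℚ.* ½^ i)        ≡⟨ cong (fromℕ 2 ℚ.* ½ ℚ.*_) (2^*½^ i) ⟩
  fromℕ 2 ℚ.* ½ ℚ.* 1ℚ                              ≡⟨⟩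
  1ℚ                                                ∎
  where
  open ≡-Reasoning
  shuffle : ∀ a b c d → a ℚ.* b ℚ.* (c ℚ.* d) ≡ a ℚ.* c ℚ.* (b ℚ.* d)
  shuffle = +-*-Solver.solve 4 (λ a b c d → (a :* b) :* (c :* d) := (a :* c) :* (b :* d)) refl
    where open +-*-Solver

½^-pos : ∀ i → 0ℚ ℚ.< ½^ i
½^-pos zero    = subst (0ℚ ℚ.<_) (sym ½^-zero) (ℚ.*<* (ℤ.+<+ (s≤s z≤n)))
½^-pos (suc i) = subst (0ℚ ℚ.<_) (sym (½^-suc i)) (ℚ.≤-<-trans (ℚ.≤-reflexive (sym (ℚ.*-zeroʳ ½))) (ℚ.*-monoʳ-<-pos ½ (½^-pos i)))

½^-decreasing : ∀ i → ½^ (suc i) ℚ.< ½^ i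
½^-decreasing i = subst₂ ℚ._<_ (sym (½^-suc i)) (ℚ.*-identityˡ (½^ i)) (ℚ.*-monoˡ-<-pos (½^ i) {{ℚ.positive (½^-pos i)}} {½} {1ℚ} ½<1)
  where
  ½<1 : ½ ℚ.< 1ℚ
  ½<1 = ℚ.*<* (ℤ.+<+ (s≤s (s≤s z≤n)))

<ʳ-≤ : ∀ (x : ℝ) {p q} → p ℚ.≤ q → q <ʳ x → p <ʳ x
<ʳ-≤ x {p} {q} p≤q low with p ℚ.<? q
... | yes p<q = ℝ.lower-closed x p<q low
... | no  p≮q = subst (_<ʳ x) (ℚ.≤-antisym (ℚ.≮⇒≥ p≮q) p≤q) low

cut-ordered : ∀ (x : ℝ) {p q} → p <ʳ x → x ʳ< q → p ℚ.≤ q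
cut-ordered x {p} {q} low up = ℚ.≮⇒≥ (λ q<p → ℝ.disjoint x (ℝ.lower-closed x q<p low , up))

-- With denominator d, a positive q is at least 1/d, and 2^-d ≤ 1/d.
small-½^ : ∀ q → 0ℚ ℚ.< q → Σ[ i ∈ ℕ ] ½^ i ℚ.≤ q
small-½^ q 0<q = d , ℚ.≤-trans ½^≤ (ℚ.toℚᵘ-cancel-≤ (ℚᵘ.≤-trans (ℚᵘ.≤-reflexive (ℚ.toℚᵘ-fromℚᵘ (mkℚᵘ (ℤ.+ 1) (ℚ.ℚ.denominator-1 q))))
    (positive-numerator q 0<q)))
  where
  d = ℚ.↧ₙ q
  inv = (ℤ.+ 1) ℚ./ d
  ½^≤ : ½^ d ℚ.≤ inv
  ½^≤ = ℚ.*-cancelˡ-≤-pos (fromℕ (2 ^ d)) {{ℚ.positive (ℚ.<-≤-trans (ℚ.*<* (ℤ.+<+ (s≤s z≤n))) (fromℕ-mono {1} (m^n>0 2 d)))}}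
    (ℚ.≤-trans (ℚ.≤-reflexive (trans (2^*½^ d) (sym (inverse-fromℕ d))))
      (ℚ.*-monoʳ-≤-nonNeg inv {{ℚ.normalize-nonNeg 1 d}} (fromℕ-mono (n≤2^n d))))
  positive-numerator : ∀ q → 0ℚ ℚ.< q → mkℚᵘ (ℤ.+ 1) (ℚ.ℚ.denominator-1 q) ℚᵘ.≤ ℚ.toℚᵘ q
  positive-numerator (ℚ.mkℚ (ℤ.+ suc a) b _) _ = *≤* (ℤ.*-monoʳ-≤-nonNeg (ℤ.+ suc b) {ℤ.+ 1} {ℤ.+ suc a} (ℤ.+≤+ (s≤s z≤n)))
  positive-numerator (ℚ.mkℚ (ℤ.+ zero) b _) (ℚ.*<* (ℤ.+<+ ()))
  positive-numerator (ℚ.mkℚ (ℤ.-[1+ a ]) b _) (ℚ.*<* ())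

record Precision (ε : ℝ) : Set where
  field
    i     : ℕ
    below : ½^ (2 + i) <ʳ ε
    above : ε ʳ< ½^ i

-- Locatedness decides only between two distinct rationals, hence the factor four between the
-- bounds. The search ends because some power of one half is known to lie below ε.
precision : ∀ ε → 0ℚ <ʳ ε → ε ʳ< 1ℚ → Precision ε
precision ε 0<ε ε<1 = initial (ℝ.lower-rounded ε 0<ε)
  where
  search : ∀ f i → ε ʳ< ½^ i → ½^ (2 + (f + i)) <ʳ ε → Precision ε
  search zero    i up low = record { i = i ; below = low ; above = up }
  search (suc f) i up low = split (ℝ.located ε (½^-decreasing (suc i)))
    where
    split : ½^ (2 + i) <ʳ ε ⊎ ε ʳ< ½^ (suc i) → Precision ε
    split (inj₁ low′) = record { i = i ; below = low′ ; above = up }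
    split (inj₂ up′)  = search f (suc i) up′ (subst (λ y → ½^ (2 + y) <ʳ ε) (sym (+-suc f i)) low)
  initial : ∃[ q ] (0ℚ ℚ.< q × q <ʳ ε) → Precision ε
  initial (q , 0<q , low) = search f 0 (subst (ε ʳ<_) (sym ½^-zero) ε<1) (subst (λ y → ½^ (2 + y) <ʳ ε) (sym (+-identityʳ f))
    (<ʳ-≤ ε (ℚ.≤-trans (ℚ.<⇒≤ (ℚ.<-trans (½^-decreasing (suc f)) (½^-decreasing f))) (proj₂ (small-½^ q 0<q))) low))
    where
    f = proj₁ (small-½^ q 0<q)

-- Passing to the bounds as infima of rationals

private
  ℚ-interchange : ∀ a b c d → a ℚ.* b ℚ.* (c ℚ.* d) ≡ a ℚ.* c ℚ.* (b ℚ.* d)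
  ℚ-interchange = +-*-Solver.solve 4 (λ a b c d → (a :* b) :* (c :* d) := (a :* c) :* (b :* d)) refl
    where open +-*-Solver

fromℕ-pos : ∀ {n} → 0 < n → ℚ.Positive (fromℕ n)
fromℕ-pos 0<n = ℚ.positive (ℚ.<-≤-trans (ℚ.*<* (ℤ.+<+ (s≤s z≤n))) (fromℕ-mono {1} 0<n))

0≤* : ∀ {x y} → 0ℚ ℚ.≤ x → 0ℚ ℚ.≤ y → 0ℚ ℚ.≤ x ℚ.* y
0≤* {x} {y} 0≤x 0≤y = ℚ.nonNegative⁻¹ (x ℚ.* y) {{ℚ.nonNeg*nonNeg⇒nonNeg x {{ℚ.nonNegative 0≤x}} y {{ℚ.nonNegative 0≤y}}}}

-- An element of the factor is q + x with q = s/(s - 1) for a partial sum s = E/R of e, and x > ε.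
-- With P = E - R this is q = (P + R)/P; `euler-bound` supplies the hypothesis for these P and R,
-- and the remaining 1/2^α lies below x.
ratio-bound : ∀ (ε : ℝ) α {k o c} → ½^ α <ʳ ε → 0 < k →
  (∀ {P R} → R ≤ P → (P + R) * pred k ^ k ≤ R * k ^ k → P * 2 ^ α * o ≤ ((P + R) * 2 ^ α + P) * c) →
  fromℕ o ≤ⁱ (e/[e-1] +ⁱ fromℝ ε) *ⁱ ⌜ fromℕ c ⌝
ratio-bound ε α {k} {o} {c} low 0<k bound u (w , _ , (q , x , (N , q-eq) , up , refl) , refl , refl) =
  ℚ.*-cancelˡ-≤-pos (fromℕ (P * a)) {{fromℕ-pos 0<Pa}} (begin
    fromℕ (P * a) ℚ.* fromℕ o                               ≡⟨ sym (fromℕ-* (P * a) o) ⟩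
    fromℕ (P * a * o)                                       ≤⟨ fromℕ-mono (bound R≤P (≤-trans (≤-reflexive (cong (_* pred k ^ k) P+R≡E)) (euler-bound k (suc N) 0<k))) ⟩
    fromℕ (((P + R) * a + P) * c)                           ≡⟨ trans (fromℕ-* ((P + R) * a + P) c) (cong (ℚ._* fromℕ c) (trans (fromℕ-+ ((P + R) * a) P) (cong (ℚ._+ fromℕ P) (fromℕ-* (P + R) a)))) ⟩
    (fromℕ (P + R) ℚ.* fromℕ a ℚ.+ fromℕ P) ℚ.* fromℕ c     ≡⟨ cong (λ y → (y ℚ.* fromℕ a ℚ.+ fromℕ P) ℚ.* fromℕ c) (sym qP≡) ⟩
    (q ℚ.* fromℕ P ℚ.* fromℕ a ℚ.+ fromℕ P) ℚ.* fromℕ c     ≡⟨ cong (ℚ._* fromℕ c) factor ⟩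
    fromℕ (P * a) ℚ.* (q ℚ.+ ½^ α) ℚ.* fromℕ c              ≤⟨ ℚ.*-monoʳ-≤-nonNeg (fromℕ c) {{ℚ.nonNegative (0≤fromℕ c)}} (ℚ.*-monoˡ-≤-nonNeg (fromℕ (P * a)) {{ℚ.nonNegative (0≤fromℕ (P * a))}} (ℚ.+-monoʳ-≤ q (cut-ordered ε low up))) ⟩
    fromℕ (P * a) ℚ.* (q ℚ.+ x) ℚ.* fromℕ c                 ≡⟨ ℚ.*-assoc (fromℕ (P * a)) (q ℚ.+ x) (fromℕ c) ⟩
    fromℕ (P * a) ℚ.* ((q ℚ.+ x) ℚ.* fromℕ c)               ∎)
  where
  open ℚ.≤-Reasoning
  a = 2 ^ α
  E = expNumerator (suc N)
  R = suc N !
  P = E ∸ R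
  s = expSum (suc N)
  2R≤E : R + R ≤ E
  2R≤E = ≤-trans (≤-reflexive (cong (R +_) (sym (+-identityʳ R)))) (2N!≤expNumerator N)
  P+R≡E : P + R ≡ E
  P+R≡E = m∸n+n≡m (≤-trans (m≤m+n R R) 2R≤E)
  R≤P : R ≤ P
  R≤P = +-cancelʳ-≤ R R P (≤-trans 2R≤E (≤-reflexive (sym P+R≡E)))
  0<Pa : 0 < P * a
  0<Pa = *-mono-≤ (≤-trans (>-nonZero⁻¹ R {{suc N !≢0}}) R≤P) (m^n>0 2 α)
  Rs≡ : fromℕ R ℚ.* s ≡ fromℕ P ℚ.+ fromℕ R
  Rs≡ = trans (expSum-numerator (suc N)) (trans (cong fromℕ (sym P+R≡E)) (fromℕ-+ P R))
  qP≡ : q ℚ.* fromℕ P ≡ fromℕ (P + R)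
  qP≡ = E.begin
    q ℚ.* fromℕ P                                   E.≡⟨ cong (q ℚ.*_) (trans (cancel (fromℕ P) (fromℕ R)) (cong (ℚ._- fromℕ R) (sym Rs≡))) ⟩
    q ℚ.* (fromℕ R ℚ.* s ℚ.- fromℕ R)               E.≡⟨ expand q (fromℕ R) s ⟩
    fromℕ R ℚ.* (q ℚ.* (s ℚ.- 1ℚ))                  E.≡⟨ cong (fromℕ R ℚ.*_) q-eq ⟩
    fromℕ R ℚ.* s                                   E.≡⟨ trans Rs≡ (sym (fromℕ-+ P R)) ⟩
    fromℕ (P + R)                                   E.∎
    where
    module E = ≡-Reasoning
    cancel : ∀ p r → p ≡ p ℚ.+ r ℚ.- r
    cancel = +-*-Solver.solve 2 (λ p r → p := (p :+ r) :- r) refl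
      where open +-*-Solver
    expand : ∀ q r s → q ℚ.* (r ℚ.* s ℚ.- r) ≡ r ℚ.* (q ℚ.* (s ℚ.- 1ℚ))
    expand = +-*-Solver.solve 3 (λ q r s → q :* (r :* s :- r) := r :* (q :* (s :- con 1ℚ))) refl
      where open +-*-Solver
  factor : q ℚ.* fromℕ P ℚ.* fromℕ a ℚ.+ fromℕ P ≡ fromℕ (P * a) ℚ.* (q ℚ.+ ½^ α)
  factor = trans (cong (q ℚ.* fromℕ P ℚ.* fromℕ a ℚ.+_) (sym (ℚ.*-identityʳ (fromℕ P))))
    (trans (cong (λ y → q ℚ.* fromℕ P ℚ.* fromℕ a ℚ.+ fromℕ P ℚ.* y) (sym (2^*½^ α)))
    (trans (collect q (fromℕ P) (fromℕ a) (½^ α)) (cong (ℚ._* (q ℚ.+ ½^ α)) (sym (fromℕ-* P a)))))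
    where
    collect : ∀ q p a h → q ℚ.* p ℚ.* a ℚ.+ p ℚ.* (a ℚ.* h) ≡ p ℚ.* a ℚ.* (q ℚ.+ h)
    collect = +-*-Solver.solve 4 (λ q p a h → (q :* p) :* a :+ p :* (a :* h) := (p :* a) :* (q :+ h)) refl
      where open +-*-Solver

fromℕ-^ : ∀ a n → fromℕ (a ^ n) ≡ fromℕ a ^ᵠ n
fromℕ-^ a zero    = refl
fromℕ-^ a (suc n) = trans (fromℕ-* a (a ^ n)) (cong (fromℕ a ℚ.*_) (fromℕ-^ a n))

^ᵠ-+ : ∀ x m n → x ^ᵠ (m + n) ≡ x ^ᵠ m ℚ.* x ^ᵠ n
^ᵠ-+ x zero    n = sym (ℚ.*-identityˡ (x ^ᵠ n))
^ᵠ-+ x (suc m) n = trans (cong (x ℚ.*_) (^ᵠ-+ x m n)) (sym (ℚ.*-assoc x _ _))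

^ᵠ-* : ∀ x m n → (x ^ᵠ m) ^ᵠ n ≡ x ^ᵠ (n * m)
^ᵠ-* x m zero    = refl
^ᵠ-* x m (suc n) = trans (cong (x ^ᵠ m ℚ.*_) (^ᵠ-* x m n)) (sym (^ᵠ-+ x m (n * m)))

^ᵠ-distrib : ∀ x y n → (x ℚ.* y) ^ᵠ n ≡ x ^ᵠ n ℚ.* y ^ᵠ n
^ᵠ-distrib x y zero    = refl
^ᵠ-distrib x y (suc n) = trans (cong (x ℚ.* y ℚ.*_) (^ᵠ-distrib x y n)) (ℚ-interchange x y (x ^ᵠ n) (y ^ᵠ n))

0≤^ᵠ : ∀ {x} → 0ℚ ℚ.≤ x → ∀ n → 0ℚ ℚ.≤ x ^ᵠ n
0≤^ᵠ 0≤x zero    = 0≤fromℕ 1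
0≤^ᵠ 0≤x (suc n) = 0≤* 0≤x (0≤^ᵠ 0≤x n)

^ᵠ-mono : ∀ {x y} → 0ℚ ℚ.≤ x → x ℚ.≤ y → ∀ n → x ^ᵠ n ℚ.≤ y ^ᵠ n
^ᵠ-mono 0≤x x≤y zero    = ℚ.≤-refl
^ᵠ-mono 0≤x x≤y (suc n) = *-mono-≤ᵠ (0≤^ᵠ 0≤x n) (ℚ.≤-trans 0≤x x≤y) x≤y (^ᵠ-mono 0≤x x≤y n)

^ᵠ-cancel : ∀ {x y} n .{{_ : NonZero n}} → 0ℚ ℚ.≤ y → x ^ᵠ n ℚ.≤ y ^ᵠ n → x ℚ.≤ y
^ᵠ-cancel {x} {y} (suc n) 0≤y le = ℚ.≮⇒≥ (λ y<x → ℚ.<-irrefl refl (ℚ.<-≤-trans (strict y<x) le))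
  where
  strict : y ℚ.< x → y ^ᵠ suc n ℚ.< x ^ᵠ suc n
  strict y<x = ℚ.≤-<-trans (ℚ.*-monoˡ-≤-nonNeg y {{ℚ.nonNegative 0≤y}} (^ᵠ-mono 0≤y (ℚ.<⇒≤ y<x) n))
    (ℚ.*-monoˡ-<-pos (x ^ᵠ n) {{pos n}} y<x)
    where
    0<x : 0ℚ ℚ.< x
    0<x = ℚ.≤-<-trans 0≤y y<x
    pos : ∀ n → ℚ.Positive (x ^ᵠ n)
    pos zero    = ℚ.positive {1ℚ} (ℚ.*<* (ℤ.+<+ (s≤s z≤n)))
    pos (suc n) = ℚ.positive (ℚ.≤-<-trans (ℚ.≤-reflexive (sym (ℚ.*-zeroʳ x))) (ℚ.*-monoʳ-<-pos x {{ℚ.positive 0<x}} (ℚ.positive⁻¹ (x ^ᵠ n) {{pos n}})))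

numerator-≥ : ∀ s → 0ℚ ℚ.≤ s → fromℕ (ℚ.↧ₙ s) ℚ.* s ≡ fromℕ ℤ.∣ ℚ.↥ s ∣
numerator-≥ (ℚ.mkℚ (ℤ.-[1+ a ]) b _) (ℚ.*≤* ())
numerator-≥ s@(ℚ.mkℚ (ℤ.+ a) b _) _ = ℚ.toℚᵘ-injective (begin
  ℚ.toℚᵘ (fromℕ (suc b) ℚ.* s)                      ≈⟨ ℚ.toℚᵘ-homo-* (fromℕ (suc b)) s ⟩
  ℚ.toℚᵘ (fromℕ (suc b)) ℚᵘ.* mkℚᵘ (ℤ.+ a) b        ≈⟨ ℚᵘ.*-congʳ (toℚᵘ-fromℕ (suc b)) ⟩
  mkℚᵘ (ℤ.+ suc b) 0 ℚᵘ.* mkℚᵘ (ℤ.+ a) b            ≈⟨ *≡* (trans (ℤ.*-identityʳ _) (trans (ℤ.*-comm (ℤ.+ suc b) (ℤ.+ a)) (cong (λ y → ℤ.+ a ℤ.* ℤ.+ suc y) (sym (+-identityʳ b))))) ⟩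
  mkℚᵘ (ℤ.+ a) 0                                    ≈⟨ ℚᵘ.≃-sym (toℚᵘ-fromℕ a) ⟩
  ℚ.toℚᵘ (fromℕ a)                                  ∎)
  where open import Relation.Binary.Reasoning.Setoid ℚᵘ.≃-setoid

recip-large : ∀ (ε : ℝ) {i} → ε ʳ< ½^ i → ∀ {u} → recip ε u → fromℕ (2 ^ i) ℚ.≤ u
recip-large ε {i} up {u} (a , 0<a , low , ua≡1) = ℚ.*-cancelʳ-≤-pos a {{ℚ.positive 0<a}} (ℚ.≤-trans
  (ℚ.*-monoˡ-≤-nonNeg (fromℕ (2 ^ i)) {{ℚ.nonNegative (0≤fromℕ (2 ^ i))}} (cut-ordered ε low up))
  (ℚ.≤-reflexive (trans (2^*½^ i) (sym ua≡1))))

-- What the communication argument extracts from an element t of the set defining m^(C/(ε r)): t is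
-- at least m^(num/den), with num/den at least C B/r for a power of two B ≤ 1/ε.
record RootBound (m C r B : ℕ) (t : ℚ) : Set where
  field
    num den     : ℕ
    {{den≢0}}   : NonZero den
    steep       : C * B * den ≤ r * num
    dominates   : fromℕ m ^ᵠ num ℚ.≤ t ^ᵠ den
    nonNegative : 0ℚ ℚ.≤ t

root-bound : ∀ (ε : ℝ) {i} → ε ʳ< ½^ i → ∀ m C r .{{_ : NonZero r}} {t} →
             power m (⌜ (ℤ.+ C) ℚ./ r ⌝ *ⁱ recip ε) t → RootBound m C r (2 ^ i) t
root-bound ε {i} up m C r {t} (s , (_ , u , refl , rec , s≡) , 0≤t , le) = record
  { num = ℤ.∣ ℚ.↥ s ∣ ; den = ℚ.↧ₙ s
  ; steep = fromℕ-cancel (begin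
      fromℕ (C * 2 ^ i * ℚ.↧ₙ s)                          ≡⟨ trans (fromℕ-* (C * 2 ^ i) (ℚ.↧ₙ s)) (cong (ℚ._* fromℕ (ℚ.↧ₙ s)) (fromℕ-* C (2 ^ i))) ⟩
      fromℕ C ℚ.* fromℕ (2 ^ i) ℚ.* fromℕ (ℚ.↧ₙ s)        ≤⟨ ℚ.*-monoʳ-≤-nonNeg (fromℕ (ℚ.↧ₙ s)) {{ℚ.nonNegative (0≤fromℕ (ℚ.↧ₙ s))}} (ℚ.*-monoˡ-≤-nonNeg (fromℕ C) {{ℚ.nonNegative (0≤fromℕ C)}} large) ⟩
      fromℕ C ℚ.* u ℚ.* fromℕ (ℚ.↧ₙ s)                    ≡⟨ cong (ℚ._* fromℕ (ℚ.↧ₙ s)) Cu≡rs ⟩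
      fromℕ r ℚ.* s ℚ.* fromℕ (ℚ.↧ₙ s)                    ≡⟨ trans (ℚ.*-assoc (fromℕ r) s _) (cong (fromℕ r ℚ.*_) (trans (ℚ.*-comm s _) (numerator-≥ s 0≤s))) ⟩
      fromℕ r ℚ.* fromℕ ℤ.∣ ℚ.↥ s ∣                       ≡⟨ sym (fromℕ-* r ℤ.∣ ℚ.↥ s ∣) ⟩
      fromℕ (r * ℤ.∣ ℚ.↥ s ∣)                             ∎)
  ; dominates = le ; nonNegative = 0≤t }
  where
  open ℚ.≤-Reasoning
  large = recip-large ε up rec
  0≤u : 0ℚ ℚ.≤ u
  0≤u = ℚ.≤-trans (0≤fromℕ (2 ^ i)) large
  rC/r : fromℕ r ℚ.* ((ℤ.+ C) ℚ./ r) ≡ fromℕ C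
  rC/r = go r
    where
    go : ∀ r .{{_ : NonZero r}} → fromℕ r ℚ.* ((ℤ.+ C) ℚ./ r) ≡ fromℕ C
    go (suc r) = ℚ.toℚᵘ-injective (R.begin
      ℚ.toℚᵘ (fromℕ (suc r) ℚ.* ((ℤ.+ C) ℚ./ suc r))            R.≈⟨ ℚ.toℚᵘ-homo-* (fromℕ (suc r)) ((ℤ.+ C) ℚ./ suc r) ⟩
      ℚ.toℚᵘ (fromℕ (suc r)) ℚᵘ.* ℚ.toℚᵘ ((ℤ.+ C) ℚ./ suc r)    R.≈⟨ ℚᵘ.*-cong (toℚᵘ-fromℕ (suc r)) (ℚ.toℚᵘ-fromℚᵘ (mkℚᵘ (ℤ.+ C) r)) ⟩
      mkℚᵘ (ℤ.+ suc r) 0 ℚᵘ.* mkℚᵘ (ℤ.+ C) r                    R.≈⟨ *≡* (trans (ℤ.*-identityʳ _) (trans (ℤ.*-comm (ℤ.+ suc r) (ℤ.+ C)) (cong (λ y → ℤ.+ C ℤ.* ℤ.+ suc y) (sym (+-identityʳ r))))) ⟩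
      mkℚᵘ (ℤ.+ C) 0                                            R.≈⟨ ℚᵘ.≃-sym (toℚᵘ-fromℕ C) ⟩
      ℚ.toℚᵘ (fromℕ C)                                          R.∎)
      where import Relation.Binary.Reasoning.Setoid ℚᵘ.≃-setoid as R
  Cu≡rs : fromℕ C ℚ.* u ≡ fromℕ r ℚ.* s
  Cu≡rs = trans (cong (ℚ._* u) (sym rC/r)) (trans (ℚ.*-assoc (fromℕ r) _ u) (cong (fromℕ r ℚ.*_) (sym s≡)))
  0≤s : 0ℚ ℚ.≤ s
  0≤s = ℚ.*-cancelˡ-≤-pos (fromℕ r) {{fromℕ-pos (>-nonZero⁻¹ r)}} (ℚ.≤-trans (ℚ.≤-reflexive (ℚ.*-zeroʳ (fromℕ r))) (ℚ.≤-trans (0≤* (0≤fromℕ C) 0≤u) (ℚ.≤-reflexive Cu≡rs)))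

module _ {m C r B : ℕ} {t : ℚ} (rb : RootBound m C r B t) (0<m : 0 < m) where
  open RootBound rb
  open ℚ.≤-Reasoning

  private instance
    m≢0 : NonZero m
    m≢0 = >-nonZero 0<m

  1≤root : fromℕ 1 ℚ.≤ t
  1≤root = ^ᵠ-cancel den nonNegative (begin
    fromℕ 1 ^ᵠ den          ≡⟨ sym (fromℕ-^ 1 den) ⟩
    fromℕ (1 ^ den)         ≤⟨ fromℕ-mono (≤-trans (≤-reflexive (^-zeroˡ den)) (m^n>0 m num)) ⟩
    fromℕ (m ^ num)         ≡⟨ fromℕ-^ m num ⟩
    fromℕ m ^ᵠ num          ≤⟨ dominates ⟩
    t ^ᵠ den                ∎)

  m≤root : den ≤ num → fromℕ m ℚ.≤ t
  m≤root le = ^ᵠ-cancel den nonNegative (begin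
    fromℕ m ^ᵠ den          ≡⟨ sym (fromℕ-^ m den) ⟩
    fromℕ (m ^ den)         ≤⟨ fromℕ-mono (^-monoʳ-≤ m le) ⟩
    fromℕ (m ^ num)         ≡⟨ fromℕ-^ m num ⟩
    fromℕ m ^ᵠ num          ≤⟨ dominates ⟩
    t ^ᵠ den                ∎)

  -- The hypotheses say x ≤ 8 m^(e/Y) and e/Y ≤ num/den. Comparing powers with exponent `den * Y`
  -- avoids roots.
  x≤8root : ∀ {x Y e} .{{_ : NonZero Y}} → x ^ Y ≤ 8 ^ Y * m ^ e → e * den ≤ Y * num → fromℕ x ℚ.≤ fromℕ 8 ℚ.* t
  x≤8root {x} {Y} {e} x^Y≤ le = ^ᵠ-cancel (den * Y) {{m*n≢0 den Y}} (0≤* (0≤fromℕ 8) nonNegative) (begin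
    fromℕ x ^ᵠ (den * Y)                          ≡⟨ sym (fromℕ-^ x (den * Y)) ⟩
    fromℕ (x ^ (den * Y))                         ≤⟨ fromℕ-mono exponents ⟩
    fromℕ (8 ^ (den * Y) * m ^ (Y * num))         ≡⟨ trans (fromℕ-* (8 ^ (den * Y)) _) (cong₂ ℚ._*_ (fromℕ-^ 8 (den * Y)) (fromℕ-^ m (Y * num))) ⟩
    fromℕ 8 ^ᵠ (den * Y) ℚ.* fromℕ m ^ᵠ (Y * num) ≡⟨ cong (fromℕ 8 ^ᵠ (den * Y) ℚ.*_) (sym (^ᵠ-* (fromℕ m) num Y)) ⟩
    fromℕ 8 ^ᵠ (den * Y) ℚ.* (fromℕ m ^ᵠ num) ^ᵠ Y ≤⟨ ℚ.*-monoˡ-≤-nonNeg (fromℕ 8 ^ᵠ (den * Y)) {{ℚ.nonNegative (0≤^ᵠ (0≤fromℕ 8) (den * Y))}}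
                                                       (^ᵠ-mono (0≤^ᵠ (0≤fromℕ m) num) dominates Y) ⟩
    fromℕ 8 ^ᵠ (den * Y) ℚ.* (t ^ᵠ den) ^ᵠ Y      ≡⟨ cong (fromℕ 8 ^ᵠ (den * Y) ℚ.*_) (trans (^ᵠ-* t den Y) (cong (t ^ᵠ_) (*-comm Y den))) ⟩
    fromℕ 8 ^ᵠ (den * Y) ℚ.* t ^ᵠ (den * Y)       ≡⟨ sym (^ᵠ-distrib (fromℕ 8) t (den * Y)) ⟩
    (fromℕ 8 ℚ.* t) ^ᵠ (den * Y)                  ∎)
    where
    exponents : x ^ (den * Y) ≤ 8 ^ (den * Y) * m ^ (Y * num)
    exponents = N.begin
      x ^ (den * Y)                       N.≡⟨ trans (cong (x ^_) (*-comm den Y)) (sym (^-*-assoc x Y den)) ⟩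
      (x ^ Y) ^ den                       N.≤⟨ ^-monoˡ-≤ den x^Y≤ ⟩
      (8 ^ Y * m ^ e) ^ den               N.≡⟨ ^-distribʳ-* (8 ^ Y) (m ^ e) den ⟩
      (8 ^ Y) ^ den * (m ^ e) ^ den       N.≡⟨ cong₂ _*_ (trans (^-*-assoc 8 Y den) (cong (8 ^_) (*-comm Y den))) (^-*-assoc m e den) ⟩
      8 ^ (den * Y) * m ^ (e * den)       N.≤⟨ *-monoʳ-≤ (8 ^ (den * Y)) (^-monoʳ-≤ m le) ⟩
      8 ^ (den * Y) * m ^ (Y * num)       N.∎
      where module N = ≤-Reasoning

-- x is the pruning cost, later 2^(3 γ) or m. Bounding it by 8 t rather than by t moves a factor 8
-- into the leading constant.
communication-transfer : ∀ (P : Parameters) (let open Parameters P) {i} → ε ʳ< ½^ i → ∀ {comm C C₁ c x} →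
  comm ≤ C₁ * (k * (2 ^ i) ^ 4 * x) * suc ⌈log₂ (n + m) ⌉ ^ c → 8 * C₁ ≤ C → c ≤ C →
  (∀ {t} → RootBound m C r (2 ^ i) t → fromℕ x ℚ.≤ fromℕ 8 ℚ.* t) →
  fromℕ comm ≤ⁱ communicationBound P C
communication-transfer P {i} up {comm} {C} {C₁} {c} {x} comm≤ 8C₁≤C c≤C x≤8t _
  (_ , _ , (_ , _ , refl , (_ , _ , (_ , t , (_ , _ , refl , (u , rec , refl) , refl) , pow , refl) , refl , refl) , refl) , refl , refl) = begin
    fromℕ comm                                                        ≤⟨ fromℕ-mono comm≤ ⟩
    fromℕ (C₁ * (k * B ^ 4 * x) * Λ ^ c)                              ≤⟨ fromℕ-mono (*-monoʳ-≤ (C₁ * (k * B ^ 4 * x)) (^-monoʳ-≤ Λ c≤C)) ⟩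
    fromℕ (C₁ * (k * B ^ 4 * x) * Λ ^ C)                              ≡⟨ trans (fromℕ-* (C₁ * (k * B ^ 4 * x)) (Λ ^ C)) (cong (ℚ._* fromℕ (Λ ^ C)) (trans (fromℕ-* C₁ (k * B ^ 4 * x)) (cong (fromℕ C₁ ℚ.*_) (trans (fromℕ-* (k * B ^ 4) x) (cong (ℚ._* fromℕ x) (trans (fromℕ-* k (B ^ 4)) (cong (fromℕ k ℚ.*_) (fromℕ-^ B 4)))))))) ⟩
    fromℕ C₁ ℚ.* (fromℕ k ℚ.* fromℕ B ^ᵠ 4 ℚ.* fromℕ x) ℚ.* fromℕ (Λ ^ C)
      ≤⟨ mono-Λ (ℚ.*-monoˡ-≤-nonNeg (fromℕ C₁) {{ℚ.nonNegative (0≤fromℕ C₁)}}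
           (*-mono-≤ᵠ (0≤fromℕ x) (0≤* (0≤fromℕ k) (0≤^ᵠ 0≤u 4))
             (ℚ.*-monoˡ-≤-nonNeg (fromℕ k) {{ℚ.nonNegative (0≤fromℕ k)}} (^ᵠ-mono (0≤fromℕ B) large 4)) (x≤8t rb))) ⟩
    fromℕ C₁ ℚ.* (fromℕ k ℚ.* u ^ᵠ 4 ℚ.* (fromℕ 8 ℚ.* t)) ℚ.* fromℕ (Λ ^ C)
      ≡⟨ cong (ℚ._* fromℕ (Λ ^ C)) (trans (regroup (fromℕ C₁) (fromℕ k ℚ.* u ^ᵠ 4) (fromℕ 8) t) (cong (ℚ._* (fromℕ k ℚ.* u ^ᵠ 4 ℚ.* t)) (sym (fromℕ-* 8 C₁)))) ⟩
    fromℕ (8 * C₁) ℚ.* (fromℕ k ℚ.* u ^ᵠ 4 ℚ.* t) ℚ.* fromℕ (Λ ^ C)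
      ≤⟨ mono-Λ (*-mono-≤ᵠ (0≤* (0≤* (0≤fromℕ k) (0≤^ᵠ 0≤u 4)) (RootBound.nonNegative rb)) (0≤fromℕ C) (fromℕ-mono 8C₁≤C)
           (ℚ.≤-trans (ℚ.≤-reflexive (sym (ℚ.+-identityʳ _))) (ℚ.+-monoʳ-≤ (fromℕ k ℚ.* u ^ᵠ 4 ℚ.* t) (0≤fromℕ n)))) ⟩
    fromℕ C ℚ.* (fromℕ k ℚ.* u ^ᵠ 4 ℚ.* t ℚ.+ fromℕ n) ℚ.* fromℕ (Λ ^ C) ∎
  where
  open Parameters P
  open ℚ.≤-Reasoning
  B = 2 ^ i
  Λ = suc ⌈log₂ (n + m) ⌉
  large = recip-large ε up rec
  0≤u : 0ℚ ℚ.≤ u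
  0≤u = ℚ.≤-trans (0≤fromℕ B) large
  rb = root-bound ε up m C r pow
  mono-Λ : ∀ {a b} → a ℚ.≤ b → a ℚ.* fromℕ (Λ ^ C) ℚ.≤ b ℚ.* fromℕ (Λ ^ C)
  mono-Λ = ℚ.*-monoʳ-≤-nonNeg (fromℕ (Λ ^ C)) {{ℚ.nonNegative (0≤fromℕ (Λ ^ C))}}
  regroup : ∀ c y e t → c ℚ.* (y ℚ.* (e ℚ.* t)) ≡ e ℚ.* c ℚ.* (y ℚ.* t)
  regroup = +-*-Solver.solve 4 (λ c y e t → c :* (y :* (e :* t)) := (e :* c) :* (y :* t)) refl
    where open +-*-Solver

-- Accounting for the communication

abstract
  scale : ℕ → ℕ → ℕ → ℕ → ℕ → ℕ → ℕ → ℕ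
  scale c₁ c₂ c₃ c₄ c₅ c₆ e = c₁ * c₂ * c₃ * c₄ * c₅ * c₁ * c₆ * c₂ * e

  scale≡ : ∀ c₁ c₂ c₃ c₄ c₅ c₆ e → scale c₁ c₂ c₃ c₄ c₅ c₆ e ≡ c₁ * c₂ * c₃ * c₄ * c₅ * c₁ * c₆ * c₂ * e
  scale≡ c₁ c₂ c₃ c₄ c₅ c₆ e = refl

-- 512 comes from `top` = 512 B, 4 from Y ≤ 4 Λ and again from x² ≤ 4 B, 2 from the two directions
-- of communication, 1024 and 6 from the volume with its 2^ζ, and 128 from β. The last argument
-- collects the constants of the logarithmic factors.
constant : ℕ → ℕ
constant d = scale 512 4 2 1024 6 128 ((5 * d + 89) * ((d + 2) * (2 * d + 38)))

-- 18432 = 512 · 36: `top` is 512 · 2^i, and 36 is twice the exponent 18 of m in the schedule.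
constant-large : ∀ d → 18432 ≤ constant d
constant-large d = subst (18432 ≤_) (sym (scale≡ 512 4 2 1024 6 128 e)) (≤-trans (≤ᵇ⇒≤ 18432 (512 * 4 * 2 * 1024 * 6 * 512 * 128 * 4) _)
  (m≤m*n (512 * 4 * 2 * 1024 * 6 * 512 * 128 * 4) e {{>-nonZero 0<e}}))
  where
  e = (5 * d + 89) * ((d + 2) * (2 * d + 38))
  0<e : 0 < e
  0<e = *-mono-≤ {1} {5 * d + 89} (≤-trans (s≤s z≤n) (m≤n+m 89 (5 * d)))
    (*-mono-≤ {1} {d + 2} (≤-trans (s≤s z≤n) (m≤n+m 2 d)) (≤-trans (s≤s z≤n) (m≤n+m 38 (2 * d))))

-- 1 + i is about log(1/ε), on which the bound has no polylogarithmic allowance. A factor 2^i, at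
-- most 1/ε, absorbs its square.
square≤4*2^ : ∀ i → suc i * suc i ≤ 4 * 2 ^ i
square≤4*2^ i = ≤-trans (*-monoʳ-≤ (suc i) (n≤1+n (suc i))) (go i)
  where
  open ≤-Reasoning
  go : ∀ i → suc i * suc (suc i) ≤ 4 * 2 ^ i
  go zero          = ≤ᵇ⇒≤ 2 4 _
  go (suc zero)    = ≤ᵇ⇒≤ 6 8 _
  go (suc (suc i)) = begin
    suc (suc (suc i)) * suc (suc (suc (suc i)))   ≤⟨ m≤m+n _ (i * i + 3 * i) ⟩
    suc (suc (suc i)) * suc (suc (suc (suc i))) + (i * i + 3 * i) ≡⟨ expand i ⟩
    2 * (suc (suc i) * suc (suc (suc i)))         ≤⟨ *-monoʳ-≤ 2 (go (suc i)) ⟩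
    2 * (4 * 2 ^ suc i)                           ≡⟨ shuffle (2 ^ suc i) ⟩
    4 * 2 ^ suc (suc i)                           ∎
    where
    expand : ∀ i → suc (suc (suc i)) * suc (suc (suc (suc i))) + (i * i + 3 * i) ≡ 2 * (suc (suc i) * suc (suc (suc i)))
    expand = solve-∀
    shuffle : ∀ y → 2 * (4 * y) ≡ 4 * (2 * y)
    shuffle = solve-∀

-- c₁, …, c₆ are instantiated by numerals.
module _ {c₁ c₂ c₃ c₄ c₅ c₆ e₁ e₂ e₃ k B G Λ x : ℕ} (x²≤ : x * x ≤ c₂ * B) where
  private
    assemble : ∀ c₁ c₂ c₃ c₄ c₅ c₆ e₁ e₂ e₃ k B G Λ x →
      c₁ * B * (c₂ * Λ) * (c₃ * (Λ * (G * c₄ * (c₅ * (k * (e₁ * (Λ * x)))) * (c₁ * B * (c₆ * B * (e₂ * Λ)))) * (e₃ * (Λ * x))))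
      ≡ c₁ * c₂ * c₃ * c₄ * c₅ * c₁ * c₆ * (e₁ * (e₂ * e₃)) * (k * (B * B * B * (x * x)) * G) * (Λ * (Λ * (Λ * (Λ * (Λ * 1)))))
    assemble = solve-∀

    absorb-square : ∀ c c₂ e k B G y → c * e * (k * (B * B * B * (c₂ * B)) * G) * y ≡ c * c₂ * e * (k * (B * (B * (B * (B * 1)))) * G) * y
    absorb-square = solve-∀

  -- The five factors Λ belong to the rounds per threshold, the levels, 2^ζ, β and the bits per
  -- element. Three of the factors B belong to the number of thresholds, `top` and β; the fourth
  -- replaces the x² arising from 2^ζ and the bits.
  budget : ∀ {a b c e} → a ≤ c₁ * B → b ≤ c₂ * Λ → c ≤ G * c₄ * (c₅ * (k * (e₁ * (Λ * x)))) * (c₁ * B * (c₆ * B * (e₂ * Λ))) → e ≤ e₃ * (Λ * x) →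
           a * b * (c₃ * (Λ * c * e)) ≤ scale c₁ c₂ c₃ c₄ c₅ c₆ (e₁ * (e₂ * e₃)) * (k * B ^ 4 * G) * Λ ^ 5
  budget {a} {b} {c} {e} a≤ b≤ c≤ e≤ = begin
    a * b * (c₃ * (Λ * c * e))   ≤⟨ *-mono-≤ (*-mono-≤ a≤ b≤) (*-monoʳ-≤ c₃ (*-mono-≤ (*-monoʳ-≤ Λ c≤) e≤)) ⟩
    _                            ≡⟨ assemble c₁ c₂ c₃ c₄ c₅ c₆ e₁ e₂ e₃ k B G Λ x ⟩
    K * (k * (B * B * B * (x * x)) * G) * Λ ^ 5   ≤⟨ *-monoˡ-≤ (Λ ^ 5) (*-monoʳ-≤ K (*-monoˡ-≤ G (*-monoʳ-≤ k (*-monoʳ-≤ (B * B * B) x²≤)))) ⟩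
    K * (k * (B * B * B * (c₂ * B)) * G) * Λ ^ 5  ≡⟨ absorb-square (c₁ * c₂ * c₃ * c₄ * c₅ * c₁ * c₆) c₂ (e₁ * (e₂ * e₃)) k B G (Λ ^ 5) ⟩
    c₁ * c₂ * c₃ * c₄ * c₅ * c₁ * c₆ * c₂ * (e₁ * (e₂ * e₃)) * (k * B ^ 4 * G) * Λ ^ 5
                                 ≡⟨ cong (λ y → y * (k * B ^ 4 * G) * Λ ^ 5) (sym (scale≡ c₁ c₂ c₃ c₄ c₅ c₆ (e₁ * (e₂ * e₃)))) ⟩
    scale c₁ c₂ c₃ c₄ c₅ c₆ (e₁ * (e₂ * e₃)) * (k * B ^ 4 * G) * Λ ^ 5 ∎
    where
    open ≤-Reasoning
    K = c₁ * c₂ * c₃ * c₄ * c₅ * c₁ * c₆ * (e₁ * (e₂ * e₃))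

module Budget (d n m k i γ Y : ℕ) (0<k : 0 < k) (Y≤ : Y ≤ 4 * suc ⌈log₂ (n + m) ⌉) where

  open Constants d n m k (2 + i) γ Y
  open Config config using (span; volume; ζ)
  open ≤-Reasoning

  B Λ x e₁ e₂ e₃ : ℕ
  B  = 2 ^ i
  Λ  = suc lg
  x  = suc i
  e₁ = 5 * d + 89
  e₂ = d + 2
  e₃ = 2 * d + 38

  A≡128B : A ≡ 128 * B
  A≡128B = trans (^-distribˡ-+-* 2 (2 + i) 5) (shuffle B)
    where
    shuffle : ∀ b → 2 * (2 * b) * 32 ≡ 128 * b
    shuffle = solve-∀

  top≡ : top ≡ 512 * B
  top≡ = trans (cong (4 *_) A≡128B) (sym (*-assoc 4 128 B))

  ν≤ : ν ≤ (d + 18) * (Λ * x)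
  ν≤ = begin
    lg + ((2 + i + 5) + (lg + ((2 + i + 5) + (d + 2) * suc lg)))    ≤⟨ m≤m+n _ (2 * lg + (2 * lg + 12 * i + 16 * (lg * i)) + ((d + 2) * (i + lg * i)) + 2) ⟩
    lg + ((2 + i + 5) + (lg + ((2 + i + 5) + (d + 2) * suc lg))) + (2 * lg + (2 * lg + 12 * i + 16 * (lg * i)) + ((d + 2) * (i + lg * i)) + 2)
                                                                    ≤⟨ m≤m+n _ (10 * lg + 2 * i) ⟩
    _                                                               ≡⟨ expand d lg i ⟩
    (d + 18) * (suc lg * suc i)                                     ∎
    where
    expand : ∀ d lg i → lg + ((2 + i + 5) + (lg + ((2 + i + 5) + (d + 2) * suc lg))) + (2 * lg + (2 * lg + 12 * i + 16 * (lg * i)) + ((d + 2) * (i + lg * i)) + 2) + (10 * lg + 2 * i)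
             ≡ (d + 18) * (suc lg * suc i)
    expand = solve-∀

  w≤ : suc w ≤ e₃ * (Λ * x)
  w≤ = begin
    suc (lg + (lg + ν) + ν)               ≡⟨ shuffle₁ lg ν ⟩
    (1 + 2 * lg) + 2 * ν                  ≤⟨ +-mono-≤ (m≤m+n (1 + 2 * lg) (1 + 2 * i + 2 * (lg * i))) (*-monoʳ-≤ 2 ν≤) ⟩
    (1 + 2 * lg) + (1 + 2 * i + 2 * (lg * i)) + 2 * ((d + 18) * (suc lg * suc i)) ≡⟨ shuffle₂ d lg i ⟩
    (2 * d + 38) * (suc lg * suc i)       ∎
    where
    shuffle₁ : ∀ l v → suc (l + (l + v) + v) ≡ (1 + 2 * l) + 2 * v
    shuffle₁ = solve-∀
    shuffle₂ : ∀ d l i → (1 + 2 * l) + (1 + 2 * i + 2 * (l * i)) + 2 * ((d + 18) * (suc l * suc i)) ≡ (2 * d + 38) * (suc l * suc i)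
    shuffle₂ = solve-∀

  L₂≤ : L₂ ≤ e₁ * (Λ * x)
  L₂≤ = begin
    lg + (2 + i + 7) + (lg + 2) + (lg + (suc ν + suc ν)) + (lg + (suc ν + suc ν) + 1) + (d * lg + 1) ≡⟨ shuffle₁ d lg i ν ⟩
    (4 * lg + 17 + i + d * lg) + 4 * ν    ≤⟨ +-mono-≤ (m≤m+n (4 * lg + 17 + i + d * lg) (13 * lg + 16 * i + 17 * (lg * i) + d * (1 + i + lg * i))) (*-monoʳ-≤ 4 ν≤) ⟩
    (4 * lg + 17 + i + d * lg) + (13 * lg + 16 * i + 17 * (lg * i) + d * (1 + i + lg * i)) + 4 * ((d + 18) * (suc lg * suc i)) ≡⟨ shuffle₂ d lg i ⟩
    (5 * d + 89) * (suc lg * suc i)       ∎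
    where
    shuffle₁ : ∀ d l i v → l + (2 + i + 7) + (l + 2) + (l + (suc v + suc v)) + (l + (suc v + suc v) + 1) + (d * l + 1) ≡ (4 * l + 17 + i + d * l) + 4 * v
    shuffle₁ = solve-∀
    shuffle₂ : ∀ d l i → (4 * l + 17 + i + d * l) + (13 * l + 16 * i + 17 * (l * i) + d * (1 + i + l * i)) + 4 * ((d + 18) * (suc l * suc i)) ≡ (5 * d + 89) * (suc l * suc i)
    shuffle₂ = solve-∀

  0<t₂ : 0 < t₂
  0<t₂ = *-mono-≤ 0<k (≤-trans (m≤n+m 1 (d * lg)) (m≤n+m (d * lg + 1) (lg + (2 + i + 7) + (lg + 2) + κ + (κ + 1))))

  2^ζ≤ : 2 ^ ζ ≤ 6 * (k * (e₁ * (Λ * x)))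
  2^ζ≤ = begin
    2 ^ ζ                             ≤⟨ proj₂ (proj₂ rounding) ⟩
    2 * suc (2 * t₂)                  ≤⟨ *-monoʳ-≤ 2 (+-monoˡ-≤ (2 * t₂) 0<t₂) ⟩
    2 * (t₂ + 2 * t₂)                 ≡⟨ shuffle t₂ ⟩
    6 * t₂                            ≤⟨ *-monoʳ-≤ 6 (*-monoʳ-≤ k L₂≤) ⟩
    6 * (k * (e₁ * (Λ * x)))          ∎
    where
    shuffle : ∀ t → 2 * (t + 2 * t) ≡ 6 * t
    shuffle = solve-∀

  G : ℕ
  G = 2 ^ (3 * γ)

  volume≡ : volume ≡ G * 1024 * 2 ^ ζ * (top * β)
  volume≡ = cong (_* (top * β)) (trans (^-distribˡ-+-* 2 (3 * γ + 10) ζ) (cong (_* 2 ^ ζ) (^-distribˡ-+-* 2 (3 * γ) 10)))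

  β≡ : β ≡ 128 * B * (e₂ * Λ)
  β≡ = cong (_* (e₂ * Λ)) A≡128B

  volume≤ : volume ≤ G * 1024 * (6 * (k * (e₁ * (Λ * x)))) * (512 * B * (128 * B * (e₂ * Λ)))
  volume≤ = ≤-trans (≤-reflexive volume≡) (*-mono-≤ (*-monoʳ-≤ (G * 1024) 2^ζ≤) (≤-reflexive (cong₂ _*_ top≡ β≡)))

  total : ∀ {a b c e} → a ≤ 512 * B → b ≤ 4 * Λ → c ≤ G * 1024 * (6 * (k * (e₁ * (Λ * x)))) * (512 * B * (128 * B * (e₂ * Λ))) → e ≤ e₃ * (Λ * x) →
          a * b * (2 * (Λ * c * e)) ≤ constant d * (k * B ^ 4 * G) * Λ ^ 5
  total = budget {512} {4} {2} {1024} {6} {128} {e₁} {e₂} {e₃} {k} {B} {G} {Λ} {x} (square≤4*2^ i)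

  topβ≤ : top * β ≤ 512 * B * (128 * B * (e₂ * Λ))
  topβ≤ = ≤-reflexive (cong₂ _*_ top≡ β≡)

  width : ℕ
  width = k * span (top * β)

  k≤t₂ : k ≤ t₂
  k≤t₂ = m≤m*n k L₂ {{>-nonZero (≤-trans (m≤n+m 1 (d * lg)) (m≤n+m (d * lg + 1) (lg + (2 + i + 7) + (lg + 2) + κ + (κ + 1))))}}

  k≤2^ζ : k ≤ 2 ^ ζ
  k≤2^ζ = ≤-trans k≤t₂ (≤-trans (≤-trans (m≤m+n t₂ (t₂ + 0)) (n≤1+n (2 * t₂))) (proj₁ (proj₂ rounding)))

  -- So summaries are no dearer than messages. The inequality is strict to leave room for the bit
  -- that accompanies each covering.
  width<volume : 0 < top * β → width < volume
  width<volume 0<X = begin-strict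
    k * (2 ^ (γ + 2) * X)             ≤⟨ *-monoˡ-≤ (2 ^ (γ + 2) * X) k≤2^ζ ⟩
    y                                 <⟨ m<m+n y {y + 0} (≤-trans 0<y (m≤m+n y 0)) ⟩
    2 * y                             ≡⟨ shuffle (2 ^ ζ) (2 ^ (γ + 2)) X ⟩
    2 * 2 ^ (γ + 2) * 2 ^ ζ * X       ≡⟨ cong (_* X) (sym (^-distribˡ-+-* 2 (suc (γ + 2)) ζ)) ⟩
    2 ^ (suc (γ + 2) + ζ) * X         ≤⟨ *-monoˡ-≤ X (^-monoʳ-≤ 2 (+-monoˡ-≤ ζ exponent)) ⟩
    volume                            ∎
    where
    X = top * β
    y = 2 ^ ζ * (2 ^ (γ + 2) * X)
    0<y : 0 < y
    0<y = *-mono-≤ (m^n>0 2 ζ) (*-mono-≤ (m^n>0 2 (γ + 2)) 0<X)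
    shuffle : ∀ z g x → 2 * (z * (g * x)) ≡ 2 * g * z * x
    shuffle = solve-∀
    exponent : suc (γ + 2) ≤ 3 * γ + 10
    exponent = begin
      suc (γ + 2)                     ≡⟨ sym (+-suc γ 2) ⟩
      γ + 3                           ≤⟨ +-mono-≤ (m≤m+n γ (γ + (γ + 0))) (m≤m+n 3 7) ⟩
      3 * γ + 10                      ∎

  interactive-bits : 0 < top * β → top * Y * (Lv * volume * suc w + Lv * suc width * suc w) ≤ constant d * (k * B ^ 4 * 2 ^ (3 * γ)) * Λ ^ 5
  interactive-bits 0<X = ≤-trans (*-monoʳ-≤ (top * Y) (begin
    Λ * volume * suc w + Λ * suc width * suc w  ≤⟨ +-monoʳ-≤ (Λ * volume * suc w) (*-monoˡ-≤ (suc w) (*-monoʳ-≤ Λ (width<volume 0<X))) ⟩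
    Λ * volume * suc w + Λ * volume * suc w     ≡⟨ cong (Λ * volume * suc w +_) (sym (+-identityʳ (Λ * volume * suc w))) ⟩
    2 * (Λ * volume * suc w)                    ∎)) (total (≤-reflexive top≡) Y≤ volume≤ w≤)

  -- The same budget, with m in the place of 2^(3 γ) and r in that of `top * Y`.
  central-bits : ∀ {r} → r ≤ top → r * (Lv * m * cap * suc w) ≤ constant d * (k * B ^ 4 * m) * Λ ^ 5
  central-bits {r} r≤ = begin
    r * (Λ * m * cap * suc w)                 ≤⟨ m≤m+n _ _ ⟩
    2 * (r * (Λ * m * cap * suc w))           ≡⟨ shuffle r Λ m cap (suc w) ⟩
    r * 1 * (2 * (Λ * (m * cap) * suc w))     ≤⟨ budget {512} {4} {2} {1024} {6} {128} {e₁} {e₂} {e₃} {k} {B} {m} {Λ} {x} (square≤4*2^ i)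
                                                   (≤-trans r≤ (≤-reflexive top≡)) (s≤s z≤n) mcap≤ w≤ ⟩
    constant d * (k * B ^ 4 * m) * Λ ^ 5      ∎
    where
    shuffle : ∀ r l m c w → 2 * (r * (l * m * c * w)) ≡ r * 1 * (2 * (l * (m * c) * w))
    shuffle = solve-∀
    k≤ : k ≤ 1024 * (6 * (k * (e₁ * (Λ * x))))
    k≤ = ≤-trans (m≤m*n k (e₁ * (Λ * x)) {{>-nonZero (*-mono-≤ {1} {e₁} (≤-trans (s≤s z≤n) (m≤n+m 89 (5 * d))) (*-mono-≤ {1} {Λ} {1} {x} (s≤s z≤n) (s≤s z≤n)))}})
      (≤-trans (m≤n*m (k * (e₁ * (Λ * x))) 6) (m≤n*m (6 * (k * (e₁ * (Λ * x)))) 1024))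
    mcap≤ : m * cap ≤ m * 1024 * (6 * (k * (e₁ * (Λ * x)))) * (512 * B * (128 * B * (e₂ * Λ)))
    mcap≤ = begin
      m * cap                                 ≡⟨ cong (m *_) cap≡ ⟩
      m * (k * (top * β))                     ≤⟨ *-monoʳ-≤ m (*-mono-≤ k≤ topβ≤) ⟩
      m * (1024 * (6 * (k * (e₁ * (Λ * x)))) * (512 * B * (128 * B * (e₂ * Λ)))) ≡⟨ regroup m 1024 (6 * (k * (e₁ * (Λ * x)))) (512 * B * (128 * B * (e₂ * Λ))) ⟩
      m * 1024 * (6 * (k * (e₁ * (Λ * x)))) * (512 * B * (128 * B * (e₂ * Λ))) ∎
      where
      regroup : ∀ m a b c → m * (a * b * c) ≡ m * a * b * c
      regroup = solve-∀

-- How many rounds Y to spend on each of the top thresholds, at pruning factor about 2^γ per round.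
record Schedule (n m k r top : ℕ) : Set where
  field
    γ Y    : ℕ
    0<Y    : 0 < Y
    Y≤     : Y ≤ 4 * suc ⌈log₂ (n + m) ⌉
    wide   : 2 * m * k < 2 ^ (γ * Y)
    regime : r ≤ top ⊎ (top * Y ≤ r × (γ ≡ 1 ⊎ ((2 ^ (3 * γ)) ^ Y ≤ 8 ^ Y * m ^ 18 × r ≤ 2 * Y * top)))

-- 2^h exceeds 2 m k, so h rounds per threshold suffice at γ = 1. With fewer, Y = r/top and γ = 1 +
-- h/Y, whence γ Y ≤ Y + h; since 2^h ≤ 16 m² ≤ m^6, this gives 2^(3 γ Y) ≤ 8^Y m^18. Rounding r/top
-- down loses at most a factor of two.
schedule : ∀ n m k r top .{{_ : NonZero top}} → 0 < k → k < m → Schedule n m k r top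
schedule n m k r top 0<k k<m = choose (r / top) refl
  where
  open ≤-Reasoning
  0<m : 0 < m
  0<m = ≤-trans (s≤s z≤n) k<m
  2≤m : 2 ≤ m
  2≤m = ≤-trans (s≤s 0<k) k<m
  lg = ⌈log₂ (n + m) ⌉
  logarithm = round-log m 0<m
  μ = proj₁ logarithm
  h = 2 * μ + 2
  μ≤ : μ ≤ suc lg
  μ≤ = ≮⇒≥ (λ lt → <⇒≱ (^-monoʳ-< 2 (s≤s (s≤s z≤n)) lt) (≤-trans (proj₂ (proj₂ logarithm)) (*-monoʳ-≤ 2 (≤-trans (m≤n+m m n) (n≤2^⌈log₂n⌉ (n + m))))))
  h≤ : h ≤ 4 * suc lg
  h≤ = begin
    2 * μ + 2                   ≤⟨ +-mono-≤ (*-monoʳ-≤ 2 μ≤) (*-monoʳ-≤ 2 {1} {suc lg} (s≤s z≤n)) ⟩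
    2 * suc lg + 2 * suc lg     ≡⟨ sym (*-distribʳ-+ (suc lg) 2 2) ⟩
    4 * suc lg                  ∎
  enough : ∀ {e} → h ≤ e → 2 * m * k < 2 ^ e
  enough {e} h≤e = begin-strict
    2 * m * k                   ≤⟨ *-mono-≤ (*-monoʳ-≤ 2 (proj₁ (proj₂ logarithm))) (≤-trans (<⇒≤ k<m) (proj₁ (proj₂ logarithm))) ⟩
    2 * p * p                   <⟨ m<m+n (2 * p * p) {2 * p * p} (*-mono-≤ (*-mono-≤ {1} {2} (s≤s z≤n) (m^n>0 2 μ)) (m^n>0 2 μ)) ⟩
    2 * p * p + 2 * p * p       ≡⟨ shuffle p ⟩
    p * p * 4                   ≡⟨ sym (trans (^-distribˡ-+-* 2 (2 * μ) 2) (cong (_* 4) (trans (cong (λ y → 2 ^ (μ + y)) (+-identityʳ μ)) (^-distribˡ-+-* 2 μ μ)))) ⟩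
    2 ^ h                       ≤⟨ ^-monoʳ-≤ 2 h≤e ⟩
    2 ^ e                       ∎
    where
    p = 2 ^ μ
    shuffle : ∀ p → 2 * p * p + 2 * p * p ≡ p * p * 4
    shuffle = solve-∀
  2^h≤ : 2 ^ h ≤ m ^ 6
  2^h≤ = begin
    2 ^ h                       ≡⟨ trans (^-distribˡ-+-* 2 (2 * μ) 2) (cong (_* 4) (trans (cong (λ y → 2 ^ (μ + y)) (+-identityʳ μ)) (^-distribˡ-+-* 2 μ μ))) ⟩
    2 ^ μ * 2 ^ μ * 4           ≤⟨ *-monoˡ-≤ 4 (*-mono-≤ (proj₂ (proj₂ logarithm)) (proj₂ (proj₂ logarithm))) ⟩
    2 * m * (2 * m) * 4         ≡⟨ shuffle₁ m 2 ⟩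
    2 * 2 * 2 * 2 * (m * m)     ≤⟨ *-monoˡ-≤ (m * m) (*-mono-≤ (*-mono-≤ (*-mono-≤ 2≤m 2≤m) 2≤m) 2≤m) ⟩
    m * m * m * m * (m * m)     ≡⟨ shuffle₂ m ⟩
    m ^ 6                       ∎
    where
    shuffle₁ : ∀ m c → c * m * (c * m) * 4 ≡ c * c * 2 * 2 * (m * m)
    shuffle₁ = solve-∀
    shuffle₂ : ∀ m → m * m * m * m * (m * m) ≡ m * (m * (m * (m * (m * (m * 1)))))
    shuffle₂ = solve-∀
  r≡ : ∀ {ρ} → r / top ≡ ρ → r < suc ρ * top
  r≡ {ρ} eq = begin-strict
    r                           ≡⟨ m≡m%n+[m/n]*n r top ⟩
    r % top + r / top * top     <⟨ +-monoˡ-< (r / top * top) (m%n<n r top) ⟩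
    top + r / top * top         ≡⟨ cong (λ y → suc y * top) eq ⟩
    suc ρ * top                 ∎
  fits : ∀ {Y} → Y ≤ r / top → top * Y ≤ r
  fits {Y} le = ≤-trans (*-monoʳ-≤ top le) (≤-trans (≤-reflexive (*-comm top (r / top))) (m/n*n≤m r top))
  choose : ∀ ρ → r / top ≡ ρ → Schedule n m k r top
  -- Not even one round per threshold. Here Y counts the rounds that the coordinator simulates on
  -- its own.
  choose zero eq = record { γ = 1 ; Y = h ; 0<Y = ≤-trans (s≤s z≤n) (m≤n+m 2 (2 * μ)) ; Y≤ = h≤ ; wide = enough (≤-reflexive (sym (*-identityˡ h)))
                          ; regime = inj₁ (≤-trans (<⇒≤ (r≡ eq)) (≤-reflexive (*-identityˡ top))) }
  choose (suc ρ) eq = case ≤-total h (suc ρ) of λ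
    { (inj₁ h≤ρ) → record { γ = 1 ; Y = h ; 0<Y = ≤-trans (s≤s z≤n) (m≤n+m 2 (2 * μ)) ; Y≤ = h≤ ; wide = enough (≤-reflexive (sym (*-identityˡ h)))
                          ; regime = inj₂ (fits (≤-trans h≤ρ (≤-reflexive (sym eq))) , inj₁ refl) }
    ; (inj₂ ρ≤h) → record { γ = γ′ ; Y = Y′ ; 0<Y = s≤s z≤n ; Y≤ = ≤-trans ρ≤h h≤ ; wide = enough h≤γY
                          ; regime = inj₂ (fits (≤-reflexive (sym eq)) , inj₂ (power≤ , r≤)) } }
    where
    Y′ = suc ρ
    γ′ = suc (h / Y′)
    h≤γY : h ≤ γ′ * Y′
    h≤γY = ≤-trans (≤-reflexive (m≡m%n+[m/n]*n h Y′)) (+-monoˡ-≤ (h / Y′ * Y′) (<⇒≤ (m%n<n h Y′)))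
    γY≤ : γ′ * Y′ ≤ Y′ + h
    γY≤ = +-monoʳ-≤ Y′ (m/n*n≤m h Y′)
    power≤ : (2 ^ (3 * γ′)) ^ Y′ ≤ 8 ^ Y′ * m ^ 18
    power≤ = begin
      (2 ^ (3 * γ′)) ^ Y′       ≡⟨ trans (^-*-assoc 2 (3 * γ′) Y′) (cong (2 ^_) (*-assoc 3 γ′ Y′)) ⟩
      2 ^ (3 * (γ′ * Y′))       ≤⟨ ^-monoʳ-≤ 2 (*-monoʳ-≤ 3 γY≤) ⟩
      2 ^ (3 * (Y′ + h))        ≡⟨ trans (cong (2 ^_) (*-distribˡ-+ 3 Y′ h)) (^-distribˡ-+-* 2 (3 * Y′) (3 * h)) ⟩
      2 ^ (3 * Y′) * 2 ^ (3 * h) ≡⟨ cong₂ _*_ (sym (^-*-assoc 2 3 Y′)) (trans (cong (2 ^_) (*-comm 3 h)) (sym (^-*-assoc 2 h 3))) ⟩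
      8 ^ Y′ * (2 ^ h) ^ 3      ≤⟨ *-monoʳ-≤ (8 ^ Y′) (^-monoˡ-≤ 3 2^h≤) ⟩
      8 ^ Y′ * (m ^ 6) ^ 3      ≡⟨ cong (8 ^ Y′ *_) (^-*-assoc m 6 3) ⟩
      8 ^ Y′ * m ^ 18           ∎
    r≤ : r ≤ 2 * Y′ * top
    r≤ = ≤-trans (<⇒≤ (r≡ eq)) (*-monoˡ-≤ top (≤-trans (≤-reflexive (+-comm 1 Y′)) (+-monoʳ-≤ Y′ (s≤s z≤n))))

-- Assembling the algorithm

∉-tabulate : ∀ {n} (P : Fin n → Bool) {x} → ¬ (x Subset.∈ tabulate P) → P x ≡ false
∉-tabulate P {x} x∉ = Bool.¬-not (λ eq → x∉ (Vec.lookup⇒[]= x (tabulate P) (trans (Vec.lookup∘tabulate P x) eq)))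

-- One number serves as leading constant, as coefficient in the exponent of m and as power of the
-- logarithm. The 8 is the one lost in bounding the pruning cost by 8 t.
exponent : ℕ → ℕ
exponent d = 8 * constant d

exponent-large : ∀ d → 8 * 18432 ≤ exponent d
exponent-large d = *-monoʳ-≤ 8 (constant-large d)

module _ (d : ℕ) (P : Parameters) where
  open Parameters P

  Solution : Set
  Solution = Σ[ Π ∈ Protocol n m p ] (∀ (S : Sets n m) (owner : Fin m → Fin p) →
    WithHighProbability (n + m) d (Succeeds P Π S owner (exponent d)))

  private
    prec : Precision ε
    prec = precision ε 0<ε ε<1

    i α : ℕ
    i = Precision.i prec
    α = 2 + i

  0≤bound : ∀ {u} → communicationBound P (exponent d) u → 0ℚ ℚ.≤ u
  0≤bound (_ , _ , (_ , _ , refl , (_ , _ , (_ , t , (_ , _ , refl , (u , rec , refl) , refl) , pow , refl) , refl , refl) , refl) , refl , refl) =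
    0≤* (0≤* (0≤fromℕ (exponent d)) (ℚ.≤-trans (0≤* (0≤* (0≤fromℕ k) (0≤^ᵠ 0≤u 4)) (RootBound.nonNegative (root-bound ε (Precision.above prec) m (exponent d) r pow)))
      (ℚ.≤-trans (ℚ.≤-reflexive (sym (ℚ.+-identityʳ _))) (ℚ.+-monoʳ-≤ (fromℕ k ℚ.* u ^ᵠ 4 ℚ.* t) (0≤fromℕ n))))) (0≤fromℕ (suc ⌈log₂ (n + m) ⌉ ^ exponent d))
    where
    0≤u : 0ℚ ℚ.≤ u
    0≤u = ℚ.≤-trans (0≤fromℕ (2 ^ i)) (recip-large ε (Precision.above prec) rec)

  silent : Subset m → Protocol n m p
  silent chosen = record
    { seeds = 1 ; machine = λ s i vw heard → [] ; summary = λ s hist → [] ; output = λ s hist → chosen }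

  -- For degenerate parameters, where one choice is optimal on every instance and can be output
  -- without communication.
  silent-solution : ∀ chosen → ∣ chosen ∣ ≤ k → (∀ (S : Sets n m) → opt S k ≤ coverage S chosen) → Solution
  silent-solution chosen size best = silent chosen , λ S owner → ⊥ , ≤-trans (≤-reflexive (cong (_* (n + m) ^ d) (Subset.∣⊥∣≡0 1))) z≤n , λ s _ → record
    { approximates = record { size = size ; ratio = ratio-bound ε α {1} (Precision.below prec) (s≤s z≤n) (λ {P} {R} R≤P _ → *-mono-≤ (≤-trans (*-monoˡ-≤ (2 ^ α) (m≤m+n P R)) (m≤m+n ((P + R) * 2 ^ α) P)) (best S)) }
    ; bits = λ u b → ℚ.≤-trans (ℚ.≤-reflexive (cong fromℕ (quiet S owner s))) (0≤bound b) }
    where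
    quiet : ∀ S owner s → Execution.communication (silent chosen) S owner s r ≡ 0
    quiet S owner s = cong₂ _+_ (ups r) (downs (pred r))
      where
      open Execution (silent chosen) S owner s
      zeros : ∀ q → Vec.sum (Vec.map length (tabulate {n = q} (λ _ → [] {A = Bool}))) ≡ 0
      zeros zero    = refl
      zeros (suc q) = zeros q
      ups : ∀ t → Vec.sum (Vec.map (λ ms → Vec.sum (Vec.map length ms)) (sent t)) ≡ 0
      ups zero    = refl
      ups (suc t) = cong₂ _+_ (zeros p) (ups t)
      downs : ∀ t → Vec.sum (Vec.map length (heard t)) ≡ 0
      downs zero    = refl
      downs (suc t) = downs t

  module Proper (0<k : 0 < k) (0<n : 0 < n) (k<m : k < m) (sch : Schedule n m k r (4 * 2 ^ (α + 5))) where
    open Schedule sch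
    open Constants d n m k α γ Y

    Y-small : Y ≤ 2 ^ (lg + 2)
    Y-small = ≤-trans Y≤ (≤-trans (*-monoʳ-≤ 4 (suc≤2^ lg)) (≤-reflexive (trans (*-comm 4 (2 ^ lg)) (sym (^-distribˡ-+-* 2 lg 2)))))

    module _ (S : Sets n m) where
      open Seeds d n m k α γ Y 0<k 0<n k<m 0<Y Y-small S public

      good : ∀ s → s Subset.∉ bad → bad₁ (quotient Sv s) ≡ false × Second.bad₂ (quotient Sv s) (remainder {Su} Sv s) ≡ false
      good s s∉ = ∨-false (∉-tabulate (λ s → bad₁ (quotient Sv s) ∨ Second.bad₂ (quotient Sv s) (remainder {Su} Sv s)) s∉)

    Lv≤ : Lv ≤ 2 ^ lg
    Lv≤ = suc≤2^ lg

    wider : ∀ {x} e → x ≤ 2 ^ e → e ≤ suc w → x ≤ 2 ^ suc w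
    wider e x≤ e≤ = ≤-trans x≤ (^-monoʳ-≤ 2 e≤)

    0<topβ : 0 < top * β
    0<topβ = *-mono-≤ (*-mono-≤ {1} {4} (s≤s z≤n) 0<A) (*-mono-≤ 0<A (*-mono-≤ {1} {d + 2} (≤-trans (s≤s z≤n) (m≤n+m 2 d)) (s≤s {0} {lg} z≤n)))

    0<m : 0 < m
    0<m = ≤-trans (s≤s z≤n) k<m

    -- C B/r with C ≥ 512 · 36 and r ≤ 512 q B leaves num/den ≥ 36/q. For q = 2 Y this is the 18/Y
    -- required by the schedule; for q = 1 it makes the root at least m.
    steep : ∀ {t} (rb : RootBound m (exponent d) r (2 ^ i) t) (let open RootBound rb) {q} → r ≤ q * top → 36 * den ≤ q * num × (q ≡ 1 → den ≤ num)
    steep rb {q} r≤ = scaled , λ { refl → ≤-trans (m≤n*m den 36) (≤-trans scaled (≤-reflexive (*-identityˡ num))) }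
      where
      open RootBound rb
      open ≤-Reasoning
      top≡ : top ≡ 512 * 2 ^ i
      top≡ = Budget.top≡ d n m k i γ Y 0<k Y≤
      s₁ : ∀ b e c B → (b * e) * (c * B) ≡ c * b * B * e
      s₁ = solve-∀
      s₂ : ∀ q t n → q * t * n ≡ q * n * t
      s₂ = solve-∀
      scaled : 36 * den ≤ q * num
      scaled = *-cancelʳ-≤ _ _ top {{>-nonZero (*-mono-≤ {1} {4} (s≤s z≤n) 0<A)}} (begin
        36 * den * top                    ≡⟨ cong (36 * den *_) top≡ ⟩
        36 * den * (512 * 2 ^ i)          ≡⟨ s₁ 36 den 512 (2 ^ i) ⟩
        512 * 36 * 2 ^ i * den            ≤⟨ *-monoˡ-≤ den (*-monoˡ-≤ (2 ^ i) (≤-trans (≤ᵇ⇒≤ (512 * 36) (8 * 18432) _) (exponent-large d))) ⟩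
        exponent d * 2 ^ i * den          ≤⟨ RootBound.steep rb ⟩
        r * num                           ≤⟨ *-monoˡ-≤ num r≤ ⟩
        q * top * num                     ≡⟨ s₂ q top num ⟩
        q * num * top                     ∎)

    transfer : ∀ {comm x} → comm ≤ constant d * (k * (2 ^ i) ^ 4 * x) * suc lg ^ 5 →
               (∀ {t} → RootBound m (exponent d) r (2 ^ i) t → fromℕ x ℚ.≤ fromℕ 8 ℚ.* t) →
               fromℕ comm ≤ⁱ communicationBound P (exponent d)
    transfer comm≤ x≤8t = communication-transfer P (Precision.above prec) {C₁ = constant d} {c = 5} comm≤ ≤-refl
      (≤-trans (≤ᵇ⇒≤ 5 (8 * 18432) _) (exponent-large d)) x≤8t

    1≤8 : ∀ {t} → fromℕ 1 ℚ.≤ t → fromℕ 8 ℚ.≤ fromℕ 8 ℚ.* t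
    1≤8 {t} 1≤t = ℚ.≤-trans (ℚ.≤-reflexive (sym (ℚ.*-identityʳ (fromℕ 8)))) (ℚ.*-monoˡ-≤-nonNeg (fromℕ 8) {{ℚ.nonNegative (0≤fromℕ 8)}} 1≤t)

    t≤8t : ∀ {t} → 0ℚ ℚ.≤ t → t ℚ.≤ fromℕ 8 ℚ.* t
    t≤8t {t} 0≤t = ℚ.≤-trans (ℚ.≤-reflexive (sym (ℚ.*-identityˡ t))) (ℚ.*-monoʳ-≤-nonNeg t {{ℚ.nonNegative 0≤t}} (fromℕ-mono {1} {8} (s≤s z≤n)))

    module Central (r≤top : r ≤ top) where
      module C = Centralised config (top * Y) Lv w Su Sv {n} {m} {p} {N} inst hit choose

      succeeds : ∀ S owner s → s Subset.∉ bad S → Succeeds P C.protocol S owner (exponent d) s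
      succeeds S owner s s∉ = record
        { approximates = subst (IsApproximation (approximationFactor P) S k) (sym (R.result-eq r)) approximation
        ; bits = transfer (≤-trans (R.communication-bound cap (λ j i → cap-size (lift D (S i) ∩ universe u j)) r) (Budget.central-bits d n m k i γ Y 0<k Y≤ r≤top))
            (λ rb → ℚ.≤-trans (m≤root rb 0<m (proj₂ (steep rb {1} (≤-trans r≤top (≤-reflexive (sym (*-identityˡ top))))) refl)) (t≤8t (RootBound.nonNegative rb))) }
        where
        u = quotient Sv s
        v = remainder {Su} Sv s
        module R = C.Run S owner s (full S u) (λ i j x → inst-view S owner u i j x)
          (wider (lg + lg + ν) (*-mono-2^ (lg + lg) ν (*-mono-2^ lg lg Lv≤ (m≤ S)) (N≤ S))
            (≤-trans (≤-trans (≤-reflexive (+-assoc lg lg ν)) (m≤m+n (lg + (lg + ν)) ν)) (n≤1+n w)))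
        module Q = Quality d n m k α γ Y 0<k 0<n k<m 0<Y Y-small wide S (proj₁ (good S s s∉)) (proj₂ (good S s s∉))
        states : Fin Lv → State m N
        states = C.states v (Execution.sent C.protocol S owner s r)
        states-eq : ∀ j → states j ≡ Process.run config (full S u j) (hit v) (top * Y)
        states-eq j = R.states-sent r j
        done = position-done config {{>-nonZero 0<Y}} (top * Y) ≤-refl
        size : ∣ choose u states ∣ ≤ k
        size = Q.choose-size (top * Y) done states states-eq
        ratio : fromℕ (opt S k) ≤ⁱ approximationFactor P *ⁱ ⌜ fromℕ (coverage S (choose u states)) ⌝
        ratio = ratio-bound ε α (Precision.below prec) 0<k (Q.choose-ratio (top * Y) done states states-eq)
        approximation : IsApproximation (approximationFactor P) S k (choose u states)
        approximation = record { size = size ; ratio = ratio }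

      solution : Solution
      solution = C.protocol , λ S owner → bad S , bad-rare S , succeeds S owner

    module Interactive (fits : top * Y ≤ r) (cost : γ ≡ 1 ⊎ ((2 ^ (3 * γ)) ^ Y ≤ 8 ^ Y * m ^ 18 × r ≤ 2 * Y * top)) where
      module C = Coordinator config Lv w Su Sv {n} {m} {p} {N} inst hit choose

      2^3γ≤8t : ∀ {t} → RootBound m (exponent d) r (2 ^ i) t → fromℕ (2 ^ (3 * γ)) ℚ.≤ fromℕ 8 ℚ.* t
      2^3γ≤8t {t} rb = bound cost
        where
        open RootBound rb using (num; den)
        halve : 36 * den ≤ 2 * Y * num → 18 * den ≤ Y * num
        halve le = *-cancelˡ-≤ 2 (≤-trans (≤-reflexive (sym (*-assoc 2 18 den))) (≤-trans le (≤-reflexive (*-assoc 2 Y num))))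
        bound : γ ≡ 1 ⊎ ((2 ^ (3 * γ)) ^ Y ≤ 8 ^ Y * m ^ 18 × r ≤ 2 * Y * top) → fromℕ (2 ^ (3 * γ)) ℚ.≤ fromℕ 8 ℚ.* t
        bound (inj₁ γ≡1) = subst (λ g → fromℕ (2 ^ (3 * g)) ℚ.≤ fromℕ 8 ℚ.* t) (sym γ≡1) (1≤8 (1≤root rb 0<m))
        bound (inj₂ (le , r≤)) = x≤8root rb 0<m {e = 18} {{>-nonZero 0<Y}} le (halve (proj₁ (steep rb {2 * Y} r≤)))

      succeeds : ∀ S owner s → s Subset.∉ bad S → Succeeds P C.protocol S owner (exponent d) s
      succeeds S owner s s∉ = record
        { approximates = subst (IsApproximation (approximationFactor P) S k) (sym (R.result-eq r)) approximation
        ; bits = transfer (≤-trans (B.communication-bound r) (Budget.interactive-bits d n m k i γ Y 0<k Y≤ 0<topβ)) 2^3γ≤8t }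
        where
        u = quotient Sv s
        v = remainder {Su} Sv s
        module R = C.Run S owner s (full S u) (λ i j x → inst-view S owner u i j x)
          (wider (lg + (lg + ν) + ν) (*-mono-2^ (lg + (lg + ν)) ν (*-mono-2^ lg (lg + ν) Lv≤ (*-mono-2^ lg ν (m≤ S) (N≤ S))) (N≤ S)) (n≤1+n w))
          (wider (lg + suc ν) (*-mono-2^ lg (suc ν) Lv≤ (suc-N≤ S)) (≤-trans (≤-reflexive (+-suc lg ν)) (s≤s (+-monoˡ-≤ ν (m≤m+n lg (lg + ν))))))
        module Q = Quality d n m k α γ Y 0<k 0<n k<m 0<Y Y-small wide S (proj₁ (good S s s∉)) (proj₂ (good S s s∉))
        states : Fin Lv → State m N
        states = C.replay (Execution.sent C.protocol S owner s r)
        states-eq : ∀ j → states j ≡ Process.run config (full S u j) (hit v) r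
        states-eq = R.replay-sent r
        module B = R.Bits 0<Y (Config.volume config) (k * Config.span config (top * β))
          (λ t j → Outcome.sent (Q.outcomes t j)) (λ t j → Outcome.small (Q.outcomes t j))
        done = position-done config {{>-nonZero 0<Y}} r fits
        size : ∣ choose u states ∣ ≤ k
        size = Q.choose-size r done states states-eq
        ratio : fromℕ (opt S k) ≤ⁱ approximationFactor P *ⁱ ⌜ fromℕ (coverage S (choose u states)) ⌝
        ratio = ratio-bound ε α (Precision.below prec) 0<k (Q.choose-ratio r done states states-eq)
        approximation : IsApproximation (approximationFactor P) S k (choose u states)
        approximation = record { size = size ; ratio = ratio }

      solution : Solution
      solution = C.protocol , λ S owner → bad S , bad-rare S , succeeds S owner

    solution : Solution
    solution = go regime
      where
      go : r ≤ top ⊎ (top * Y ≤ r × (γ ≡ 1 ⊎ ((2 ^ (3 * γ)) ^ Y ≤ 8 ^ Y * m ^ 18 × r ≤ 2 * Y * top))) → Solution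
      go (inj₁ r≤top)         = Central.solution r≤top
      go (inj₂ (fits , cost)) = Interactive.solution fits cost

  opt-zero : ∀ {S : Sets n m} → k ≡ 0 ⊎ n ≡ 0 → opt S k ≤ coverage S ⊥
  opt-zero {S} zeroed = ≤-trans (≤-trans (proj₂ (proj₂ attained)) (empty zeroed)) z≤n
    where
    attained = opt-attained S k
    chosen = proj₁ attained
    empty : k ≡ 0 ⊎ n ≡ 0 → coverage S chosen ≤ 0
    empty (inj₂ refl) = coverage≤n S chosen
    empty (inj₁ k≡0)  = ≤-trans (Subset.p⊆q⇒∣p∣≤∣q∣ (covered⊆ S {members chosen} chosen ∈-members))
      (≤-reflexive (trans (cong (λ xs → ∣ ⋃ (List.map S xs) ∣) (none (members chosen)
        (trans (length-members chosen) (n≤0⇒n≡0 (subst (∣ chosen ∣ ≤_) k≡0 (proj₁ (proj₂ attained))))))) (Subset.∣⊥∣≡0 n)))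
      where
      none : ∀ {m} (xs : List (Fin m)) → length xs ≡ 0 → xs ≡ []
      none [] refl = refl

  -- Setting aside k = 0, n = 0 and k ≥ m leaves m ≥ 2 and m + 1 ≤ n + m, on which the schedule and
  -- the logarithmic estimates rely.
  solve : Solution
  solve = go (k ≟ 0) (n ≟ 0) (k <? m)
    where
    go : Dec (k ≡ 0) → Dec (n ≡ 0) → Dec (k < m) → Solution
    go (yes k≡0) _ _ = silent-solution ⊥ (≤-trans (≤-reflexive (Subset.∣⊥∣≡0 m)) z≤n) (λ S → opt-zero {S} (inj₁ k≡0))
    go (no _) (yes n≡0) _ = silent-solution ⊥ (≤-trans (≤-reflexive (Subset.∣⊥∣≡0 m)) z≤n) (λ S → opt-zero {S} (inj₂ n≡0))
    go (no _) (no _) (no k≮m) = silent-solution ⊤ (≤-trans (≤-reflexive (Subset.∣⊤∣≡n m)) (≮⇒≥ k≮m))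
      (λ S → ≤-trans (proj₂ (proj₂ (opt-attained S k))) (Subset.p⊆q⇒∣p∣≤∣q∣ (λ x∈ → ⊆covered S {members (proj₁ (opt-attained S k))} ⊤ (λ _ → Subset.∈⊤) (covered⊆ S (proj₁ (opt-attained S k)) ∈-members x∈))))
    go (no k≢0) (no n≢0) (yes k<m) = Proper.solution 0<k (n≢0⇒n>0 n≢0) k<m
      (schedule n m k r (4 * 2 ^ (α + 5)) {{m*n≢0 4 (2 ^ (α + 5)) {{_}} {{m^n≢0 2 (α + 5)}}}} 0<k k<m)
      where
      0<k = n≢0⇒n>0 k≢0

corollary5 : ∀ (d : ℕ) → ∃[ C ] Σ[ A ∈ Algorithm ]
    (∀ (P : Parameters) → let open Parameters P in
    ∀ (S : Sets n m) (owner : Fin m → Fin p) →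
    WithHighProbability (n + m) d (Succeeds P (A P) S owner C))
corollary5 d = exponent d , (λ P → proj₁ (solve d P)) , λ P → proj₂ (solve d P)
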